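{- The system $\textsf{P}_0+\Pi^0_1\text{ - }\textsf{TRANS}+\textsf{STP}$ proves $\textsf{ATR}_0^{\text{st}}$.
   Context: Types: $0$ is the type of natural numbers, $1=0\to0$, $2=1\to0$, and $\tau^*$ is the type of finite sequences of objects of type $\tau$. $\textsf{E-PRA}^{\omega}$ is Kohlenbach's extensional primitive recursive arithmetic in all finite types (classical logic, extensionality, combinators, the type-$0$ primitive recursor, quantifier-free induction), and $\textsf{E-PRA}^{\omega*}$ its definitional extension with types $\tau^*$. $\textsf{QF-AC}^{1,0}$ is $(\forall x^1)(\exists y^0)\varphi(x,y)\to(\exists F^{1\to0})(\forall x^1)\varphi(x,F(x))$ for quantifier-free internal $\varphi$. The language of $\textsf{P}_0$ adds a predicate $\text{st}$ ("is standard") for every type. $(\forall^{\text{st}}x)A$ abbreviates $(\forall x)(\text{st}(x)\to A)$ and $(\exists^{\text{st}}x)A$ abbreviates $(\exists x)(\text{st}(x)\wedge A)$; a formula is internal if it does not involve $\text{st}$. For internal $A$, $A^{\text{st}}$ is obtained by relativising all quantifiers (except bounded number quantifiers) to $\text{st}$. The system $\textsf{P}_0$ consists of $\textsf{E-PRA}^{\omega*}+\textsf{QF-AC}^{1,0}$ plus: (1) $\text{st}(x)\wedge x=y\to\text{st}(y)$; $\text{st}(t)$ for every closed term $t$ of the (internal) language; $\text{st}(f)\wedge\text{st}(x)\to\text{st}(f(x))$; (2) Idealisation $\textsf{I}$: $(\forall^{\text{st}}x^{\sigma^*})(\exists y^\tau)(\forall z^\sigma\in x)\varphi(z,y)\to(\exists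 y^\tau)(\forall^{\text{st}}x^\sigma)\varphi(x,y)$ for internal $\varphi$; (3) $\textsf{HAC}_{\textsf{int}}$: $(\forall^{\text{st}}x^\rho)(\exists^{\text{st}}y^\tau)\varphi(x,y)\to(\exists^{\text{st}}F^{\rho\to\tau^*})(\forall^{\text{st}}x^\rho)(\exists y^\tau\in F(x))\varphi(x,y)$ for internal $\varphi$. $\Pi^0_1\text{ - }\textsf{TRANS}$: $(\forall^{\text{st}}f^1)\big[(\forall^{\text{st}}n^0)(f(n)\neq0)\to(\forall m^0)(f(m)\neq0)\big]$. $\textsf{STP}$: $(\forall\alpha^1\leq_11)(\exists^{\text{st}}\beta^1\leq_11)(\alpha\approx_1\beta)$, where $\alpha\leq_11$ means $\alpha(n)\le1$ for all $n$, and $\alpha\approx_1\beta$ means $(\forall^{\text{st}}n^0)(\alpha(n)=\beta(n))$. $\textsf{ATR}_0$ is the usual system of second-order arithmetic: $\textsf{ACA}_0$ plus, for every arithmetical $\theta$, $(\forall X^1)[\textsf{WO}(X)\to(\exists Y^1)H_\theta(X,Y)]$, where $\textsf{WO}(X)$ says that $X$ is a countable well-ordering and $H_\theta(X,Y)$ says that $Y$ results from iterating $\theta$ along $X$, i.e. $Y=\{(n,j):j\in\text{field}(X)\wedge\theta(n,Y^j)\}$ with $Y^j=\{(m,i)\in Y:i<_Xj\}$ (sets coded by characteristic functions). $\textsf{ATR}_0^{\text{st}}$ is $\textsf{ATR}_0$ relativised to $\text{st}$. -}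

module Defs where

open import Data.Empty using (⊥)
open import Data.List.Base using (List; []; _∷_; map)
open import Data.List.Membership.Propositional using (_∈_)
open import Data.List.Membership.Propositional.Properties using (∈-map⁺)
open import Data.List.Relation.Binary.Subset.Propositional using (_⊆_)
open import Data.List.Relation.Binary.Subset.Propositional.Properties using (∷⁺ʳ)
open import Data.List.Relation.Unary.Any using (here; there)
open import Data.Product.Base using (_×_)
open import Data.Sum.Base using (_⊎_)
open import Data.Unit.Base using (⊤)
open import Relation.Binary.PropositionalEquality using (_≡_; refl)

-- Variables are de Bruijn indices, i.e. proofs of membership in a context.

pattern v0 = here refl
pattern v1 = there v0
pattern v2 = there v1
pattern v3 = there v2
pattern v4 = there v3
pattern v5 = there v4

------------------------------------------------------------------------
-- Second-order arithmetic

module L₂ where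

  data Sort : Set where
    num set : Sort

  Ctx : Set
  Ctx = List Sort

  infixl 7 _+_
  infixl 8 _*_

  data Tm (Ξ : Ctx) : Set where
    var     : num ∈ Ξ → Tm Ξ
    𝟘 𝟙     : Tm Ξ
    _+_ _*_ : Tm Ξ → Tm Ξ → Tm Ξ

  infix  6 _≐_ _<_ _ε_
  infixr 5 _∧_
  infixr 4 _∨_
  infixr 3 _⊃_
  infix  2 _⇔_
  infixr 2 ∀ⁿ_ ∃ⁿ_ ∀ˢ_ ∃ˢ_ ∀<[_]_ ∃<[_]_

  data Fm (Ξ : Ctx) : Set where
    _≐_ _<_         : Tm Ξ → Tm Ξ → Fm Ξ
    _ε_             : Tm Ξ → set ∈ Ξ → Fm Ξ
    ⊥′              : Fm Ξ
    _∧_ _∨_ _⊃_     : Fm Ξ → Fm Ξ → Fm Ξ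
    ∀ⁿ_ ∃ⁿ_         : Fm (num ∷ Ξ) → Fm Ξ
    ∀<[_]_ ∃<[_]_   : Tm Ξ → Fm (num ∷ Ξ) → Fm Ξ
    ∀ˢ_ ∃ˢ_         : Fm (set ∷ Ξ) → Fm Ξ

  ¬_ : ∀ {Ξ} → Fm Ξ → Fm Ξ
  ¬ φ = φ ⊃ ⊥′

  _⇔_ : ∀ {Ξ} → Fm Ξ → Fm Ξ → Fm Ξ
  φ ⇔ ψ = (φ ⊃ ψ) ∧ (ψ ⊃ φ)

  Arithmetical : ∀ {Ξ} → Fm Ξ → Set
  Arithmetical (s ≐ t)      = ⊤
  Arithmetical (s < t)      = ⊤
  Arithmetical (t ε X)      = ⊤
  Arithmetical ⊥′           = ⊤
  Arithmetical (φ ∧ ψ)      = Arithmetical φ × Arithmetical ψ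
  Arithmetical (φ ∨ ψ)      = Arithmetical φ × Arithmetical ψ
  Arithmetical (φ ⊃ ψ)      = Arithmetical φ × Arithmetical ψ
  Arithmetical (∀ⁿ φ)       = Arithmetical φ
  Arithmetical (∃ⁿ φ)       = Arithmetical φ
  Arithmetical (∀<[ t ] φ)  = Arithmetical φ
  Arithmetical (∃<[ t ] φ)  = Arithmetical φ
  Arithmetical (∀ˢ φ)       = ⊥
  Arithmetical (∃ˢ φ)       = ⊥

  renTm : ∀ {Ξ Ξ′} → Ξ ⊆ Ξ′ → Tm Ξ → Tm Ξ′
  renTm ρ (var x) = var (ρ x)
  renTm ρ 𝟘       = 𝟘
  renTm ρ 𝟙       = 𝟙
  renTm ρ (s + t) = renTm ρ s + renTm ρ t
  renTm ρ (s * t) = renTm ρ s * renTm ρ t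

  ren : ∀ {Ξ Ξ′} → Ξ ⊆ Ξ′ → Fm Ξ → Fm Ξ′
  ren ρ (s ≐ t)      = renTm ρ s ≐ renTm ρ t
  ren ρ (s < t)      = renTm ρ s < renTm ρ t
  ren ρ (t ε X)      = renTm ρ t ε ρ X
  ren ρ ⊥′           = ⊥′
  ren ρ (φ ∧ ψ)      = ren ρ φ ∧ ren ρ ψ
  ren ρ (φ ∨ ψ)      = ren ρ φ ∨ ren ρ ψ
  ren ρ (φ ⊃ ψ)      = ren ρ φ ⊃ ren ρ ψ
  ren ρ (∀ⁿ φ)       = ∀ⁿ ren (∷⁺ʳ num ρ) φ
  ren ρ (∃ⁿ φ)       = ∃ⁿ ren (∷⁺ʳ num ρ) φ
  ren ρ (∀<[ t ] φ)  = ∀<[ renTm ρ t ] ren (∷⁺ʳ num ρ) φ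
  ren ρ (∃<[ t ] φ)  = ∃<[ renTm ρ t ] ren (∷⁺ʳ num ρ) φ
  ren ρ (∀ˢ φ)       = ∀ˢ ren (∷⁺ʳ set ρ) φ
  ren ρ (∃ˢ φ)       = ∃ˢ ren (∷⁺ʳ set ρ) φ

  closure : ∀ Ξ → Fm Ξ → Fm []
  closure []        φ = φ
  closure (num ∷ Ξ) φ = closure Ξ (∀ⁿ φ)
  closure (set ∷ Ξ) φ = closure Ξ (∀ˢ φ)

  -- The pairing (i , j) = (i + j)² + i.
  pair : ∀ {Ξ} → Tm Ξ → Tm Ξ → Tm Ξ
  pair i j = (i + j) * (i + j) + i

  -- A linear order is coded by the set X of pairs (i , j) with i ≤_X j.
  Le Lt : ∀ {Ξ} → set ∈ Ξ → Tm Ξ → Tm Ξ → Fm Ξ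
  Le X i j = pair i j ε X
  Lt X i j = Le X i j ∧ ¬ Le X j i

  Field : ∀ {Ξ} → set ∈ Ξ → Tm Ξ → Fm Ξ
  Field X i = Le X i i

  Reflexive Transitive Antisymmetric Total : ∀ {Ξ} → set ∈ Ξ → Fm Ξ
  Reflexive X = ∀ⁿ ∀ⁿ Le X₂ (var v1) (var v0) ⊃ Field X₂ (var v1) ∧ Field X₂ (var v0)
    where X₂ = there (there X)
  Transitive X = ∀ⁿ ∀ⁿ ∀ⁿ
    Le X₃ (var v2) (var v1) ∧ Le X₃ (var v1) (var v0) ⊃ Le X₃ (var v2) (var v0)
    where X₃ = there (there (there X))
  Antisymmetric X = ∀ⁿ ∀ⁿ
    Le X₂ (var v1) (var v0) ∧ Le X₂ (var v0) (var v1) ⊃ var v1 ≐ var v0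
    where X₂ = there (there X)
  Total X = ∀ⁿ ∀ⁿ
    Field X₂ (var v1) ∧ Field X₂ (var v0) ⊃
      Le X₂ (var v1) (var v0) ∨ Le X₂ (var v0) (var v1)
    where X₂ = there (there X)

  LO : ∀ {Ξ} → set ∈ Ξ → Fm Ξ
  LO X = Reflexive X ∧ Transitive X ∧ Antisymmetric X ∧ Total X

  -- The set F of pairs is (the graph of) a function from ℕ to field(X).
  IntoField : ∀ {Ξ} → set ∈ Ξ → set ∈ Ξ → Fm Ξ
  IntoField F X =
      (∀ⁿ var v0 ε there F ⊃
        (∃ⁿ ∃ⁿ var v2 ≐ pair (var v1) (var v0) ∧ Field (there (there (there X))) (var v0)))
    ∧ (∀ⁿ ∃ⁿ pair (var v1) (var v0) ε there (there F))
    ∧ (∀ⁿ ∀ⁿ ∀ⁿ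
        pair (var v2) (var v1) ε F₃ ∧ pair (var v2) (var v0) ε F₃ ⊃ var v1 ≐ var v0)
    where F₃ = there (there (there F))

  Descending : ∀ {Ξ} → set ∈ Ξ → set ∈ Ξ → Fm Ξ
  Descending F X = ∀ⁿ ∀ⁿ ∀ⁿ
    pair (var v2) (var v1) ε F₃ ∧ pair (var v2 + 𝟙) (var v0) ε F₃ ⊃
      Lt (there (there (there X))) (var v0) (var v1)
    where F₃ = there (there (there F))

  WF WO : ∀ {Ξ} → set ∈ Ξ → Fm Ξ
  WF X = Reflexive X ∧ ¬ (∃ˢ IntoField v0 (there X) ∧ Descending v0 (there X))
  WO X = LO X ∧ WF X

  -- Z = Y^j = {(m , i) ∈ Y : i <_X j}
  IsSection : ∀ {Ξ} → set ∈ Ξ → set ∈ Ξ → set ∈ Ξ → num ∈ Ξ → Fm Ξ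
  IsSection Z Y X j = ∀ⁿ (var v0 ε there Z ⇔
    (∃ⁿ ∃ⁿ var v2 ≐ pair (var v1) (var v0) ∧ var v2 ε there (there (there Y)) ∧
            Lt (there (there (there X))) (var v0) (var (there (there (there j))))))

  -- θ(n , Y^j) is rendered as "θ(n , Z) for the set Z equal to Y^j".  In θ the
  -- index v0 is n, v1 is the set argument, and the rest are parameters.
  module _ {Ξ : Ctx} (θ : Fm (num ∷ set ∷ Ξ)) where

    -- The target context is Z, j, n, p, Y, X, followed by the parameters.
    place : num ∷ set ∷ Ξ ⊆ set ∷ num ∷ num ∷ num ∷ set ∷ set ∷ Ξ
    place v0                = v2
    place v1                = v0
    place (there (there x)) = there (there (there (there (there (there x)))))

    -- Y is v0 and X is v1.
    H : Fm (set ∷ set ∷ Ξ)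
    H = ∀ⁿ (var v0 ε v1 ⇔
      (∃ⁿ ∃ⁿ var v2 ≐ pair (var v1) (var v0) ∧ Field v4 (var v0) ∧
              (∃ˢ IsSection v0 v4 v5 v1 ∧ ren place θ)))

  data ATR₀ : Fm [] → Set where
    +1-nonzero  : ATR₀ (∀ⁿ ¬ (var v0 + 𝟙 ≐ 𝟘))
    +1-inj      : ATR₀ (∀ⁿ ∀ⁿ var v1 + 𝟙 ≐ var v0 + 𝟙 ⊃ var v1 ≐ var v0)
    +-zero      : ATR₀ (∀ⁿ var v0 + 𝟘 ≐ var v0)
    +-suc       : ATR₀ (∀ⁿ ∀ⁿ var v1 + (var v0 + 𝟙) ≐ (var v1 + var v0) + 𝟙)
    *-zero      : ATR₀ (∀ⁿ var v0 * 𝟘 ≐ 𝟘)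
    *-suc       : ATR₀ (∀ⁿ ∀ⁿ var v1 * (var v0 + 𝟙) ≐ var v1 * var v0 + var v1)
    <-zero      : ATR₀ (∀ⁿ ¬ (var v0 < 𝟘))
    <-suc       : ATR₀ (∀ⁿ ∀ⁿ (var v1 < var v0 + 𝟙 ⇔ var v1 < var v0 ∨ var v1 ≐ var v0))
    induction   : ATR₀ (∀ˢ 𝟘 ε v0 ∧ (∀ⁿ var v0 ε v1 ⊃ var v0 + 𝟙 ε v1) ⊃ (∀ⁿ var v0 ε v1))
    comprehension : ∀ Ξ (φ : Fm (num ∷ Ξ)) → Arithmetical φ →
      ATR₀ (closure Ξ (∃ˢ ∀ⁿ (var v0 ε v1 ⇔ ren (∷⁺ʳ num there) φ)))
    transfinite-recursion : ∀ Ξ (θ : Fm (num ∷ set ∷ Ξ)) → Arithmetical θ →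
      ATR₀ (closure Ξ (∀ˢ WO v0 ⊃ (∃ˢ H θ)))

------------------------------------------------------------------------
-- Terms of all finite types

infixr 6 _⇒_
infix  7 _*

data Ty : Set where
  𝟎   : Ty
  _⇒_ : Ty → Ty → Ty
  _*  : Ty → Ty

𝟏 : Ty
𝟏 = 𝟎 ⇒ 𝟎

Ctx : Set
Ctx = List Ty

-- A finite sequence is determined by its length and its entries; `tab f n` is
-- the sequence ⟨ f 0 , … , f (n - 1) ⟩.

data Con : Ty → Set where
  K    : ∀ {σ τ} → Con (σ ⇒ τ ⇒ σ)
  S    : ∀ {ρ σ τ} → Con ((ρ ⇒ σ ⇒ τ) ⇒ (ρ ⇒ σ) ⇒ ρ ⇒ τ)
  zero : Con 𝟎
  suc  : Con (𝟎 ⇒ 𝟎)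
  R₀   : Con (𝟎 ⇒ 𝟎 ⇒ (𝟎 ⇒ 𝟎 ⇒ 𝟎) ⇒ 𝟎)
  len  : ∀ {σ} → Con (σ * ⇒ 𝟎)
  at   : ∀ {σ} → Con (σ * ⇒ 𝟎 ⇒ σ)
  tab  : ∀ {σ} → Con ((𝟎 ⇒ σ) ⇒ 𝟎 ⇒ σ *)

infixl 9 _·_

data Tm (Γ : Ctx) : Ty → Set where
  var : ∀ {σ} → σ ∈ Γ → Tm Γ σ
  con : ∀ {σ} → Con σ → Tm Γ σ
  _·_ : ∀ {σ τ} → Tm Γ (σ ⇒ τ) → Tm Γ σ → Tm Γ τ

renTm : ∀ {Γ Δ σ} → Γ ⊆ Δ → Tm Γ σ → Tm Δ σ
renTm ρ (var x) = var (ρ x)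
renTm ρ (con c) = con c
renTm ρ (f · t) = renTm ρ f · renTm ρ t

wk : ∀ {Γ σ τ} → Tm Γ σ → Tm (τ ∷ Γ) σ
wk = renTm there

-- Bracket abstraction.
lam : ∀ {Γ σ τ} → Tm (σ ∷ Γ) τ → Tm Γ (σ ⇒ τ)
lam {σ = σ} (var v0)        = con S · con K · con (K {σ} {σ})
lam         (var (there x)) = con K · var x
lam         (con c)         = con K · con c
lam         (f · t)         = con S · lam f · lam t

O : ∀ {Γ} → Tm Γ 𝟎
O = con zero

suc′ : ∀ {Γ} → Tm Γ 𝟎 → Tm Γ 𝟎
suc′ t = con suc · t

rec : ∀ {Γ} → Tm Γ 𝟎 → Tm Γ 𝟎 → Tm Γ (𝟎 ⇒ 𝟎 ⇒ 𝟎) → Tm Γ 𝟎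
rec n y z = con R₀ · n · y · z

length : ∀ {Γ σ} → Tm Γ (σ *) → Tm Γ 𝟎
length s = con len · s

_!_ : ∀ {Γ σ} → Tm Γ (σ *) → Tm Γ 𝟎 → Tm Γ σ
s ! i = con at · s · i

-- The defining term of each operation is closed, so that the operation
-- commutes with substitution.  The step function of R₀ receives the previous
-- value first and the recursion index second.

predᶜ : ∀ {Γ} → Tm Γ (𝟎 ⇒ 𝟎)
predᶜ = lam (rec (var v0) O (lam (lam (var v0))))

plusᶜ timesᶜ monusᶜ : ∀ {Γ} → Tm Γ (𝟎 ⇒ 𝟎 ⇒ 𝟎)
plusᶜ  = lam (lam (rec (var v0) (var v1) (lam (lam (suc′ (var v1))))))
timesᶜ = lam (lam (rec (var v0) O (lam (lam (plusᶜ · var v1 · var v3)))))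
monusᶜ = lam (lam (rec (var v0) (var v1) (lam (lam (predᶜ · var v1)))))

infixl 7 _+_ _∸_
infixl 8 _×′_

_+_ _×′_ _∸_ : ∀ {Γ} → Tm Γ 𝟎 → Tm Γ 𝟎 → Tm Γ 𝟎
s + t  = plusᶜ · s · t
s ×′ t = timesᶜ · s · t
s ∸ t  = monusᶜ · s · t

-- The zero object, used as the value of out-of-range entries of sequences.
zeroAt : ∀ {Γ} σ → Tm Γ σ
zeroAt 𝟎       = O
zeroAt (σ ⇒ τ) = con K · zeroAt τ
zeroAt (σ *)   = con tab · (con K · zeroAt σ) · O

------------------------------------------------------------------------
-- Formulas

infix  6 _≐_
infixr 5 _∧_
infixr 4 _∨_
infixr 3 _⊃_
infix  2 _⇔_
infixr 2 ∀[_]_ ∃[_]_ ∀<[_]_ ∃<[_]_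

-- Equations between numbers are the only prime formulas besides st.  Bounded
-- number quantifiers are separate constructors because they are exempt from
-- relativisation; axioms below identify them with their usual definitions.

data Fm (Γ : Ctx) : Set where
  _≐_           : Tm Γ 𝟎 → Tm Γ 𝟎 → Fm Γ
  st            : ∀ {σ} → Tm Γ σ → Fm Γ
  ⊥′            : Fm Γ
  _∧_ _∨_ _⊃_   : Fm Γ → Fm Γ → Fm Γ
  ∀[_]_ ∃[_]_   : ∀ σ → Fm (σ ∷ Γ) → Fm Γ
  ∀<[_]_ ∃<[_]_ : Tm Γ 𝟎 → Fm (𝟎 ∷ Γ) → Fm Γ

¬_ : ∀ {Γ} → Fm Γ → Fm Γ
¬ φ = φ ⊃ ⊥′

_⇔_ : ∀ {Γ} → Fm Γ → Fm Γ → Fm Γ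
φ ⇔ ψ = (φ ⊃ ψ) ∧ (ψ ⊃ φ)

Internal : ∀ {Γ} → Fm Γ → Set
Internal (s ≐ t)     = ⊤
Internal (st t)      = ⊥
Internal ⊥′          = ⊤
Internal (φ ∧ ψ)     = Internal φ × Internal ψ
Internal (φ ∨ ψ)     = Internal φ × Internal ψ
Internal (φ ⊃ ψ)     = Internal φ × Internal ψ
Internal (∀[ σ ] φ)  = Internal φ
Internal (∃[ σ ] φ)  = Internal φ
Internal (∀<[ t ] φ) = Internal φ
Internal (∃<[ t ] φ) = Internal φ

-- Quantifier-free and internal.
QF : ∀ {Γ} → Fm Γ → Set
QF (s ≐ t)     = ⊤
QF (st t)      = ⊥
QF ⊥′          = ⊤
QF (φ ∧ ψ)     = QF φ × QF ψ
QF (φ ∨ ψ)     = QF φ × QF ψ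
QF (φ ⊃ ψ)     = QF φ × QF ψ
QF (∀[ σ ] φ)  = ⊥
QF (∃[ σ ] φ)  = ⊥
QF (∀<[ t ] φ) = ⊥
QF (∃<[ t ] φ) = ⊥

ren : ∀ {Γ Δ} → Γ ⊆ Δ → Fm Γ → Fm Δ
ren ρ (s ≐ t)     = renTm ρ s ≐ renTm ρ t
ren ρ (st t)      = st (renTm ρ t)
ren ρ ⊥′          = ⊥′
ren ρ (φ ∧ ψ)     = ren ρ φ ∧ ren ρ ψ
ren ρ (φ ∨ ψ)     = ren ρ φ ∨ ren ρ ψ
ren ρ (φ ⊃ ψ)     = ren ρ φ ⊃ ren ρ ψ
ren ρ (∀[ σ ] φ)  = ∀[ σ ] ren (∷⁺ʳ σ ρ) φ
ren ρ (∃[ σ ] φ)  = ∃[ σ ] ren (∷⁺ʳ σ ρ) φ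
ren ρ (∀<[ t ] φ) = ∀<[ renTm ρ t ] ren (∷⁺ʳ 𝟎 ρ) φ
ren ρ (∃<[ t ] φ) = ∃<[ renTm ρ t ] ren (∷⁺ʳ 𝟎 ρ) φ

wkFm : ∀ {Γ τ} → Fm Γ → Fm (τ ∷ Γ)
wkFm = ren there

Sub : Ctx → Ctx → Set
Sub Γ Δ = ∀ {σ} → σ ∈ Γ → Tm Δ σ

infixl 5 _▹_

_▹_ : ∀ {Γ Δ τ} → Sub Γ Δ → Tm Δ τ → Sub (τ ∷ Γ) Δ
(θ ▹ t) v0        = t
(θ ▹ t) (there x) = θ x

lift : ∀ {Γ Δ τ} → Sub Γ Δ → Sub (τ ∷ Γ) (τ ∷ Δ)
lift θ v0        = var v0
lift θ (there x) = wk (θ x)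

subTm : ∀ {Γ Δ σ} → Sub Γ Δ → Tm Γ σ → Tm Δ σ
subTm θ (var x) = θ x
subTm θ (con c) = con c
subTm θ (f · t) = subTm θ f · subTm θ t

sub : ∀ {Γ Δ} → Sub Γ Δ → Fm Γ → Fm Δ
sub θ (s ≐ t)     = subTm θ s ≐ subTm θ t
sub θ (st t)      = st (subTm θ t)
sub θ ⊥′          = ⊥′
sub θ (φ ∧ ψ)     = sub θ φ ∧ sub θ ψ
sub θ (φ ∨ ψ)     = sub θ φ ∨ sub θ ψ
sub θ (φ ⊃ ψ)     = sub θ φ ⊃ sub θ ψ
sub θ (∀[ σ ] φ)  = ∀[ σ ] sub (lift θ) φ
sub θ (∃[ σ ] φ)  = ∃[ σ ] sub (lift θ) φ
sub θ (∀<[ t ] φ) = ∀<[ subTm θ t ] sub (lift θ) φ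
sub θ (∃<[ t ] φ) = ∃<[ subTm θ t ] sub (lift θ) φ

infix 10 _[_]

_[_] : ∀ {Γ σ} → Fm (σ ∷ Γ) → Tm Γ σ → Fm Γ
φ [ t ] = sub (var ▹ t) φ

infix 6 _<_ _≤_

_<_ _≤_ : ∀ {Γ} → Tm Γ 𝟎 → Tm Γ 𝟎 → Fm Γ
s < t = suc′ s ∸ t ≐ O
s ≤ t = s ∸ t ≐ O

-- Extensional equality.
Eq : ∀ {Γ} σ → Tm Γ σ → Tm Γ σ → Fm Γ
Eq 𝟎       s t = s ≐ t
Eq (σ ⇒ τ) s t = ∀[ σ ] Eq τ (wk s · var v0) (wk t · var v0)
Eq (σ *)   s t = length s ≐ length t ∧
                 (∀<[ length s ] Eq σ (wk s ! var v0) (wk t ! var v0))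

infix 6 _ε_

_ε_ : ∀ {Γ σ} → Tm Γ σ → Tm Γ (σ *) → Fm Γ
_ε_ {σ = σ} t s = ∃<[ length s ] Eq σ (wk t) (wk s ! var v0)

infixr 2 ∀ˢᵗ[_]_ ∃ˢᵗ[_]_

∀ˢᵗ[_]_ ∃ˢᵗ[_]_ : ∀ {Γ} σ → Fm (σ ∷ Γ) → Fm Γ
∀ˢᵗ[ σ ] φ = ∀[ σ ] st (var v0) ⊃ φ
∃ˢᵗ[ σ ] φ = ∃[ σ ] st (var v0) ∧ φ

-- Only meaningful on internal formulas; prime formulas st t are left alone.
infix 11 _^st

_^st : ∀ {Γ} → Fm Γ → Fm Γ
(s ≐ t) ^st     = s ≐ t
(st t) ^st      = st t
⊥′ ^st          = ⊥′
(φ ∧ ψ) ^st     = φ ^st ∧ ψ ^st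
(φ ∨ ψ) ^st     = φ ^st ∨ ψ ^st
(φ ⊃ ψ) ^st     = φ ^st ⊃ ψ ^st
(∀[ σ ] φ) ^st  = ∀ˢᵗ[ σ ] φ ^st
(∃[ σ ] φ) ^st  = ∃ˢᵗ[ σ ] φ ^st
(∀<[ t ] φ) ^st = ∀<[ t ] φ ^st
(∃<[ t ] φ) ^st = ∃<[ t ] φ ^st

------------------------------------------------------------------------
-- Theories and classical natural deduction

-- Axioms may have free variables; `T Γ φ` says that φ is an axiom of T.
Theory : Set₁
Theory = (Γ : Ctx) → Fm Γ → Set

infixl 5 _⊕_

_⊕_ : Theory → Fm [] → Theory
(T ⊕ A) Γ φ = T Γ φ ⊎ φ ≡ ren (λ ()) A

infix 1 _∣_⊢_

data _∣_⊢_ (T : Theory) {Γ : Ctx} (Δ : List (Fm Γ)) : Fm Γ → Set where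
  ax  : ∀ {φ} → T Γ φ → T ∣ Δ ⊢ φ
  hyp : ∀ {φ} → φ ∈ Δ → T ∣ Δ ⊢ φ
  raa : ∀ {φ} → T ∣ (¬ φ) ∷ Δ ⊢ ⊥′ → T ∣ Δ ⊢ φ
  ∧I  : ∀ {φ ψ} → T ∣ Δ ⊢ φ → T ∣ Δ ⊢ ψ → T ∣ Δ ⊢ φ ∧ ψ
  ∧E₁ : ∀ {φ ψ} → T ∣ Δ ⊢ φ ∧ ψ → T ∣ Δ ⊢ φ
  ∧E₂ : ∀ {φ ψ} → T ∣ Δ ⊢ φ ∧ ψ → T ∣ Δ ⊢ ψ
  ∨I₁ : ∀ {φ ψ} → T ∣ Δ ⊢ φ → T ∣ Δ ⊢ φ ∨ ψ
  ∨I₂ : ∀ {φ ψ} → T ∣ Δ ⊢ ψ → T ∣ Δ ⊢ φ ∨ ψ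
  ∨E  : ∀ {φ ψ χ} → T ∣ Δ ⊢ φ ∨ ψ → T ∣ φ ∷ Δ ⊢ χ → T ∣ ψ ∷ Δ ⊢ χ → T ∣ Δ ⊢ χ
  ⊃I  : ∀ {φ ψ} → T ∣ φ ∷ Δ ⊢ ψ → T ∣ Δ ⊢ φ ⊃ ψ
  ⊃E  : ∀ {φ ψ} → T ∣ Δ ⊢ φ ⊃ ψ → T ∣ Δ ⊢ φ → T ∣ Δ ⊢ ψ
  ∀I  : ∀ {σ φ} → T ∣ map wkFm Δ ⊢ φ → T ∣ Δ ⊢ ∀[ σ ] φ
  ∀E  : ∀ {σ φ} → T ∣ Δ ⊢ ∀[ σ ] φ → (t : Tm Γ σ) → T ∣ Δ ⊢ φ [ t ]
  ∃I  : ∀ {σ φ} (t : Tm Γ σ) → T ∣ Δ ⊢ φ [ t ] → T ∣ Δ ⊢ ∃[ σ ] φ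
  ∃E  : ∀ {σ φ ψ} → T ∣ Δ ⊢ ∃[ σ ] φ → T ∣ φ ∷ map wkFm Δ ⊢ wkFm ψ → T ∣ Δ ⊢ ψ

-- E-PRA^ω with finite sequences.
data E-PRA^ω* (Γ : Ctx) : Fm Γ → Set where
  ∀<-def    : ∀ t φ → E-PRA^ω* Γ ((∀<[ t ] φ) ⇔ (∀[ 𝟎 ] var v0 < wk t ⊃ φ))
  ∃<-def    : ∀ t φ → E-PRA^ω* Γ ((∃<[ t ] φ) ⇔ (∃[ 𝟎 ] var v0 < wk t ∧ φ))
  ≐-refl    : ∀ s → E-PRA^ω* Γ (s ≐ s)
  ≐-sym     : ∀ s t → E-PRA^ω* Γ (s ≐ t ⊃ t ≐ s)
  ≐-trans   : ∀ s t u → E-PRA^ω* Γ (s ≐ t ⊃ t ≐ u ⊃ s ≐ u)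
  ext       : ∀ {σ τ} (f : Tm Γ (σ ⇒ τ)) s t → E-PRA^ω* Γ (Eq σ s t ⊃ Eq τ (f · s) (f · t))
  suc≢0     : ∀ t → E-PRA^ω* Γ (¬ (suc′ t ≐ O))
  suc-inj   : ∀ s t → E-PRA^ω* Γ (suc′ s ≐ suc′ t ⊃ s ≐ t)
  K-def     : ∀ {σ τ} (s : Tm Γ σ) (t : Tm Γ τ) → E-PRA^ω* Γ (Eq σ (con K · s · t) s)
  S-def     : ∀ {ρ σ τ} (f : Tm Γ (ρ ⇒ σ ⇒ τ)) (g : Tm Γ (ρ ⇒ σ)) (t : Tm Γ ρ) →
              E-PRA^ω* Γ (Eq τ (con S · f · g · t) (f · t · (g · t)))
  R₀-zero   : ∀ y z → E-PRA^ω* Γ (rec O y z ≐ y)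
  R₀-suc    : ∀ x y z → E-PRA^ω* Γ (rec (suc′ x) y z ≐ z · rec x y z · x)
  QF-ind    : ∀ (φ : Fm (𝟎 ∷ Γ)) → QF φ →
              E-PRA^ω* Γ (φ [ O ] ∧ (∀[ 𝟎 ] φ ⊃ sub ((λ x → var (there x)) ▹ suc′ (var v0)) φ) ⊃
                          (∀[ 𝟎 ] φ))
  len-tab   : ∀ {σ} (f : Tm Γ (𝟎 ⇒ σ)) n → E-PRA^ω* Γ (length (con tab · f · n) ≐ n)
  at-tab    : ∀ {σ} (f : Tm Γ (𝟎 ⇒ σ)) n i →
              E-PRA^ω* Γ (i < n ⊃ Eq σ ((con tab · f · n) ! i) (f · i))
  at-beyond : ∀ {σ} (s : Tm Γ (σ *)) i → E-PRA^ω* Γ (length s ≤ i ⊃ Eq σ (s ! i) (zeroAt σ))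

-- In QF-AC the formula φ has y as v0 and x as v1, and likewise in HAC-int; in
-- idealisation v0 is the variable of type σ and v1 that of type τ.
data P₀ (Γ : Ctx) : Fm Γ → Set where
  base         : ∀ {φ} → E-PRA^ω* Γ φ → P₀ Γ φ
  QF-AC        : ∀ (φ : Fm (𝟎 ∷ 𝟏 ∷ Γ)) → QF φ →
                 P₀ Γ ((∀[ 𝟏 ] ∃[ 𝟎 ] φ) ⊃
                       (∃[ 𝟏 ⇒ 𝟎 ] ∀[ 𝟏 ]
                         sub ((λ x → var (there (there x))) ▹ var v0 ▹ var v1 · var v0) φ))
  st-Eq        : ∀ {σ} (s t : Tm Γ σ) → P₀ Γ (st s ∧ Eq σ s t ⊃ st t)
  st-closed    : ∀ {σ} (t : Tm [] σ) → P₀ Γ (st (renTm (λ ()) t))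
  st-app       : ∀ {σ τ} (f : Tm Γ (σ ⇒ τ)) t → P₀ Γ (st f ∧ st t ⊃ st (f · t))
  idealisation : ∀ {σ τ} (φ : Fm (σ ∷ τ ∷ Γ)) → Internal φ →
                 P₀ Γ ((∀ˢᵗ[ σ * ] ∃[ τ ] ∀[ σ ] var v0 ε var v2 ⊃ ren (∷⁺ʳ σ (∷⁺ʳ τ there)) φ) ⊃
                       (∃[ τ ] ∀ˢᵗ[ σ ] φ))
  HAC-int      : ∀ {ρ τ} (φ : Fm (τ ∷ ρ ∷ Γ)) → Internal φ →
                 P₀ Γ ((∀ˢᵗ[ ρ ] ∃ˢᵗ[ τ ] φ) ⊃
                       (∃ˢᵗ[ ρ ⇒ τ * ] ∀ˢᵗ[ ρ ] ∃[ τ ]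
                         var v0 ε (var v2 · var v1) ∧ ren (∷⁺ʳ τ (∷⁺ʳ ρ there)) φ))

Π⁰₁-TRANS : Fm []
Π⁰₁-TRANS = ∀ˢᵗ[ 𝟏 ] ((∀ˢᵗ[ 𝟎 ] ¬ (var v1 · var v0 ≐ O)) ⊃ (∀[ 𝟎 ] ¬ (var v1 · var v0 ≐ O)))

_≤₁1 : ∀ {Γ} → Tm Γ 𝟏 → Fm Γ
α ≤₁1 = ∀[ 𝟎 ] wk α · var v0 ≤ suc′ O

_≈₁_ : ∀ {Γ} → Tm Γ 𝟏 → Tm Γ 𝟏 → Fm Γ
α ≈₁ β = ∀ˢᵗ[ 𝟎 ] wk α · var v0 ≐ wk β · var v0

STP : Fm []
STP = ∀[ 𝟏 ] (var v0 ≤₁1) ⊃ (∃ˢᵗ[ 𝟏 ] (var v0 ≤₁1) ∧ (var v1 ≈₁ var v0))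

------------------------------------------------------------------------
-- Second-order arithmetic in finite types: sets are characteristic functions

⟦_⟧ : L₂.Sort → Ty
⟦ L₂.num ⟧ = 𝟎
⟦ L₂.set ⟧ = 𝟏

⌜_⌝ᵗ : ∀ {Ξ} → L₂.Tm Ξ → Tm (map ⟦_⟧ Ξ) 𝟎
⌜ L₂.var x ⌝ᵗ   = var (∈-map⁺ ⟦_⟧ x)
⌜ L₂.𝟘 ⌝ᵗ       = O
⌜ L₂.𝟙 ⌝ᵗ       = suc′ O
⌜ s L₂.+ t ⌝ᵗ   = ⌜ s ⌝ᵗ + ⌜ t ⌝ᵗ
⌜ s L₂.* t ⌝ᵗ   = ⌜ s ⌝ᵗ ×′ ⌜ t ⌝ᵗ

⌜_⌝ : ∀ {Ξ} → L₂.Fm Ξ → Fm (map ⟦_⟧ Ξ)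
⌜ s L₂.≐ t ⌝        = ⌜ s ⌝ᵗ ≐ ⌜ t ⌝ᵗ
⌜ s L₂.< t ⌝        = ⌜ s ⌝ᵗ < ⌜ t ⌝ᵗ
⌜ t L₂.ε X ⌝        = var (∈-map⁺ ⟦_⟧ X) · ⌜ t ⌝ᵗ ≐ suc′ O
⌜ L₂.⊥′ ⌝           = ⊥′
⌜ φ L₂.∧ ψ ⌝        = ⌜ φ ⌝ ∧ ⌜ ψ ⌝
⌜ φ L₂.∨ ψ ⌝        = ⌜ φ ⌝ ∨ ⌜ ψ ⌝
⌜ φ L₂.⊃ ψ ⌝        = ⌜ φ ⌝ ⊃ ⌜ ψ ⌝
⌜ L₂.∀ⁿ φ ⌝         = ∀[ 𝟎 ] ⌜ φ ⌝
⌜ L₂.∃ⁿ φ ⌝         = ∃[ 𝟎 ] ⌜ φ ⌝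
⌜ L₂.∀<[ t ] φ ⌝    = ∀<[ ⌜ t ⌝ᵗ ] ⌜ φ ⌝
⌜ L₂.∃<[ t ] φ ⌝    = ∃<[ ⌜ t ⌝ᵗ ] ⌜ φ ⌝
⌜ L₂.∀ˢ φ ⌝         = ∀[ 𝟏 ] (var v0 ≤₁1) ⊃ ⌜ φ ⌝
⌜ L₂.∃ˢ φ ⌝         = ∃[ 𝟏 ] (var v0 ≤₁1) ∧ ⌜ φ ⌝

_Proves_ : Theory → (Fm [] → Set) → Set
T Proves Φ = ∀ {A} → Φ A → T ∣ [] ⊢ A

-- The relativisations to st of the axioms of ATR₀.
data ATR₀^st : Fm [] → Set where
  relativised : ∀ {A} → L₂.ATR₀ A → ATR₀^st (⌜ A ⌝ ^st)

{-# OPTIONS --safe #-}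
module Submission where

-- By HAC-int and transfer there is a standard functional μ such that f (μ f) = 0 whenever
-- the standard function f has a zero.  It turns arithmetical formulas with standard
-- parameters into equations, which gives comprehension.  The standard part of the
-- characteristic function of { k : i ≤ k } shows that numbers below a standard number are
-- standard, which gives induction.
--
-- For transfinite recursion along X, every standard Y that satisfies the recursion below j
-- demands of a set Z that (n , j) ∈ Z ⇔ θ(n , Y^j).  By induction along X, two such Y agree
-- below j, so the demands are consistent.  A standard finite sequence of them is met by
-- some Z, hence by idealisation some Z meets all standard ones, and by STP Z can be taken
-- standard.  By induction along X this Z satisfies the recursion.
--
-- The derivations use free names in place of bound variables: to derive ∀x φ it suffices
-- to derive φ for a fresh name, and hence for an arbitrary term.

open import Defs
open import Data.Empty using (⊥; ⊥-elim)
open import Data.List.Base using (List; []; _∷_; map)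
open import Data.List.Membership.Propositional using (_∈_)
open import Data.List.Membership.Propositional.Properties using (∈-map⁺)
open import Data.List.Relation.Binary.Subset.Propositional using (_⊆_)
open import Data.List.Relation.Binary.Subset.Propositional.Properties using (∷⁺ʳ; map⁺)
open import Data.List.Relation.Unary.Any using (here; there)
import Data.Nat.Base as ℕ
open ℕ using (ℕ)
import Data.Nat.Properties as ℕ
open import Data.Product.Base using (_×_; _,_)
open import Data.Sum.Base using (inj₁; inj₂)
open import Data.Unit.Base using (⊤; tt)
open import Function.Base using (id)
open import Relation.Binary.PropositionalEquality
  using (_≡_; refl; sym; trans; cong; cong₂; subst; subst₂)
open import Relation.Nullary.Decidable.Core using (Dec; yes; no)

-- Substitution calculus

-- It is not known in advance that any set satisfies the recursion below a given j, so Z cannot be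
-- obtained by collecting such sets. The demands are therefore conditional, and Z is unconstrained
-- where nothing is demanded. When the last induction reaches j, Z satisfies the recursion below j
-- and so is itself one of the sets Y that make demands; meeting its own demand at (n , j) is
-- exactly the recursion clause. Only standard sets make demands, so Z has to be made standard
-- before this induction. The pattern is Σ¹₁ separation: "some Y demands (n , j) in Z" and "some Y
-- demands it outside Z" are disjoint Σ¹₁ conditions over the standard sets, and Z separates them.
--
-- Two obstacles shape the middle part. Idealisation admits only internal formulas, while the
-- recursion below j is relativised to `st`; the functional μ replaces it by an equation. And
-- consistency is known only for standard demands: it applies to the items of a standard finite
-- sequence because their indices lie below a standard length and are thus standard themselves.

private variable
  Γ Θ Ω : Ctx
  ρ σ τ υ : Ty

renTm-renTm : ∀ {r : Γ ⊆ Θ} {r′ : Θ ⊆ Ω} (t : Tm Γ σ) →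
              renTm r′ (renTm r t) ≡ renTm (λ x → r′ (r x)) t
renTm-renTm (var x) = refl
renTm-renTm (con c) = refl
renTm-renTm (f · t) = cong₂ _·_ (renTm-renTm f) (renTm-renTm t)

subTm-cong : {s s′ : Sub Γ Θ} → (∀ {σ} (x : σ ∈ Γ) → s x ≡ s′ x) →
             (t : Tm Γ σ) → subTm s t ≡ subTm s′ t
subTm-cong e (var x) = e x
subTm-cong e (con c) = refl
subTm-cong e (f · t) = cong₂ _·_ (subTm-cong e f) (subTm-cong e t)

subTm-var : (t : Tm Γ σ) → subTm var t ≡ t
subTm-var (var x) = refl
subTm-var (con c) = refl
subTm-var (f · t) = cong₂ _·_ (subTm-var f) (subTm-var t)

subTm-renTm : {s : Sub Θ Ω} {r : Γ ⊆ Θ} (t : Tm Γ σ) →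
              subTm s (renTm r t) ≡ subTm (λ x → s (r x)) t
subTm-renTm (var x) = refl
subTm-renTm (con c) = refl
subTm-renTm (f · t) = cong₂ _·_ (subTm-renTm f) (subTm-renTm t)

renTm-subTm : {s : Sub Γ Θ} {r : Θ ⊆ Ω} (t : Tm Γ σ) →
              renTm r (subTm s t) ≡ subTm (λ x → renTm r (s x)) t
renTm-subTm (var x) = refl
renTm-subTm (con c) = refl
renTm-subTm (f · t) = cong₂ _·_ (renTm-subTm f) (renTm-subTm t)

subTm-subTm : {s : Sub Γ Θ} {s′ : Sub Θ Ω} (t : Tm Γ σ) →
              subTm s′ (subTm s t) ≡ subTm (λ x → subTm s′ (s x)) t
subTm-subTm (var x) = refl
subTm-subTm (con c) = refl
subTm-subTm (f · t) = cong₂ _·_ (subTm-subTm f) (subTm-subTm t)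

subTm-▹-wk : {s : Sub Γ Θ} {u : Tm Θ τ} (t : Tm Γ σ) → subTm (s ▹ u) (wk t) ≡ subTm s t
subTm-▹-wk t = subTm-renTm t

[]-wk : {u : Tm Γ τ} (t : Tm Γ σ) → subTm (var ▹ u) (wk t) ≡ t
[]-wk t = trans (subTm-▹-wk t) (subTm-var t)

subTm-lift-wk : {s : Sub Γ Θ} (t : Tm Γ σ) → subTm (lift {τ = τ} s) (wk t) ≡ wk (subTm s t)
subTm-lift-wk t = trans (subTm-renTm t) (sym (renTm-subTm t))

lift-cong : {s s′ : Sub Γ Θ} → (∀ {σ} (x : σ ∈ Γ) → s x ≡ s′ x) →
            (x : σ ∈ τ ∷ Γ) → lift s x ≡ lift s′ x
lift-cong e v0        = refl
lift-cong e (there x) = cong wk (e x)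

sub-cong : {s s′ : Sub Γ Θ} → (∀ {σ} (x : σ ∈ Γ) → s x ≡ s′ x) →
           (φ : Fm Γ) → sub s φ ≡ sub s′ φ
sub-cong e (s ≐ t)     = cong₂ _≐_ (subTm-cong e s) (subTm-cong e t)
sub-cong e (st t)      = cong st (subTm-cong e t)
sub-cong e ⊥′          = refl
sub-cong e (φ ∧ ψ)     = cong₂ _∧_ (sub-cong e φ) (sub-cong e ψ)
sub-cong e (φ ∨ ψ)     = cong₂ _∨_ (sub-cong e φ) (sub-cong e ψ)
sub-cong e (φ ⊃ ψ)     = cong₂ _⊃_ (sub-cong e φ) (sub-cong e ψ)
sub-cong e (∀[ σ ] φ)  = cong (∀[ σ ]_) (sub-cong (lift-cong e) φ)
sub-cong e (∃[ σ ] φ)  = cong (∃[ σ ]_) (sub-cong (lift-cong e) φ)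
sub-cong e (∀<[ t ] φ) = cong₂ ∀<[_]_ (subTm-cong e t) (sub-cong (lift-cong e) φ)
sub-cong e (∃<[ t ] φ) = cong₂ ∃<[_]_ (subTm-cong e t) (sub-cong (lift-cong e) φ)

lift-∷⁺ʳ : {s : Sub Θ Ω} {r : Γ ⊆ Θ} (x : σ ∈ τ ∷ Γ) →
           lift s (∷⁺ʳ τ r x) ≡ lift (λ y → s (r y)) x
lift-∷⁺ʳ v0        = refl
lift-∷⁺ʳ (there x) = refl

sub-ren : {s : Sub Θ Ω} {r : Γ ⊆ Θ} (φ : Fm Γ) → sub s (ren r φ) ≡ sub (λ x → s (r x)) φ
sub-ren (s ≐ t)     = cong₂ _≐_ (subTm-renTm s) (subTm-renTm t)
sub-ren (st t)      = cong st (subTm-renTm t)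
sub-ren ⊥′          = refl
sub-ren (φ ∧ ψ)     = cong₂ _∧_ (sub-ren φ) (sub-ren ψ)
sub-ren (φ ∨ ψ)     = cong₂ _∨_ (sub-ren φ) (sub-ren ψ)
sub-ren (φ ⊃ ψ)     = cong₂ _⊃_ (sub-ren φ) (sub-ren ψ)
sub-ren (∀[ σ ] φ)  = cong (∀[ σ ]_) (trans (sub-ren φ) (sub-cong lift-∷⁺ʳ φ))
sub-ren (∃[ σ ] φ)  = cong (∃[ σ ]_) (trans (sub-ren φ) (sub-cong lift-∷⁺ʳ φ))
sub-ren (∀<[ t ] φ) = cong₂ ∀<[_]_ (subTm-renTm t) (trans (sub-ren φ) (sub-cong lift-∷⁺ʳ φ))
sub-ren (∃<[ t ] φ) = cong₂ ∃<[_]_ (subTm-renTm t) (trans (sub-ren φ) (sub-cong lift-∷⁺ʳ φ))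

∷⁺ʳ-lift : {s : Sub Γ Θ} {r : Θ ⊆ Ω} (x : σ ∈ τ ∷ Γ) →
           renTm (∷⁺ʳ τ r) (lift s x) ≡ lift (λ y → renTm r (s y)) x
∷⁺ʳ-lift             v0        = refl
∷⁺ʳ-lift {s = s} (there x) = trans (renTm-renTm (s x)) (sym (renTm-renTm (s x)))

ren-sub : {s : Sub Γ Θ} {r : Θ ⊆ Ω} (φ : Fm Γ) → ren r (sub s φ) ≡ sub (λ x → renTm r (s x)) φ
ren-sub (s ≐ t)     = cong₂ _≐_ (renTm-subTm s) (renTm-subTm t)
ren-sub (st t)      = cong st (renTm-subTm t)
ren-sub ⊥′          = refl
ren-sub (φ ∧ ψ)     = cong₂ _∧_ (ren-sub φ) (ren-sub ψ)
ren-sub (φ ∨ ψ)     = cong₂ _∨_ (ren-sub φ) (ren-sub ψ)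
ren-sub (φ ⊃ ψ)     = cong₂ _⊃_ (ren-sub φ) (ren-sub ψ)
ren-sub (∀[ σ ] φ)  = cong (∀[ σ ]_) (trans (ren-sub φ) (sub-cong ∷⁺ʳ-lift φ))
ren-sub (∃[ σ ] φ)  = cong (∃[ σ ]_) (trans (ren-sub φ) (sub-cong ∷⁺ʳ-lift φ))
ren-sub (∀<[ t ] φ) = cong₂ ∀<[_]_ (renTm-subTm t) (trans (ren-sub φ) (sub-cong ∷⁺ʳ-lift φ))
ren-sub (∃<[ t ] φ) = cong₂ ∃<[_]_ (renTm-subTm t) (trans (ren-sub φ) (sub-cong ∷⁺ʳ-lift φ))

lift-lift : {s : Sub Γ Θ} {s′ : Sub Θ Ω} (x : σ ∈ τ ∷ Γ) →
            subTm (lift s′) (lift s x) ≡ lift (λ y → subTm s′ (s y)) x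
lift-lift             v0        = refl
lift-lift {s = s} (there x) = subTm-lift-wk (s x)

sub-sub : {s : Sub Γ Θ} {s′ : Sub Θ Ω} (φ : Fm Γ) →
          sub s′ (sub s φ) ≡ sub (λ x → subTm s′ (s x)) φ
sub-sub (s ≐ t)     = cong₂ _≐_ (subTm-subTm s) (subTm-subTm t)
sub-sub (st t)      = cong st (subTm-subTm t)
sub-sub ⊥′          = refl
sub-sub (φ ∧ ψ)     = cong₂ _∧_ (sub-sub φ) (sub-sub ψ)
sub-sub (φ ∨ ψ)     = cong₂ _∨_ (sub-sub φ) (sub-sub ψ)
sub-sub (φ ⊃ ψ)     = cong₂ _⊃_ (sub-sub φ) (sub-sub ψ)
sub-sub (∀[ σ ] φ)  = cong (∀[ σ ]_) (trans (sub-sub φ) (sub-cong lift-lift φ))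
sub-sub (∃[ σ ] φ)  = cong (∃[ σ ]_) (trans (sub-sub φ) (sub-cong lift-lift φ))
sub-sub (∀<[ t ] φ) = cong₂ ∀<[_]_ (subTm-subTm t) (trans (sub-sub φ) (sub-cong lift-lift φ))
sub-sub (∃<[ t ] φ) = cong₂ ∃<[_]_ (subTm-subTm t) (trans (sub-sub φ) (sub-cong lift-lift φ))

sub-lift-▹ : {s : Sub Γ Θ} {u : Tm Θ τ} (φ : Fm (τ ∷ Γ)) → sub (lift s) φ [ u ] ≡ sub (s ▹ u) φ
sub-lift-▹ {s = s} φ = trans (sub-sub φ) (sub-cong (λ { v0 → refl ; (there x) → []-wk (s x) }) φ)

sub-Eq : {s : Sub Γ Θ} (σ : Ty) {a b : Tm Γ σ} → sub s (Eq σ a b) ≡ Eq σ (subTm s a) (subTm s b)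
sub-Eq 𝟎 = refl
sub-Eq (σ ⇒ τ) {a} {b} = cong (∀[ σ ]_) (trans (sub-Eq τ)
  (cong₂ (Eq τ) (cong (_· var v0) (subTm-lift-wk a)) (cong (_· var v0) (subTm-lift-wk b))))
sub-Eq (σ *) {a} {b} = cong₂ _∧_ refl (cong₂ ∀<[_]_ refl (trans (sub-Eq σ)
  (cong₂ (Eq σ) (cong (_! var v0) (subTm-lift-wk a)) (cong (_! var v0) (subTm-lift-wk b)))))

QF-sub : {s : Sub Γ Θ} (φ : Fm Γ) → QF φ → QF (sub s φ)
QF-sub (s ≐ t) q       = q
QF-sub ⊥′ q            = q
QF-sub (φ ∧ ψ) (p , q) = QF-sub φ p , QF-sub ψ q
QF-sub (φ ∨ ψ) (p , q) = QF-sub φ p , QF-sub ψ q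
QF-sub (φ ⊃ ψ) (p , q) = QF-sub φ p , QF-sub ψ q

weaken : ∀ {T} {H H′ : List (Fm Γ)} {φ} → H ⊆ H′ → T ∣ H ⊢ φ → T ∣ H′ ⊢ φ
weaken i (ax a)     = ax a
weaken i (hyp h)    = hyp (i h)
weaken i (raa d)    = raa (weaken (∷⁺ʳ _ i) d)
weaken i (∧I d e)   = ∧I (weaken i d) (weaken i e)
weaken i (∧E₁ d)    = ∧E₁ (weaken i d)
weaken i (∧E₂ d)    = ∧E₂ (weaken i d)
weaken i (∨I₁ d)    = ∨I₁ (weaken i d)
weaken i (∨I₂ d)    = ∨I₂ (weaken i d)
weaken i (∨E d e f) = ∨E (weaken i d) (weaken (∷⁺ʳ _ i) e) (weaken (∷⁺ʳ _ i) f)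
weaken i (⊃I d)     = ⊃I (weaken (∷⁺ʳ _ i) d)
weaken i (⊃E d e)   = ⊃E (weaken i d) (weaken i e)
weaken i (∀I d)     = ∀I (weaken (map⁺ _ i) d)
weaken i (∀E d t)   = ∀E (weaken i d) t
weaken i (∃I t d)   = ∃I t (weaken i d)
weaken i (∃E d e)   = ∃E (weaken i d) (weaken (∷⁺ʳ _ (map⁺ _ i)) e)

-- Terms over an infinite supply of names, and formulas whose quantifiers are
-- closures.  A name stays available under all quantifiers, so that generic
-- objects can be handled as variables of the metalanguage.

data Term : Ty → Set where
  name : ℕ → Term σ
  con  : Con σ → Term σ
  _·_  : Term (σ ⇒ τ) → Term σ → Term τ

infixl 5 _▸_

data Env : Ctx → Set where
  ∅   : Env []
  _▸_ : Env Θ → Term σ → Env (σ ∷ Θ)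

lookup : Env Θ → σ ∈ Θ → Term σ
lookup (e ▸ t) v0        = t
lookup (e ▸ t) (there x) = lookup e x

infix 12 _⟪_⟫

_⟪_⟫ : Tm Θ σ → Env Θ → Term σ
var x ⟪ e ⟫   = lookup e x
con c ⟪ e ⟫   = con c
(f · t) ⟪ e ⟫ = f ⟪ e ⟫ · t ⟪ e ⟫

-- The body of a quantifier stays a formula in context, paired with values for its other variables.
-- Instantiating `all σ φ e` at `t` then only extends the environment to `e ▸ t`, and derivations
-- never meet a pending substitution.
data Form : Set where
  _≐_         : Term 𝟎 → Term 𝟎 → Form
  st          : Term σ → Form
  ⊥′          : Form
  _∧_ _∨_ _⊃_ : Form → Form → Form
  all ex      : ∀ {Θ} σ → Fm (σ ∷ Θ) → Env Θ → Form
  all< ex<    : ∀ {Θ} → Term 𝟎 → Fm (𝟎 ∷ Θ) → Env Θ → Form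

infix 12 _⟨_⟩

_⟨_⟩ : Fm Θ → Env Θ → Form
(s ≐ t) ⟨ e ⟩     = s ⟪ e ⟫ ≐ t ⟪ e ⟫
st t ⟨ e ⟩        = st (t ⟪ e ⟫)
⊥′ ⟨ e ⟩          = ⊥′
(φ ∧ ψ) ⟨ e ⟩     = φ ⟨ e ⟩ ∧ ψ ⟨ e ⟩
(φ ∨ ψ) ⟨ e ⟩     = φ ⟨ e ⟩ ∨ ψ ⟨ e ⟩
(φ ⊃ ψ) ⟨ e ⟩     = φ ⟨ e ⟩ ⊃ ψ ⟨ e ⟩
(∀[ σ ] φ) ⟨ e ⟩  = all σ φ e
(∃[ σ ] φ) ⟨ e ⟩  = ex σ φ e
(∀<[ t ] φ) ⟨ e ⟩ = all< (t ⟪ e ⟫) φ e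
(∃<[ t ] φ) ⟨ e ⟩ = ex< (t ⟪ e ⟫) φ e

Names : Ctx → Set
Names Γ = ∀ σ → ℕ → Tm Γ σ

realᵗ : Names Γ → Term σ → Tm Γ σ
realᵗ η (name n) = η _ n
realᵗ η (con c)  = con c
realᵗ η (f · t)  = realᵗ η f · realᵗ η t

infixr 9 _∙_

_∙_ : Names Γ → Env Θ → Sub Θ Γ
(η ∙ e) x = realᵗ η (lookup e x)

real : Names Γ → Form → Fm Γ
real η (s ≐ t)      = realᵗ η s ≐ realᵗ η t
real η (st t)       = st (realᵗ η t)
real η ⊥′           = ⊥′
real η (A ∧ B)      = real η A ∧ real η B
real η (A ∨ B)      = real η A ∨ real η B
real η (A ⊃ B)      = real η A ⊃ real η B
real η (all σ φ e)  = ∀[ σ ] sub (lift (η ∙ e)) φ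
real η (ex σ φ e)   = ∃[ σ ] sub (lift (η ∙ e)) φ
real η (all< t φ e) = ∀<[ realᵗ η t ] sub (lift (η ∙ e)) φ
real η (ex< t φ e)  = ∃<[ realᵗ η t ] sub (lift (η ∙ e)) φ

realᵗ-⟪⟫ : (η : Names Γ) (e : Env Θ) (t : Tm Θ σ) → realᵗ η (t ⟪ e ⟫) ≡ subTm (η ∙ e) t
realᵗ-⟪⟫ η e (var x) = refl
realᵗ-⟪⟫ η e (con c) = refl
realᵗ-⟪⟫ η e (f · t) = cong₂ _·_ (realᵗ-⟪⟫ η e f) (realᵗ-⟪⟫ η e t)

real-⟨⟩ : (η : Names Γ) (e : Env Θ) (φ : Fm Θ) → real η (φ ⟨ e ⟩) ≡ sub (η ∙ e) φ
real-⟨⟩ η e (s ≐ t)     = cong₂ _≐_ (realᵗ-⟪⟫ η e s) (realᵗ-⟪⟫ η e t)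
real-⟨⟩ η e (st t)      = cong st (realᵗ-⟪⟫ η e t)
real-⟨⟩ η e ⊥′          = refl
real-⟨⟩ η e (φ ∧ ψ)     = cong₂ _∧_ (real-⟨⟩ η e φ) (real-⟨⟩ η e ψ)
real-⟨⟩ η e (φ ∨ ψ)     = cong₂ _∨_ (real-⟨⟩ η e φ) (real-⟨⟩ η e ψ)
real-⟨⟩ η e (φ ⊃ ψ)     = cong₂ _⊃_ (real-⟨⟩ η e φ) (real-⟨⟩ η e ψ)
real-⟨⟩ η e (∀[ σ ] φ)  = refl
real-⟨⟩ η e (∃[ σ ] φ)  = refl
real-⟨⟩ η e (∀<[ t ] φ) = cong (∀<[_] _) (realᵗ-⟪⟫ η e t)
real-⟨⟩ η e (∃<[ t ] φ) = cong (∃<[_] _) (realᵗ-⟪⟫ η e t)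

-- Fresh names

infix 4 _≟_

_≟_ : (σ τ : Ty) → Dec (σ ≡ τ)
𝟎 ≟ 𝟎             = yes refl
(σ ⇒ τ) ≟ (σ′ ⇒ τ′) with σ ≟ σ′ | τ ≟ τ′
... | yes refl | yes refl = yes refl
... | no p     | _        = no λ { refl → p refl }
... | yes _    | no p     = no λ { refl → p refl }
(σ *) ≟ (τ *) with σ ≟ τ
... | yes refl = yes refl
... | no p     = no λ { refl → p refl }
𝟎 ≟ (σ ⇒ τ)        = no λ ()
𝟎 ≟ (σ *)          = no λ ()
(σ ⇒ τ) ≟ 𝟎        = no λ ()
(σ ⇒ τ) ≟ (ρ *)    = no λ ()
(σ *) ≟ 𝟎          = no λ ()
(σ *) ≟ (τ ⇒ ρ)    = no λ ()

extend : Names Γ → ℕ → ∀ τ → Names (τ ∷ Γ)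
extend η n τ σ m with m ℕ.≟ n | τ ≟ σ
... | yes _ | yes refl = var v0
... | _     | _        = wk (η σ m)

extend-fresh : (η : Names Γ) (n : ℕ) → extend η n τ τ n ≡ var v0
extend-fresh {τ = τ} η n with n ℕ.≟ n | τ ≟ τ
... | yes _ | yes refl = refl
... | no p  | _        = ⊥-elim (p refl)
... | yes _ | no p     = ⊥-elim (p refl)

extend-old : (η : Names Γ) {n m : ℕ} → m ℕ.< n → extend η n τ σ m ≡ wk (η σ m)
extend-old {τ = τ} {σ = σ} η {n} {m} m<n with m ℕ.≟ n | τ ≟ σ
... | yes refl | _     = ⊥-elim (ℕ.<-irrefl refl m<n)
... | no _     | _     = refl

-- A name is given by a number and a type, but the bound ignores the type, so every number from the
-- bound on is fresh at all types.
boundᵗ : Term σ → ℕ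
boundᵗ (name n) = ℕ.suc n
boundᵗ (con c)  = 0
boundᵗ (f · t)  = boundᵗ f ℕ.⊔ boundᵗ t

boundᵉ : Env Θ → ℕ
boundᵉ ∅       = 0
boundᵉ (e ▸ t) = boundᵉ e ℕ.⊔ boundᵗ t

bound : Form → ℕ
bound (s ≐ t)      = boundᵗ s ℕ.⊔ boundᵗ t
bound (st t)       = boundᵗ t
bound ⊥′           = 0
bound (A ∧ B)      = bound A ℕ.⊔ bound B
bound (A ∨ B)      = bound A ℕ.⊔ bound B
bound (A ⊃ B)      = bound A ℕ.⊔ bound B
bound (all σ φ e)  = boundᵉ e
bound (ex σ φ e)   = boundᵉ e
bound (all< t φ e) = boundᵗ t ℕ.⊔ boundᵉ e
bound (ex< t φ e)  = boundᵗ t ℕ.⊔ boundᵉ e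

boundᴴ : List Form → ℕ
boundᴴ []      = 0
boundᴴ (A ∷ H) = bound A ℕ.⊔ boundᴴ H

⊔≤ˡ : ∀ {i n} j → i ℕ.⊔ j ℕ.≤ n → i ℕ.≤ n
⊔≤ˡ {i} j = ℕ.≤-trans (ℕ.m≤m⊔n i j)

⊔≤ʳ : ∀ {j n} i → i ℕ.⊔ j ℕ.≤ n → j ℕ.≤ n
⊔≤ʳ {j} i = ℕ.≤-trans (ℕ.m≤n⊔m i j)

module _ (η : Names Γ) {n : ℕ} {τ : Ty} where

  private η′ = extend η n τ

  extendᵗ : (t : Term σ) → boundᵗ t ℕ.≤ n → realᵗ η′ t ≡ wk (realᵗ η t)
  extendᵗ (name m) b = extend-old η b
  extendᵗ (con c) b  = refl
  extendᵗ (f · t) b  = cong₂ _·_ (extendᵗ f (⊔≤ˡ (boundᵗ t) b)) (extendᵗ t (⊔≤ʳ (boundᵗ f) b))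

  extendᵉ : (e : Env Θ) → boundᵉ e ℕ.≤ n → (x : σ ∈ Θ) → (η′ ∙ e) x ≡ wk ((η ∙ e) x)
  extendᵉ (e ▸ t) b v0        = extendᵗ t (⊔≤ʳ (boundᵉ e) b)
  extendᵉ (e ▸ t) b (there x) = extendᵉ e (⊔≤ˡ (boundᵗ t) b) x

  extend-closure : (e : Env Θ) → boundᵉ e ℕ.≤ n → (φ : Fm (σ ∷ Θ)) →
    sub (lift (η′ ∙ e)) φ ≡ ren (∷⁺ʳ σ there) (sub (lift (η ∙ e)) φ)
  extend-closure e b φ = trans
    (sub-cong (λ x → trans (lift-cong (extendᵉ e b) x) (sym (∷⁺ʳ-lift x))) φ)
    (sym (ren-sub φ))

  extend-Form : (A : Form) → bound A ℕ.≤ n → real η′ A ≡ wkFm (real η A)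
  extend-Form (s ≐ t) b =
    cong₂ _≐_ (extendᵗ s (⊔≤ˡ (boundᵗ t) b)) (extendᵗ t (⊔≤ʳ (boundᵗ s) b))
  extend-Form (st t) b = cong st (extendᵗ t b)
  extend-Form ⊥′ b = refl
  extend-Form (A ∧ B) b =
    cong₂ _∧_ (extend-Form A (⊔≤ˡ (bound B) b)) (extend-Form B (⊔≤ʳ (bound A) b))
  extend-Form (A ∨ B) b =
    cong₂ _∨_ (extend-Form A (⊔≤ˡ (bound B) b)) (extend-Form B (⊔≤ʳ (bound A) b))
  extend-Form (A ⊃ B) b =
    cong₂ _⊃_ (extend-Form A (⊔≤ˡ (bound B) b)) (extend-Form B (⊔≤ʳ (bound A) b))
  extend-Form (all σ φ e) b = cong (∀[ σ ]_) (extend-closure e b φ)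
  extend-Form (ex σ φ e) b  = cong (∃[ σ ]_) (extend-closure e b φ)
  extend-Form (all< t φ e) b =
    cong₂ ∀<[_]_ (extendᵗ t (⊔≤ˡ (boundᵉ e) b)) (extend-closure e (⊔≤ʳ (boundᵗ t) b) φ)
  extend-Form (ex< t φ e) b =
    cong₂ ∃<[_]_ (extendᵗ t (⊔≤ˡ (boundᵉ e) b)) (extend-closure e (⊔≤ʳ (boundᵗ t) b) φ)

  extend-Forms : (H : List Form) → boundᴴ H ℕ.≤ n → map (real η′) H ≡ map wkFm (map (real η) H)
  extend-Forms [] b      = refl
  extend-Forms (A ∷ H) b =
    cong₂ _∷_ (extend-Form A (⊔≤ˡ (boundᴴ H) b)) (extend-Forms H (⊔≤ʳ (bound A) b))

  extend-body : (e : Env Θ) → boundᵉ e ℕ.≤ n → (φ : Fm (τ ∷ Θ)) →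
    real η′ (φ ⟨ e ▸ name n ⟩) ≡ sub (lift (η ∙ e)) φ
  extend-body e b φ = trans (real-⟨⟩ η′ (e ▸ name n) φ)
    (sub-cong (λ { v0 → extend-fresh η n ; (there x) → extendᵉ e b x }) φ)

-- Derivability of named formulas

Th : Theory
Th = P₀ ⊕ Π⁰₁-TRANS ⊕ STP

infix 1 _⊩_

-- Uniformity in the context and in the values of the names is what yields the quantifier rules: a
-- name fresh for the hypotheses can be sent to the newly bound variable while all others are
-- weakened.
record _⊩_ (H : List Form) (A : Form) : Set where
  constructor mk
  field instantiate : ∀ {Γ} (η : Names Γ) → Th ∣ map (real η) H ⊢ real η A

open _⊩_

private variable
  H H′ : List Form
  A B C : Form

embed : H ⊆ H′ → H ⊩ A → H′ ⊩ A
embed i d = mk λ η → weaken (map⁺ (real η) i) (instantiate d η)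

infix 20 ↑_ ↑²_ ↑³_ ↑⁴_ ↑⁵_ ↑⁶_

↑_ : H ⊩ A → B ∷ H ⊩ A
↑_ = embed there

↑²_ : ∀ {B₁ B₂} → H ⊩ A → B₁ ∷ B₂ ∷ H ⊩ A
↑² d = ↑ ↑ d

↑³_ : ∀ {B₁ B₂ B₃} → H ⊩ A → B₁ ∷ B₂ ∷ B₃ ∷ H ⊩ A
↑³ d = ↑ ↑² d

↑⁴_ : ∀ {B₁ B₂ B₃ B₄} → H ⊩ A → B₁ ∷ B₂ ∷ B₃ ∷ B₄ ∷ H ⊩ A
↑⁴ d = ↑ ↑³ d

↑⁵_ : ∀ {B₁ B₂ B₃ B₄ B₅} → H ⊩ A → B₁ ∷ B₂ ∷ B₃ ∷ B₄ ∷ B₅ ∷ H ⊩ A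
↑⁵ d = ↑ ↑⁴ d

↑⁶_ : ∀ {B₁ B₂ B₃ B₄ B₅ B₆} → H ⊩ A → B₁ ∷ B₂ ∷ B₃ ∷ B₄ ∷ B₅ ∷ B₆ ∷ H ⊩ A
↑⁶ d = ↑ ↑⁵ d

-- Closures over different environments may denote the same formula.

infix 4 _~_

record _~_ (A B : Form) : Set where
  constructor mk
  field instantiate : ∀ {Γ} (η : Names Γ) → real η A ≡ real η B

conv : A ~ B → H ⊩ A → H ⊩ B
conv p d = mk λ η → subst (Th ∣ _ ⊢_) (_~_.instantiate p η) (instantiate d η)

~sym : A ~ B → B ~ A
~sym p = mk λ η → sym (_~_.instantiate p η)

-- Natural deduction for named formulas

assume : (A ∷ H ⊩ A → A ∷ H ⊩ B) → A ∷ H ⊩ B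
assume f = f (mk λ η → hyp v0)

lam⊃ : (A ∷ H ⊩ A → A ∷ H ⊩ B) → H ⊩ A ⊃ B
lam⊃ f = mk λ η → ⊃I (instantiate (assume f) η)

infixl 8 _$_

_$_ : H ⊩ A ⊃ B → H ⊩ A → H ⊩ B
d $ e = mk λ η → ⊃E (instantiate d η) (instantiate e η)

infixr 5 _&_

_&_ : H ⊩ A → H ⊩ B → H ⊩ A ∧ B
d & e = mk λ η → ∧I (instantiate d η) (instantiate e η)

fst : H ⊩ A ∧ B → H ⊩ A
fst d = mk λ η → ∧E₁ (instantiate d η)

snd : H ⊩ A ∧ B → H ⊩ B
snd d = mk λ η → ∧E₂ (instantiate d η)

inl : H ⊩ A → H ⊩ A ∨ B
inl d = mk λ η → ∨I₁ (instantiate d η)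

inr : H ⊩ B → H ⊩ A ∨ B
inr d = mk λ η → ∨I₂ (instantiate d η)

cases : H ⊩ A ∨ B → (A ∷ H ⊩ A → A ∷ H ⊩ C) → (B ∷ H ⊩ B → B ∷ H ⊩ C) → H ⊩ C
cases d f g = mk λ η →
  ∨E (instantiate d η) (instantiate (assume f) η) (instantiate (assume g) η)

contra : ((A ⊃ ⊥′) ∷ H ⊩ A ⊃ ⊥′ → (A ⊃ ⊥′) ∷ H ⊩ ⊥′) → H ⊩ A
contra f = mk λ η → raa (instantiate (assume f) η)

absurd : H ⊩ ⊥′ → H ⊩ A
absurd d = mk λ η → raa (weaken there (instantiate d η))

em : ∀ A → H ⊩ A ∨ (A ⊃ ⊥′)
em A = contra λ n → n $ inr (lam⊃ λ a → ↑ n $ inl a)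

byCases : ∀ A → (A ∷ H ⊩ A → A ∷ H ⊩ C) →
          ((A ⊃ ⊥′) ∷ H ⊩ A ⊃ ⊥′ → (A ⊃ ⊥′) ∷ H ⊩ C) → H ⊩ C
byCases A = cases (em A)

module _ {Θ : Ctx} {σ : Ty} {φ : Fm (σ ∷ Θ)} {e : Env Θ} where

  real-▸ : ∀ (η : Names Γ) t → sub (lift (η ∙ e)) φ [ realᵗ η t ] ≡ real η (φ ⟨ e ▸ t ⟩)
  real-▸ η t = trans (sub-lift-▹ φ)
    (trans (sub-cong (λ { v0 → refl ; (there x) → refl }) φ) (sym (real-⟨⟩ η (e ▸ t) φ)))

  infixl 8 _$∀_

  _$∀_ : H ⊩ all σ φ e → (t : Term σ) → H ⊩ φ ⟨ e ▸ t ⟩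
  d $∀ t = mk λ η → subst (Th ∣ _ ⊢_) (real-▸ η t) (∀E (instantiate d η) (realᵗ η t))

  exI : (t : Term σ) → H ⊩ φ ⟨ e ▸ t ⟩ → H ⊩ ex σ φ e
  exI t d = mk λ η → ∃I (realᵗ η t) (subst (Th ∣ _ ⊢_) (sym (real-▸ η t)) (instantiate d η))

  allI : (∀ t → H ⊩ φ ⟨ e ▸ t ⟩) → H ⊩ all σ φ e
  allI {H} f = mk λ η → ∀I (subst₂ (Th ∣_⊢_)
      (extend-Forms η H (⊔≤ʳ (boundᵉ e) ℕ.≤-refl))
      (extend-body η e (⊔≤ˡ (boundᴴ H) ℕ.≤-refl) φ)
      (instantiate (f (name n)) (extend η n σ)))
    where n = boundᵉ e ℕ.⊔ boundᴴ H

  exE : H ⊩ ex σ φ e →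
        (∀ t → φ ⟨ e ▸ t ⟩ ∷ H ⊩ φ ⟨ e ▸ t ⟩ → φ ⟨ e ▸ t ⟩ ∷ H ⊩ C) → H ⊩ C
  exE {H} {C} d f = mk λ η → ∃E (instantiate d η) (subst₂ (Th ∣_⊢_)
      (cong₂ _∷_ (extend-body η e (⊔≤ˡ (boundᴴ H ℕ.⊔ bound C) ℕ.≤-refl) φ)
                 (extend-Forms η H (⊔≤ˡ (bound C) (⊔≤ʳ (boundᵉ e) ℕ.≤-refl))))
      (extend-Form η C (⊔≤ʳ (boundᴴ H) (⊔≤ʳ (boundᵉ e) ℕ.≤-refl)))
      (instantiate (assume (f (name n))) (extend η n σ)))
    where n = boundᵉ e ℕ.⊔ (boundᴴ H ℕ.⊔ bound C)

axiom₀ : (∀ {Γ} (η : Names Γ) → P₀ Γ (real η A)) → H ⊩ A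
axiom₀ a = mk λ η → ax (inj₁ (inj₁ (a η)))

axiom : (∀ {Γ} (η : Names Γ) → E-PRA^ω* Γ (real η A)) → H ⊩ A
axiom a = axiom₀ λ η → base (a η)

ren-⟨⟩ : {r : Γ ⊆ Θ} {e : Env Γ} {e′ : Env Θ} → (∀ {σ} (x : σ ∈ Γ) → lookup e′ (r x) ≡ lookup e x) →
         (φ : Fm Γ) → ren r φ ⟨ e′ ⟩ ~ φ ⟨ e ⟩
ren-⟨⟩ {r = r} {e} {e′} p φ = mk λ η → trans (real-⟨⟩ η e′ (ren r φ)) (trans (sub-ren φ)
  (trans (sub-cong (λ x → cong (realᵗ η) (p x)) φ) (sym (real-⟨⟩ η e φ))))

sub-⟨⟩ : {s : Sub Γ Θ} {e : Env Γ} {e′ : Env Θ} → (∀ {σ} (x : σ ∈ Γ) → s x ⟪ e′ ⟫ ≡ lookup e x) →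
         (φ : Fm Γ) → sub s φ ⟨ e′ ⟩ ~ φ ⟨ e ⟩
sub-⟨⟩ {s = s} {e} {e′} p φ = mk λ η → trans (real-⟨⟩ η e′ (sub s φ)) (trans (sub-sub φ)
  (trans (sub-cong (λ x → trans (sym (realᵗ-⟪⟫ η e′ (s x))) (cong (realᵗ η) (p x))) φ)
         (sym (real-⟨⟩ η e φ))))

-- Extensional equality

record _⊩_≃_ (H : List Form) (s t : Term σ) : Set where
  constructor mk
  field formula : H ⊩ Eq σ (var v1) (var v0) ⟨ ∅ ▸ s ▸ t ⟩

infix 1 _⊩_≃_

open _⊩_≃_

eq : {s t : Term 𝟎} → H ⊩ s ≐ t → H ⊩ s ≃ t
eq = mk

num : {s t : Term 𝟎} → H ⊩ s ≃ t → H ⊩ s ≐ t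
num = formula

infix 20 ↑≃_

↑≃_ : {s t : Term σ} → H ⊩ s ≃ t → A ∷ H ⊩ s ≃ t
↑≃ p = mk (↑ formula p)

Eq-⟨⟩ : (a b : Tm Θ σ) (e : Env Θ) →
        Eq σ a b ⟨ e ⟩ ~ Eq σ (var v1) (var v0) ⟨ ∅ ▸ a ⟪ e ⟫ ▸ b ⟪ e ⟫ ⟩
Eq-⟨⟩ {σ = σ} a b e = mk λ η → trans (real-⟨⟩ η e (Eq σ a b)) (trans (sub-Eq σ) (trans
  (cong₂ (Eq σ) (sym (realᵗ-⟪⟫ η e a)) (sym (realᵗ-⟪⟫ η e b)))
  (sym (trans (real-⟨⟩ η _ (Eq σ (var v1) (var v0))) (sub-Eq σ)))))

real-Eq : (η : Names Γ) (s t : Term σ) →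
          real η (Eq σ (var v1) (var v0) ⟨ ∅ ▸ s ▸ t ⟩) ≡ Eq σ (realᵗ η s) (realᵗ η t)
real-Eq {σ = σ} η s t = trans (real-⟨⟩ η _ (Eq σ (var v1) (var v0))) (sub-Eq σ)

fromEq : {a b : Tm Θ σ} {e : Env Θ} → H ⊩ Eq σ a b ⟨ e ⟩ → H ⊩ a ⟪ e ⟫ ≃ b ⟪ e ⟫
fromEq d = mk (conv (Eq-⟨⟩ _ _ _) d)

toEq : {a b : Tm Θ σ} {e : Env Θ} → H ⊩ a ⟪ e ⟫ ≃ b ⟪ e ⟫ → H ⊩ Eq σ a b ⟨ e ⟩
toEq {a = a} {b} {e} d = conv (~sym (Eq-⟨⟩ a b e)) (formula d)

ext-app : {f : Term (σ ⇒ τ)} {s t : Term σ} → H ⊩ s ≃ t → H ⊩ f · s ≃ f · t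
ext-app {f = f} {s} {t} (mk d) = mk (mk λ η →
  subst (Th ∣ _ ⊢_) (sym (real-Eq η _ _)) (⊃E
    (ax (inj₁ (inj₁ (base (ext (realᵗ η f) (realᵗ η s) (realᵗ η t))))))
    (subst (Th ∣ _ ⊢_) (real-Eq η s t) (instantiate d η))))

app-cong : {f g : Term (σ ⇒ τ)} {t : Term σ} → H ⊩ f ≃ g → H ⊩ f · t ≃ g · t
app-cong {t = t} (mk d) = fromEq {a = var v2 · var v0} {var v1 · var v0} (d $∀ t)

funext : {f g : Term (σ ⇒ τ)} → (∀ x → H ⊩ f · x ≃ g · x) → H ⊩ f ≃ g
funext d = mk (allI λ x → toEq {a = var v2 · var v0} {var v1 · var v0} (d x))

O̲ : Term 𝟎
O̲ = con zero

S̲ : Term 𝟎 → Term 𝟎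
S̲ n = con suc · n

-- The bracket abstractions of these operations are large.  They are kept opaque
-- and enter formulas only as values of variables.

opaque

  predecessor : Term (𝟎 ⇒ 𝟎)
  predecessor = predᶜ ⟪ ∅ ⟫

  plus times monus : Term (𝟎 ⇒ 𝟎 ⇒ 𝟎)
  plus  = plusᶜ ⟪ ∅ ⟫
  times = timesᶜ ⟪ ∅ ⟫
  monus = monusᶜ ⟪ ∅ ⟫

  wk-monus-real : (η : Names Γ) → wk {τ = 𝟎} (realᵗ η monus) ≡ monusᶜ
  wk-monus-real η = refl

infixl 7 _⊞_ _⊟_
infixl 8 _⊠_

_⊞_ _⊟_ _⊠_ : Term 𝟎 → Term 𝟎 → Term 𝟎
s ⊞ t = plus · s · t
s ⊟ t = monus · s · t
s ⊠ t = times · s · t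

infix 6 _≼_ _≺_

_≼_ _≺_ : Term 𝟎 → Term 𝟎 → Form
s ≼ t = s ⊟ t ≐ O̲
s ≺ t = S̲ s ≼ t

module _ {Θ : Ctx} {φ : Fm (𝟎 ∷ Θ)} {e : Env Θ} {t : Term 𝟎} where

  private
    less : Fm (𝟎 ∷ 𝟎 ∷ (𝟎 ⇒ 𝟎 ⇒ 𝟎) ∷ Θ)
    less = var v2 · suc′ (var v0) · var v1 ≐ O

    φ′ : Fm (𝟎 ∷ 𝟎 ∷ (𝟎 ⇒ 𝟎 ⇒ 𝟎) ∷ Θ)
    φ′ = ren (∷⁺ʳ 𝟎 (λ x → there (there x))) φ

    e′ : Env (𝟎 ∷ (𝟎 ⇒ 𝟎 ⇒ 𝟎) ∷ Θ)
    e′ = e ▸ monus ▸ t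

    less-real : (η : Names Γ) → (var v0 < wk (realᵗ η t)) ≡ sub (lift (η ∙ e′)) less
    less-real η = cong (λ f → f · suc′ (var v0) · wk (realᵗ η t) ≐ O)
      (sym (wk-monus-real η))

    body : (η : Names Γ) → sub (lift (η ∙ e)) φ ≡ sub (lift (η ∙ e′)) φ′
    body η = sym (trans (sub-ren φ) (sub-cong (λ { v0 → refl ; (there x) → refl }) φ))

    φ′~φ : ∀ x → φ′ ⟨ e′ ▸ x ⟩ ~ φ ⟨ e ▸ x ⟩
    φ′~φ x = ren-⟨⟩ (λ { v0 → refl ; (there y) → refl }) φ

    all<-def : H ⊩ (all< t φ e ⊃ all 𝟎 (less ⊃ φ′) e′) ∧ (all 𝟎 (less ⊃ φ′) e′ ⊃ all< t φ e)
    all<-def = axiom λ η → subst (E-PRA^ω* _)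
      (cong₂ (λ χ ψ → (∀<[ realᵗ η t ] sub (lift (η ∙ e)) φ) ⇔ (∀[ 𝟎 ] χ ⊃ ψ)) (less-real η) (body η))
      (∀<-def (realᵗ η t) (sub (lift (η ∙ e)) φ))

    ex<-def : H ⊩ (ex< t φ e ⊃ ex 𝟎 (less ∧ φ′) e′) ∧ (ex 𝟎 (less ∧ φ′) e′ ⊃ ex< t φ e)
    ex<-def = axiom λ η → subst (E-PRA^ω* _)
      (cong₂ (λ χ ψ → (∃<[ realᵗ η t ] sub (lift (η ∙ e)) φ) ⇔ (∃[ 𝟎 ] χ ∧ ψ)) (less-real η) (body η))
      (∃<-def (realᵗ η t) (sub (lift (η ∙ e)) φ))

  all<E : H ⊩ all< t φ e → ∀ x → H ⊩ x ≺ t → H ⊩ φ ⟨ e ▸ x ⟩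
  all<E d x p = conv (φ′~φ x) (fst all<-def $ d $∀ x $ p)

  all<I : (∀ x → x ≺ t ∷ H ⊩ x ≺ t → x ≺ t ∷ H ⊩ φ ⟨ e ▸ x ⟩) → H ⊩ all< t φ e
  all<I d = snd all<-def $ allI λ x → lam⊃ λ p → conv (~sym (φ′~φ x)) (assume (d x))

  ex<I : ∀ x → H ⊩ x ≺ t → H ⊩ φ ⟨ e ▸ x ⟩ → H ⊩ ex< t φ e
  ex<I x p d = snd ex<-def $ exI x (p & conv (~sym (φ′~φ x)) d)

  ex<E : H ⊩ ex< t φ e →
         (∀ x → φ ⟨ e ▸ x ⟩ ∷ x ≺ t ∷ H ⊩ x ≺ t → φ ⟨ e ▸ x ⟩ ∷ x ≺ t ∷ H ⊩ φ ⟨ e ▸ x ⟩ →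
                φ ⟨ e ▸ x ⟩ ∷ x ≺ t ∷ H ⊩ C) → H ⊩ C
  ex<E d f = exE (fst ex<-def $ d) λ x h →
    -- `exE` adds one conjunctive hypothesis, while `f` expects two; these are introduced as
    -- implications and discharged by the two components.
    lam⊃ (λ _ → lam⊃ λ _ →
      embed (λ { v0 → v0 ; v1 → v1 ; (there (there y)) → there (there (there y)) })
        (f x (mk λ η → hyp v1) (mk λ η → hyp v0)))
    $ fst h $ conv (φ′~φ x) (snd h)

≃refl : {t : Term σ} → H ⊩ t ≃ t
≃refl {𝟎}       = eq (axiom λ η → ≐-refl _)
≃refl {σ ⇒ τ} = funext λ x → ≃refl
≃refl {σ *}     = mk (formula (≃refl {𝟎}) & all<I λ x p →
  toEq {a = con at · var v2 · var v0} {con at · var v1 · var v0} ≃refl)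

≃sym : {s t : Term σ} → H ⊩ s ≃ t → H ⊩ t ≃ s
≃sym {𝟎} d          = eq (axiom (λ η → ≐-sym _ _) $ num d)
≃sym {σ ⇒ τ} d      = funext λ x → ≃sym (app-cong d)
≃sym {σ *} {s = s} {t} (mk d) = mk (num l & all<I λ x p →
  toEq {a = con at · var v2 · var v0} {con at · var v1 · var v0}
    (≃sym (fromEq {a = con at · var v2 · var v0} {con at · var v1 · var v0}
      (all<E (↑ snd d) x (num (mk (conv′ p)))))))
  where
    l : _ ⊩ con len · t ≃ con len · s
    l = ≃sym {𝟎} (eq (fst d))
    conv′ : ∀ {x} → x ≺ con len · t ∷ _ ⊩ x ≺ con len · t → x ≺ con len · t ∷ _ ⊩ x ≺ con len · s
    conv′ {x} p = axiom (λ η → ≐-trans _ _ _) $ num (ext-app {f = monus · S̲ x} (↑≃ eq (fst d))) $ p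

≃trans : {s t u : Term σ} → H ⊩ s ≃ t → H ⊩ t ≃ u → H ⊩ s ≃ u
≃trans {𝟎} d d′          = eq (axiom (λ η → ≐-trans _ _ _) $ num d $ num d′)
≃trans {σ ⇒ τ} d d′      = funext λ x → ≃trans (app-cong d) (app-cong d′)
≃trans {σ *} {s = s} {t} (mk d) (mk d′) =
  mk (num (≃trans (eq (fst d)) (eq (fst d′))) & all<I λ x p →
  toEq {a = con at · var v2 · var v0} {con at · var v1 · var v0}
    (≃trans (fromEq {a = con at · var v2 · var v0} {con at · var v1 · var v0} (all<E (↑ snd d) x p))
            (fromEq {a = con at · var v2 · var v0} {con at · var v1 · var v0} (all<E (↑ snd d′) x
              (num (≃trans (≃sym (ext-app (↑≃ eq (fst d)))) (eq p)))))))

infixr 4 _⨾_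

_⨾_ : {s t u : Term σ} → H ⊩ s ≃ t → H ⊩ t ≃ u → H ⊩ s ≃ u
_⨾_ = ≃trans

infixl 9 _·≃_

_·≃_ : {f g : Term (σ ⇒ τ)} {s t : Term σ} → H ⊩ f ≃ g → H ⊩ s ≃ t → H ⊩ f · s ≃ g · t
p ·≃ q = app-cong p ⨾ ext-app q

K-eq : {s : Term σ} {t : Term τ} → H ⊩ con K · s · t ≃ s
K-eq = mk (axiom λ η → subst (E-PRA^ω* _) (sym (real-Eq η _ _)) (K-def _ _))

S-eq : {f : Term (ρ ⇒ σ ⇒ τ)} {g : Term (ρ ⇒ σ)} {t : Term ρ} → H ⊩ con S · f · g · t ≃ f · t · (g · t)
S-eq = mk (axiom λ η → subst (E-PRA^ω* _) (sym (real-Eq η _ _)) (S-def _ _ _))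

β : (t : Tm (σ ∷ Θ) τ) {e : Env Θ} {u : Term σ} → H ⊩ lam t ⟪ e ⟫ · u ≃ t ⟪ e ▸ u ⟫
β (var v0)        = S-eq ⨾ K-eq
β (var (there x)) = K-eq
β (con c)         = K-eq
β (f · t)         = S-eq ⨾ β f ·≃ β t

β₂ : (t : Tm (τ ∷ σ ∷ Θ) υ) {e : Env Θ} {u : Term σ} {v : Term τ} →
     H ⊩ lam (lam t) ⟪ e ⟫ · u · v ≃ t ⟪ e ▸ u ▸ v ⟫
β₂ t = app-cong (β (lam t)) ⨾ β t

-- Replacement of equals

infix 1 _⊩_≈_

data _⊩_≈_ (H : List Form) : Env Θ → Env Θ → Set where
  ∅   : H ⊩ ∅ ≈ ∅
  _▸_ : {e e′ : Env Θ} {s t : Term σ} → H ⊩ e ≈ e′ → H ⊩ s ≃ t → H ⊩ e ▸ s ≈ e′ ▸ t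

≈refl : {e : Env Θ} → H ⊩ e ≈ e
≈refl {e = ∅}     = ∅
≈refl {e = e ▸ t} = ≈refl ▸ ≃refl

≈sym : {e e′ : Env Θ} → H ⊩ e ≈ e′ → H ⊩ e′ ≈ e
≈sym ∅       = ∅
≈sym (p ▸ q) = ≈sym p ▸ ≃sym q

↑≈_ : {e e′ : Env Θ} → H ⊩ e ≈ e′ → A ∷ H ⊩ e ≈ e′
↑≈ ∅       = ∅
↑≈ (p ▸ q) = (↑≈ p) ▸ ↑≃ q

infix 20 ↑≈_

lookup-≈ : {e e′ : Env Θ} → H ⊩ e ≈ e′ → (x : σ ∈ Θ) → H ⊩ lookup e x ≃ lookup e′ x
lookup-≈ (p ▸ q) v0        = q
lookup-≈ (p ▸ q) (there x) = lookup-≈ p x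

⟪⟫-≈ : {e e′ : Env Θ} → H ⊩ e ≈ e′ → (t : Tm Θ σ) → H ⊩ t ⟪ e ⟫ ≃ t ⟪ e′ ⟫
⟪⟫-≈ p (var x) = lookup-≈ p x
⟪⟫-≈ p (con c) = ≃refl
⟪⟫-≈ p (f · t) = ⟪⟫-≈ p f ·≃ ⟪⟫-≈ p t

st-≃ : {s t : Term σ} → H ⊩ s ≃ t → H ⊩ st s → H ⊩ st t
st-≃ {s = s} {t} p d = axiom₀ {A = st s ∧ (Eq _ (var v1) (var v0) ⟨ ∅ ▸ s ▸ t ⟩) ⊃ st t}
  (λ η → subst (λ X → P₀ _ (st (realᵗ η s) ∧ X ⊃ st (realᵗ η t))) (sym (real-Eq η s t))
                (st-Eq (realᵗ η s) (realᵗ η t)))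
  $ (d & formula p)

≺-≃ : {x s t : Term 𝟎} → H ⊩ s ≃ t → H ⊩ x ≺ s → H ⊩ x ≺ t
≺-≃ p d = num (≃sym (ext-app p) ⨾ eq d)

leibniz : (φ : Fm Θ) {e e′ : Env Θ} → H ⊩ e ≈ e′ → H ⊩ φ ⟨ e ⟩ → H ⊩ φ ⟨ e′ ⟩
leibniz (s ≐ t) p d     = num (≃sym (⟪⟫-≈ p s) ⨾ eq d ⨾ ⟪⟫-≈ p t)
leibniz (st t) p d      = st-≃ (⟪⟫-≈ p t) d
leibniz ⊥′ p d          = d
leibniz (φ ∧ ψ) p d     = leibniz φ p (fst d) & leibniz ψ p (snd d)
leibniz (φ ∨ ψ) p d     =
  cases d (λ a → inl (leibniz φ (↑≈ p) a)) (λ b → inr (leibniz ψ (↑≈ p) b))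
leibniz (φ ⊃ ψ) p d     =
  lam⊃ λ a → leibniz ψ (↑≈ p) (↑ d $ leibniz φ (↑≈ ≈sym p) a)
leibniz (∀[ σ ] φ) p d  = allI λ x → leibniz φ (p ▸ ≃refl) (d $∀ x)
leibniz (∃[ σ ] φ) p d  = exE d λ x a → exI x (leibniz φ (↑≈ p ▸ ≃refl) a)
leibniz (∀<[ t ] φ) p d = all<I λ x b →
  leibniz φ (↑≈ p ▸ ≃refl) (all<E (↑ d) x (≺-≃ (≃sym (⟪⟫-≈ (↑≈ p) t)) b))
leibniz (∃<[ t ] φ) p d = ex<E d λ x b a →
  ex<I x (≺-≃ (⟪⟫-≈ (↑≈ ↑≈ p) t) b) (leibniz φ (↑≈ ↑≈ p ▸ ≃refl) a)

module _ (φ : Fm (𝟎 ∷ Θ)) (e : Env Θ) {q : QF φ} where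

  private
    next : Sub (𝟎 ∷ Θ) (𝟎 ∷ Θ)
    next = (λ x → var (there x)) ▹ suc′ (var v0)

    ind-axiom : H ⊩ φ ⟨ e ▸ O̲ ⟩ ∧ all 𝟎 (φ ⊃ sub next φ) e ⊃ all 𝟎 φ e
    ind-axiom = axiom λ η → subst (E-PRA^ω* _)
      (cong₂ (λ X Y → X ∧ (∀[ 𝟎 ] sub (lift (η ∙ e)) φ ⊃ Y) ⊃ (∀[ 𝟎 ] sub (lift (η ∙ e)) φ))
        (real-▸ η O̲)
        (trans (sub-sub φ) (trans
          (sub-cong (λ { v0 → refl ; (there x) →
            trans (subTm-renTm (realᵗ η (lookup e x))) (sym (ren-as-sub (realᵗ η (lookup e x)))) }) φ)
          (sym (sub-sub φ)))))
      (QF-ind (sub (lift (η ∙ e)) φ) (QF-sub φ q))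
      where
        ren-as-sub : (t : Tm Γ σ) → wk {τ = τ} t ≡ subTm (λ x → var (there x)) t
        ren-as-sub (var x) = refl
        ren-as-sub (con c) = refl
        ren-as-sub (f · t) = cong₂ _·_ (ren-as-sub f) (ren-as-sub t)

  ind : H ⊩ φ ⟨ e ▸ O̲ ⟩ →
        (∀ n → φ ⟨ e ▸ n ⟩ ∷ H ⊩ φ ⟨ e ▸ n ⟩ → φ ⟨ e ▸ n ⟩ ∷ H ⊩ φ ⟨ e ▸ S̲ n ⟩) →
        ∀ n → H ⊩ φ ⟨ e ▸ n ⟩
  ind d f n = ind-axiom $ (d & (allI λ m → lam⊃ λ h →
    conv (~sym (sub-⟨⟩ (λ { v0 → refl ; (there x) → refl }) φ)) (f m h))) $∀ n

-- Arithmetic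

private variable
  a b c i j k m n s t u y : Term 𝟎

S̲-cong : H ⊩ s ≃ t → H ⊩ S̲ s ≃ S̲ t
S̲-cong = ext-app

⊞-cong : H ⊩ a ≃ b → H ⊩ s ≃ t → H ⊩ a ⊞ s ≃ b ⊞ t
⊞-cong p q = ext-app p ·≃ q

⊟-cong : H ⊩ a ≃ b → H ⊩ s ≃ t → H ⊩ a ⊟ s ≃ b ⊟ t
⊟-cong p q = ext-app p ·≃ q

⊠-cong : H ⊩ a ≃ b → H ⊩ s ≃ t → H ⊩ a ⊠ s ≃ b ⊠ t
⊠-cong p q = ext-app p ·≃ q

S̲≢O̲ : H ⊩ S̲ t ≃ O̲ → H ⊩ A
S̲≢O̲ p = absurd (axiom (λ η → suc≢0 _) $ num p)

S̲-inj : H ⊩ S̲ s ≃ S̲ t → H ⊩ s ≃ t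
S̲-inj p = eq (axiom (λ η → suc-inj _ _) $ num p)

recᵗ : Term 𝟎 → Term 𝟎 → Term (𝟎 ⇒ 𝟎 ⇒ 𝟎) → Term 𝟎
recᵗ n y z = con R₀ · n · y · z

rec-O̲ : ∀ {y z} → H ⊩ recᵗ O̲ y z ≃ y
rec-O̲ = eq (axiom λ η → R₀-zero _ _)

rec-S̲ : ∀ {n y z} → H ⊩ recᵗ (S̲ n) y z ≃ z · recᵗ n y z · n
rec-S̲ = eq (axiom λ η → R₀-suc _ _ _)

rec-lam : (t : Tm (𝟎 ∷ 𝟎 ∷ Θ) 𝟎) {e : Env Θ} →
          H ⊩ recᵗ (S̲ n) y (lam (lam t) ⟪ e ⟫) ≃ t ⟪ e ▸ recᵗ n y (lam (lam t) ⟪ e ⟫) ▸ n ⟫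
rec-lam t = rec-S̲ ⨾ β₂ t

private
  predᵇ : Tm (𝟎 ∷ Γ) 𝟎
  predᵇ = rec (var v0) O (lam (lam (var v0)))

  plusᵇ timesᵇ monusᵇ : Tm (𝟎 ∷ 𝟎 ∷ Γ) 𝟎
  plusᵇ  = rec (var v0) (var v1) (lam (lam (suc′ (var v1))))
  timesᵇ = rec (var v0) O (lam (lam (plusᶜ · var v1 · var v3)))
  monusᵇ = rec (var v0) (var v1) (lam (lam (predᶜ · var v1)))

pred : Term 𝟎 → Term 𝟎
pred n = predecessor · n

opaque
  unfolding predecessor

  pred-def : H ⊩ pred n ≃ predᵇ ⟪ ∅ ▸ n ⟫
  pred-def = β predᵇ {∅}

  ⊞-def : H ⊩ s ⊞ t ≃ plusᵇ ⟪ ∅ ▸ s ▸ t ⟫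
  ⊞-def = β₂ plusᵇ {∅}

  ⊠-def : H ⊩ s ⊠ t ≃ timesᵇ ⟪ ∅ ▸ s ▸ t ⟫
  ⊠-def = β₂ timesᵇ {∅}

  ⊟-def : H ⊩ s ⊟ t ≃ monusᵇ ⟪ ∅ ▸ s ▸ t ⟫
  ⊟-def = β₂ monusᵇ {∅}

  ⊠-step : H ⊩ recᵗ (S̲ n) y (lam (lam (plusᶜ · var v1 · var v3)) ⟪ ∅ ▸ s ▸ t ⟫) ≃
               recᵗ n y (lam (lam (plusᶜ · var v1 · var v3)) ⟪ ∅ ▸ s ▸ t ⟫) ⊞ s
  ⊠-step {s = s} {t} = rec-lam (plusᶜ · var v1 · var v3) {∅ ▸ s ▸ t}

  ⊟-step : H ⊩ recᵗ (S̲ n) y (lam (lam (predᶜ · var v1)) ⟪ ∅ ▸ s ▸ t ⟫) ≃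
               pred (recᵗ n y (lam (lam (predᶜ · var v1)) ⟪ ∅ ▸ s ▸ t ⟫))
  ⊟-step {s = s} {t} = rec-lam (predᶜ · var v1) {∅ ▸ s ▸ t}

pred-O̲ : H ⊩ pred O̲ ≃ O̲
pred-O̲ = pred-def ⨾ rec-O̲

pred-S̲ : H ⊩ pred (S̲ n) ≃ n
pred-S̲ {n = n} = pred-def ⨾ rec-lam (var v0) {∅ ▸ S̲ n}

pred-cong : H ⊩ s ≃ t → H ⊩ pred s ≃ pred t
pred-cong = ext-app

⊞-O̲ : H ⊩ s ⊞ O̲ ≃ s
⊞-O̲ = ⊞-def ⨾ rec-O̲

⊞-S̲ : H ⊩ s ⊞ S̲ t ≃ S̲ (s ⊞ t)
⊞-S̲ {s = s} {t} = ⊞-def ⨾ rec-lam (suc′ (var v1)) {∅ ▸ s ▸ S̲ t} ⨾ S̲-cong (≃sym ⊞-def)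

⊠-O̲ : H ⊩ s ⊠ O̲ ≃ O̲
⊠-O̲ = ⊠-def ⨾ rec-O̲

⊠-S̲ : H ⊩ s ⊠ S̲ t ≃ s ⊠ t ⊞ s
⊠-S̲ {s = s} {t} = ⊠-def ⨾ ⊠-step {t = S̲ t}
  ⨾ ⊞-cong (≃sym ⊠-def) ≃refl

⊟-O̲ : H ⊩ s ⊟ O̲ ≃ s
⊟-O̲ = ⊟-def ⨾ rec-O̲

⊟-S̲ : H ⊩ s ⊟ S̲ t ≃ pred (s ⊟ t)
⊟-S̲ {s = s} {t} = ⊟-def ⨾ ⊟-step {s = s} {t = S̲ t} ⨾ pred-cong (≃sym ⊟-def)

O̲-⊞ : H ⊩ O̲ ⊞ t ≃ t
O̲-⊞ {t = t} = eq (ind (var v1 · O · var v0 ≐ var v0) (∅ ▸ plus) (num ⊞-O̲)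
  (λ n h → num (⊞-S̲ ⨾ S̲-cong (eq h))) t)

S̲-⊞ : H ⊩ S̲ s ⊞ t ≃ S̲ (s ⊞ t)
S̲-⊞ {s = s} {t} = eq (ind (var v2 · suc′ (var v1) · var v0 ≐ suc′ (var v2 · var v1 · var v0)) (∅ ▸ plus ▸ s)
  (num (⊞-O̲ ⨾ S̲-cong (≃sym ⊞-O̲)))
  (λ n h → num (⊞-S̲ ⨾ S̲-cong (eq h ⨾ ≃sym ⊞-S̲))) t)

⊞-comm : H ⊩ s ⊞ t ≃ t ⊞ s
⊞-comm {s = s} {t} = eq (ind (var v2 · var v1 · var v0 ≐ var v2 · var v0 · var v1) (∅ ▸ plus ▸ s)
  (num (⊞-O̲ ⨾ ≃sym O̲-⊞))
  (λ n h → num (⊞-S̲ ⨾ S̲-cong (eq h) ⨾ ≃sym S̲-⊞)) t)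

⊞-assoc : H ⊩ (s ⊞ t) ⊞ u ≃ s ⊞ (t ⊞ u)
⊞-assoc {s = s} {t} {u} = eq (ind
  (var v3 · (var v3 · var v2 · var v1) · var v0 ≐ var v3 · var v2 · (var v3 · var v1 · var v0))
  (∅ ▸ plus ▸ s ▸ t)
  (num (⊞-O̲ ⨾ ⊞-cong ≃refl (≃sym ⊞-O̲)))
  (λ n h → num (⊞-S̲ ⨾ S̲-cong (eq h) ⨾ ≃sym ⊞-S̲ ⨾ ⊞-cong ≃refl (≃sym ⊞-S̲))) u)

S̲⊟S̲ : H ⊩ S̲ s ⊟ S̲ t ≃ s ⊟ t
S̲⊟S̲ {s = s} {t} = eq (ind (var v2 · suc′ (var v1) · suc′ (var v0) ≐ var v2 · var v1 · var v0) (∅ ▸ monus ▸ s)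
  (num (⊟-S̲ ⨾ pred-cong ⊟-O̲ ⨾ pred-S̲ ⨾ ≃sym ⊟-O̲))
  (λ n h → num (⊟-S̲ ⨾ pred-cong (eq h) ⨾ ≃sym ⊟-S̲)) t)

O̲⊟ : H ⊩ O̲ ⊟ t ≃ O̲
O̲⊟ {t = t} = eq (ind (var v1 · O · var v0 ≐ O) (∅ ▸ monus) (num ⊟-O̲)
  (λ n h → num (⊟-S̲ ⨾ pred-cong (eq h) ⨾ pred-O̲)) t)

⊟-self : H ⊩ s ⊟ s ≃ O̲
⊟-self {s = s} = eq (ind (var v1 · var v0 · var v0 ≐ O) (∅ ▸ monus) (num ⊟-O̲)
  (λ n h → num (S̲⊟S̲ ⨾ eq h)) s)

S̲⊟-self : H ⊩ S̲ s ⊟ s ≃ S̲ O̲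
S̲⊟-self {s = s} = eq (ind (var v1 · suc′ (var v0) · var v0 ≐ suc′ O) (∅ ▸ monus) (num ⊟-O̲)
  (λ n h → num (S̲⊟S̲ ⨾ eq h)) s)

-- Induction is quantifier-free, so the predecessor has to be named by a term instead of being
-- asserted to exist.
zero-or-S̲ : ∀ n → H ⊩ (n ≐ O̲) ∨ (n ≐ S̲ (pred n))
zero-or-S̲ = ind ((var v0 ≐ O) ∨ (var v0 ≐ suc′ (var v1 · var v0))) (∅ ▸ predecessor) (inl (num ≃refl))
  (λ n h → inr (num (S̲-cong (≃sym pred-S̲))))

split : ∀ n → (n ≐ O̲ ∷ H ⊩ n ≃ O̲ → n ≐ O̲ ∷ H ⊩ C) →
              (n ≐ S̲ (pred n) ∷ H ⊩ n ≃ S̲ (pred n) → n ≐ S̲ (pred n) ∷ H ⊩ C) → H ⊩ C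
split n f g = cases (zero-or-S̲ n) (λ h → f (eq h)) (λ h → g (eq h))

≼-refl : H ⊩ s ≼ s
≼-refl = num ⊟-self

≼-reflexive : H ⊩ s ≃ t → H ⊩ s ≼ t
≼-reflexive p = num (⊟-cong p ≃refl ⨾ ⊟-self)

O̲≼ : H ⊩ O̲ ≼ t
O̲≼ = num O̲⊟

≼-≃ : H ⊩ a ≃ b → H ⊩ s ≃ t → H ⊩ a ≼ s → H ⊩ b ≼ t
≼-≃ p q d = num (⊟-cong (≃sym p) (≃sym q) ⨾ eq d)

S̲≼S̲ : H ⊩ s ≼ t → H ⊩ S̲ s ≼ S̲ t
S̲≼S̲ d = num (S̲⊟S̲ ⨾ eq d)

S̲≼S̲⁻¹ : H ⊩ S̲ s ≼ S̲ t → H ⊩ s ≼ t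
S̲≼S̲⁻¹ d = num (≃sym S̲⊟S̲ ⨾ eq d)

≺-irrefl : H ⊩ s ≺ s → H ⊩ A
≺-irrefl d = S̲≢O̲ (≃sym S̲⊟-self ⨾ eq d)

⊀O̲ : H ⊩ s ≺ O̲ → H ⊩ A
⊀O̲ d = S̲≢O̲ (≃sym ⊟-O̲ ⨾ eq d)

≺⇒≼ : H ⊩ s ≺ t → H ⊩ s ≼ t
≺⇒≼ {s = s} {t} d = split t
  (λ p → ⊀O̲ (≼-≃ ≃refl p (↑ d)))
  (λ p → num (⊟-cong ≃refl p ⨾ ⊟-S̲ ⨾ pred-cong (eq (S̲≼S̲⁻¹ (≼-≃ ≃refl p (↑ d)))) ⨾ pred-O̲))

-- Induction on `s` with `t` fixed. It turns an inequality into an explicit sum, from which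
-- transitivity, antisymmetry and monotonicity follow by calculation.
≼-⊞⊟ : H ⊩ s ≼ t → H ⊩ s ⊞ (t ⊟ s) ≃ t
≼-⊞⊟ {s = s} {t} d = eq (ind
  (var v2 · var v0 · var v1 ≐ O ⊃ var v3 · var v0 · (var v2 · var v1 · var v0) ≐ var v1)
  (∅ ▸ plus ▸ monus ▸ t)
  (lam⊃ λ _ → num (O̲-⊞ ⨾ ⊟-O̲))
  (λ n h → lam⊃ λ p → split (t ⊟ n)
    -- If `t ⊟ n` were zero, the induction hypothesis would give `n = t`, against `n < t`.
    (λ q → ≺-irrefl (≼-≃ ≃refl (≃sym (eq (↑ (↑ h $ ≺⇒≼ p))) ⨾ ⊞-cong ≃refl q ⨾ ⊞-O̲) (↑ p)))
    (λ q → num (⊞-cong ≃refl (⊟-S̲ ⨾ pred-cong q ⨾ pred-S̲) ⨾ S̲-⊞ ⨾ ≃sym ⊞-S̲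
                 ⨾ ⊞-cong ≃refl (≃sym q) ⨾ eq (↑ (↑ h $ ≺⇒≼ p)))))
  s $ d)

≼-⊞ : H ⊩ s ≼ s ⊞ k
≼-⊞ {s = s} {k} = ind (var v2 · var v1 · (var v3 · var v1 · var v0) ≐ O) (∅ ▸ plus ▸ monus ▸ s)
  (num (⊟-cong ≃refl ⊞-O̲ ⨾ ⊟-self))
  (λ n h → num (⊟-cong ≃refl ⊞-S̲ ⨾ ⊟-S̲ ⨾ pred-cong (eq h) ⨾ pred-O̲)) k

≼-trans : H ⊩ s ≼ t → H ⊩ t ≼ u → H ⊩ s ≼ u
≼-trans d d′ = ≼-≃ ≃refl (≃sym ⊞-assoc ⨾ ⊞-cong (≼-⊞⊟ d) ≃refl ⨾ ≼-⊞⊟ d′) ≼-⊞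

≼-antisym : H ⊩ s ≼ t → H ⊩ t ≼ s → H ⊩ s ≃ t
≼-antisym d d′ = ≃sym ⊞-O̲ ⨾ ⊞-cong ≃refl (≃sym (eq d′)) ⨾ ≼-⊞⊟ d

≼S̲ : H ⊩ s ≼ S̲ s
≼S̲ = ≺⇒≼ ≼-refl

≼-split : H ⊩ s ≼ t → H ⊩ (s ≺ t) ∨ (s ≐ t)
≼-split {s = s} {t} d = split (t ⊟ s)
  (λ q → inr (num (≼-antisym (↑ d) (num q))))
  (λ q → inl (≼-≃ ≃refl (S̲-⊞ ⨾ ≃sym ⊞-S̲ ⨾ ⊞-cong ≃refl (≃sym q) ⨾ ≼-⊞⊟ (↑ d)) ≼-⊞))

≼-or-≻ : ∀ s t → H ⊩ (s ≼ t) ∨ (t ≺ s)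
≼-or-≻ s t = ind 
  ((var v2 · var v0 · var v1 ≐ O) ∨ (var v2 · suc′ (var v1) · var v0 ≐ O)) (∅ ▸ monus ▸ t)
  (inl O̲≼)
  (λ n h → cases h
    (λ p → cases (≼-split p) inl (λ q → inr (S̲≼S̲ (≼-reflexive (≃sym (eq q))))))
    (λ p → inr (≼-trans p ≼S̲))) s

-- The pairing function

⊞-monoˡ : H ⊩ s ≼ t → H ⊩ s ⊞ u ≼ t ⊞ u
⊞-monoˡ d = ≼-≃ ≃refl
  (⊞-assoc ⨾ ⊞-cong ≃refl ⊞-comm ⨾ ≃sym ⊞-assoc ⨾ ⊞-cong (≼-⊞⊟ d) ≃refl) ≼-⊞

⊞-mono : H ⊩ a ≼ b → H ⊩ s ≼ t → H ⊩ a ⊞ s ≼ b ⊞ t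
⊞-mono d d′ = ≼-trans (⊞-monoˡ d) (≼-≃ ⊞-comm ⊞-comm (⊞-monoˡ d′))

⊞-cancelˡ : H ⊩ u ⊞ s ≃ u ⊞ t → H ⊩ s ≃ t
⊞-cancelˡ {u = u} {s} {t} d = eq (ind
  (var v3 · var v0 · var v2 ≐ var v3 · var v0 · var v1 ⊃ var v2 ≐ var v1) (∅ ▸ plus ▸ s ▸ t)
  (lam⊃ λ p → num (≃sym O̲-⊞ ⨾ eq p ⨾ O̲-⊞))
  (λ n h → lam⊃ λ p → ↑ h $ num (S̲-inj (≃sym S̲-⊞ ⨾ eq p ⨾ S̲-⊞))) u $ num d)

⊠-monoˡ : H ⊩ s ≼ t → H ⊩ s ⊠ u ≼ t ⊠ u
⊠-monoˡ {s = s} {t} {u} d = ind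
  (var v3 · (var v4 · var v2 · var v0) · (var v4 · var v1 · var v0) ≐ O) (∅ ▸ times ▸ monus ▸ s ▸ t)
  (≼-≃ (≃sym ⊠-O̲) ≃refl O̲≼)
  (λ n h → ≼-≃ (≃sym ⊠-S̲) (≃sym ⊠-S̲) (⊞-mono h (↑ d))) u

-- `times` recurses on its second argument, so that argument is written as `s ⊞ (t ⊟ s)` and the
-- induction runs on the difference.
⊠-monoʳ : H ⊩ s ≼ t → H ⊩ u ⊠ s ≼ u ⊠ t
⊠-monoʳ {s = s} {t} {u} d = ≼-≃ ≃refl (⊠-cong ≃refl (≼-⊞⊟ d))
  (ind
    (var v3 · (var v4 · var v1 · var v2) · (var v4 · var v1 · (var v5 · var v2 · var v0)) ≐ O)
    (∅ ▸ plus ▸ times ▸ monus ▸ s ▸ u)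
    (≼-reflexive (⊠-cong ≃refl (≃sym ⊞-O̲)))
    (λ n h → ≼-trans h (≼-≃ ≃refl (≃sym (⊠-cong ≃refl ⊞-S̲ ⨾ ⊠-S̲)) ≼-⊞)) (t ⊟ s))

pairᵗ : Term 𝟎 → Term 𝟎 → Term 𝟎
pairᵗ i j = (i ⊞ j) ⊠ (i ⊞ j) ⊞ i

pairᵗ-cong : H ⊩ a ≃ b → H ⊩ s ≃ t → H ⊩ pairᵗ a s ≃ pairᵗ b t
pairᵗ-cong p q = ⊞-cong (⊠-cong (⊞-cong p q) (⊞-cong p q)) p

-- a ² + i < (a + 1) ² ≤ b ² whenever i ≤ a < b.
square-gap : H ⊩ i ≼ a → H ⊩ a ≺ b → H ⊩ a ⊠ a ⊞ i ≺ b ⊠ b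
square-gap d p = ≼-trans (≼-≃ ⊞-S̲ ≃refl (⊞-mono (⊠-monoˡ (≺⇒≼ p)) (≼-trans (S̲≼S̲ d) p)))
  (≼-≃ ⊠-S̲ ≃refl (⊠-monoʳ p))

-- The chain (i + j)² + i < (m + n)² ≤ (m + n)² + m: codes of pairs with different sums lie in
-- disjoint intervals between squares.
pairᵗ-≺ : H ⊩ i ⊞ j ≺ m ⊞ n → H ⊩ pairᵗ i j ≃ pairᵗ m n → H ⊩ A
pairᵗ-≺ p q = ≺-irrefl (≼-≃ (S̲-cong q) ≃refl (≼-trans (square-gap ≼-⊞ p) ≼-⊞))

pairᵗ-sum : H ⊩ pairᵗ i j ≃ pairᵗ m n → H ⊩ i ⊞ j ≃ m ⊞ n
pairᵗ-sum {i = i} {j} {m} {n} p = eq (cases (≼-or-≻ (i ⊞ j) (m ⊞ n))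
  (λ q → cases (≼-split q) (λ r → pairᵗ-≺ r (↑≃ ↑≃ p)) id)
  (λ q → pairᵗ-≺ q (↑≃ ≃sym p)))

pairᵗ-injˡ : H ⊩ pairᵗ i j ≃ pairᵗ m n → H ⊩ i ≃ m
pairᵗ-injˡ p = ⊞-cancelˡ (p ⨾ ⊞-cong (⊠-cong (≃sym q) (≃sym q)) ≃refl)
  where q = pairᵗ-sum p

pairᵗ-injʳ : H ⊩ pairᵗ i j ≃ pairᵗ m n → H ⊩ j ≃ n
pairᵗ-injʳ p = ⊞-cancelˡ (pairᵗ-sum p ⨾ ⊞-cong (≃sym (pairᵗ-injˡ p)) ≃refl)

-- Standard terms

st-con : {c : Con σ} → H ⊩ st (con c)
st-con {c = c} = axiom₀ λ η → st-closed (con c)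

st-· : {f : Term (σ ⇒ τ)} {t : Term σ} → H ⊩ st f → H ⊩ st t → H ⊩ st (f · t)
st-· p q = axiom₀ (λ η → st-app _ _) $ (p & q)

infix 1 _⊩st_

data _⊩st_ (H : List Form) : Env Θ → Set where
  ∅   : H ⊩st ∅
  _▸_ : {e : Env Θ} {t : Term σ} → H ⊩st e → H ⊩ st t → H ⊩st e ▸ t

↑ˢ_ : {e : Env Θ} → H ⊩st e → A ∷ H ⊩st e
↑ˢ ∅       = ∅
↑ˢ (p ▸ q) = (↑ˢ p) ▸ ↑ q

infix 20 ↑ˢ_

st-lookup : {e : Env Θ} → H ⊩st e → (x : σ ∈ Θ) → H ⊩ st (lookup e x)
st-lookup (p ▸ q) v0        = q
st-lookup (p ▸ q) (there x) = st-lookup p x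

st-⟪⟫ : {e : Env Θ} → H ⊩st e → (t : Tm Θ σ) → H ⊩ st (t ⟪ e ⟫)
st-⟪⟫ p (var x) = st-lookup p x
st-⟪⟫ p (con c) = st-con
st-⟪⟫ p (f · t) = st-· (st-⟪⟫ p f) (st-⟪⟫ p t)

st-S̲ : H ⊩ st n → H ⊩ st (S̲ n)
st-S̲ = st-· st-con

opaque
  unfolding plus

  st-predecessor : H ⊩ st predecessor
  st-predecessor = st-⟪⟫ ∅ predᶜ

  st-plus : H ⊩ st plus
  st-plus = st-⟪⟫ ∅ plusᶜ

  st-times : H ⊩ st times
  st-times = st-⟪⟫ ∅ timesᶜ

  st-monus : H ⊩ st monus
  st-monus = st-⟪⟫ ∅ monusᶜ

-- Definition by cases

ifz : Tm Γ 𝟎 → Tm Γ 𝟎 → Tm Γ 𝟎 → Tm Γ 𝟎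
ifz a b c = rec a b (con K · (con K · c))

ifzᵗ : Term 𝟎 → Term 𝟎 → Term 𝟎 → Term 𝟎
ifzᵗ a b c = recᵗ a b (con K · (con K · c))

recᵗ-cong : ∀ {z} → H ⊩ m ≃ n → H ⊩ recᵗ m y z ≃ recᵗ n y z
recᵗ-cong p = app-cong (app-cong (ext-app p))

ifz-O̲ : H ⊩ a ≃ O̲ → H ⊩ ifzᵗ a b c ≃ b
ifz-O̲ p = recᵗ-cong p ⨾ rec-O̲

ifz-S̲ : H ⊩ a ≃ S̲ n → H ⊩ ifzᵗ a b c ≃ c
ifz-S̲ p = recᵗ-cong p ⨾ rec-S̲ ⨾ app-cong K-eq ⨾ K-eq

O̲≢S̲ : H ⊩ t ≃ O̲ → H ⊩ t ≃ S̲ n → H ⊩ A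
O̲≢S̲ p q = S̲≢O̲ (≃sym q ⨾ p)

S̲⇒≢O̲ : H ⊩ t ≃ S̲ n → H ⊩ t ≐ O̲ ⊃ ⊥′
S̲⇒≢O̲ p = lam⊃ λ q → O̲≢S̲ (eq q) (↑≃ p)

-- Transfer, standard parts and unbounded search

Zero : Term 𝟏 → Form
Zero f = (∃ˢᵗ[ 𝟎 ] var v1 · var v0 ≐ O) ⟨ ∅ ▸ f ⟩

transfer : {f : Term 𝟏} → H ⊩ st f → H ⊩ f · n ≐ O̲ → H ⊩ Zero f
transfer {n = n} {f = f} p q = contra λ h →
  ↑ trans-axiom $∀ f $ ↑ p $ (allI λ m → lam⊃ λ sm → lam⊃ λ z → ↑² h $ exI m (↑ sm & z)) $∀ n $ ↑ q
  where
    trans-axiom : H ⊩ Π⁰₁-TRANS ⟨ ∅ ⟩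
    trans-axiom = mk λ η → ax (inj₁ (inj₂ refl))

binary : Fm (𝟏 ∷ (𝟎 ⇒ 𝟎 ⇒ 𝟎) ∷ Θ)
binary = ∀[ 𝟎 ] var v2 · (var v1 · var v0) · suc′ O ≐ O

StandardPart : Fm (𝟏 ∷ (𝟎 ⇒ 𝟎 ⇒ 𝟎) ∷ [])
StandardPart = ∃ˢᵗ[ 𝟏 ] (∀[ 𝟎 ] var v3 · (var v1 · var v0) · suc′ O ≐ O) ∧
                        (∀ˢᵗ[ 𝟎 ] var v2 · var v0 ≐ var v1 · var v0)

opaque
  unfolding monus

  standardPart : {f : Term 𝟏} → H ⊩ binary ⟨ ∅ ▸ monus ▸ f ⟩ → H ⊩ StandardPart ⟨ ∅ ▸ monus ▸ f ⟩
  standardPart {H} {f} d = stp $∀ f $ d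
    where
      stp : H ⊩ (∀[ 𝟏 ] binary ⊃ StandardPart) ⟨ ∅ ▸ monus ⟩
      stp = mk λ η → ax (inj₂ refl)

-- HAC-int only provides a finite sequence of candidates for a zero, which is searched.

private

  candidate : Fm (𝟎 ∷ 𝟏 ∷ Γ)
  candidate = (∃[ 𝟎 ] var v2 · var v0 ≐ O) ⊃ var v1 · var v0 ≐ O

  candidates : H ⊩ (∃ˢᵗ[ 𝟏 ⇒ 𝟎 * ] ∀ˢᵗ[ 𝟏 ] ∃[ 𝟎 ] var v0 ε (var v2 · var v1) ∧
                     ((∃[ 𝟎 ] var v2 · var v0 ≐ O) ⊃ var v1 · var v0 ≐ O)) ⟨ ∅ ⟩
  candidates = axiom₀ {A = ((∀ˢᵗ[ 𝟏 ] ∃ˢᵗ[ 𝟎 ] candidate) ⊃ _) ⟨ ∅ ⟩} (λ η → HAC-int candidate _)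
    $ allI λ f → lam⊃ λ sf → byCases (Zero f)
      (λ z → exE z λ n h → exI n (fst h & lam⊃ λ _ → ↑ snd h))
      -- Without a standard zero there is none at all, by transfer; the implication is then vacuous
      -- and any standard value serves.
      (λ z → exI O̲ (st-con & lam⊃ λ h → exE h λ n q → absurd (↑² z $ transfer (↑³ sf) q)))

  stepᵇ : Tm (𝟎 ∷ 𝟎 ∷ 𝟏 ∷ (𝟏 ⇒ 𝟎 *) ∷ []) 𝟎
  stepᵇ = ifz (var v2 · ((var v3 · var v2) ! var v0)) ((var v3 · var v2) ! var v0) (var v1)

  searchᵇ : Tm (𝟏 ∷ (𝟏 ⇒ 𝟎 *) ∷ []) 𝟎
  searchᵇ = rec (length (var v1 · var v0)) O (lam (lam stepᵇ))

  module _ {Φ : Term (𝟏 ⇒ 𝟎 *)} {f : Term 𝟏} where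

    entry : Term 𝟎 → Term 𝟎
    entry i = con at · (Φ · f) · i

    step = lam (lam stepᵇ) ⟪ ∅ ▸ Φ ▸ f ⟫

    -- Each step either replaces the current value by an entry that is a zero of `f` or keeps it, so
    -- from stage `i + 1` on the value is a zero.
    search-≺ : H ⊩ f · entry i ≃ O̲ → ∀ n → H ⊩ i ≺ n ⊃ f · recᵗ n O̲ step ≐ O̲
    search-≺ {i = i} p = ind
      (var v4 · suc′ (var v3) · var v0 ≐ O ⊃ var v2 · rec (var v0) O (var v1) ≐ O)
      (∅ ▸ monus ▸ i ▸ f ▸ step)
      (lam⊃ ⊀O̲)
      λ n h → lam⊃ λ q → split (f · entry n)
        (λ z → num (ext-app (rec-lam stepᵇ {∅ ▸ Φ ▸ f} ⨾ ifz-O̲ z) ⨾ z))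
        (λ z → num (ext-app (rec-lam stepᵇ {∅ ▸ Φ ▸ f} ⨾ ifz-S̲ z) ⨾ eq (cases (≼-split (S̲≼S̲⁻¹ (↑ q)))
          (λ r → ↑³ h $ r)
          (λ r → O̲≢S̲ (ext-app (ext-app (≃sym (eq r))) ⨾ ↑≃ ↑≃ ↑≃ ↑≃ p) (↑≃ z)))))

-- Feferman's search operator μ, restricted to standard functions. The number `n` that witnesses the
-- zero may be nonstandard, which already incorporates transfer.
Search : Fm ((𝟏 ⇒ 𝟎) ∷ Γ)
Search = ∀ˢᵗ[ 𝟏 ] ∀[ 𝟎 ] var v1 · var v0 ≐ O ⊃ var v1 · (var v2 · var v1) ≐ O

search : H ⊩ (∃ˢᵗ[ 𝟏 ⇒ 𝟎 ] Search) ⟨ ∅ ⟩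
search = exE candidates λ Φ h → exI (lam searchᵇ ⟪ ∅ ▸ Φ ⟫) (st-⟪⟫ (∅ ▸ fst h) (lam searchᵇ) &
  allI λ f → lam⊃ λ sf → allI λ n → lam⊃ λ z → num (ext-app (β searchᵇ {∅ ▸ Φ}) ⨾ eq
    (exE (↑² snd h $∀ f $ ↑ sf) λ m g → ex<E (fst g) λ i i≺ m≐ →
      search-≺ (ext-app (≃sym (eq m≐)) ⨾ eq (↑² snd g $ exI n (↑³ z))) _ $ i≺)))

-- Standard numbers form an initial segment

private

  aboveᵇ : Tm (𝟎 ∷ 𝟎 ∷ (𝟎 ⇒ 𝟎 ⇒ 𝟎) ∷ []) 𝟎
  aboveᵇ = ifz (var v2 · var v1 · var v0) (suc′ O) O

  above : Term 𝟎 → Term 𝟏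
  above i = lam aboveᵇ ⟪ ∅ ▸ monus ▸ i ⟫

  above-≽ : H ⊩ i ≼ k → H ⊩ above i · k ≃ S̲ O̲
  above-≽ {i = i} p = β aboveᵇ {∅ ▸ monus ▸ i} ⨾ ifz-O̲ (eq p)

  above-≺ : H ⊩ k ≺ i → H ⊩ above i · k ≃ O̲
  above-≺ {k = k} {i} p = eq (split (i ⊟ k)
    (λ q → ≺-irrefl (≼-trans (↑ p) (num q)))
    (λ q → num (β aboveᵇ {∅ ▸ monus ▸ i} ⨾ ifz-S̲ q)))

  above-binary : H ⊩ binary ⟨ ∅ ▸ monus ▸ above i ⟩
  above-binary {i = i} = allI λ k → cases (≼-or-≻ i k)
    (λ p → ≼-reflexive (above-≽ p))
    (λ p → ≼-≃ (≃sym (above-≺ p)) ≃refl O̲≼)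

  leastᵇ : Tm (𝟎 ∷ 𝟎 ∷ 𝟎 ∷ 𝟏 ∷ []) 𝟎
  leastᵇ = ifz (var v3 · var v1) (suc′ (var v0)) (var v1)

  -- The least m < n with g m ≠ 0, and n if there is none.
  least : Tm (𝟎 ∷ 𝟏 ∷ []) 𝟎
  least = rec (var v0) O (lam (lam leastᵇ))

  module _ {g : Term 𝟏} where

    -- Minimality is expressed through the immediate predecessor alone. This keeps the formula
    -- within quantifier-free induction, and a single zero of `g` just below a nonzero value is
    -- enough to locate a jump.
    Least : Term 𝟎 → Form
    Least n = (l ≐ O̲ ∨ g · pred l ≐ O̲) ∧ ((g · l ≐ O̲ ⊃ ⊥′) ∨ l ≐ n)
      where l = least ⟪ ∅ ▸ g ▸ n ⟫

    least-spec : ∀ n → H ⊩ Least n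
    least-spec = ind
      ((l ≐ O ∨ var v2 · (var v3 · l) ≐ O) ∧ ((var v2 · l ≐ O ⊃ ⊥′) ∨ l ≐ var v0))
      (∅ ▸ predecessor ▸ g ▸ lam (lam leastᵇ) ⟪ ∅ ▸ g ▸ O̲ ⟫)
      (inl (num rec-O̲) & inr (num rec-O̲))
      λ n h → split (g · (least ⟪ ∅ ▸ g ▸ n ⟫))
        (λ z → cases (↑ snd h)
          (λ r → absurd (r $ num (↑≃ z)))
          (λ r → inr (num (ext-app (pred-cong (next n ⨾ ifz-O̲ (↑≃ z)) ⨾ pred-S̲ ⨾ ≃sym (eq r)) ⨾ ↑≃ z)) &
                 inr (num (next n ⨾ ifz-O̲ (↑≃ z)))))
        (λ z → cases (↑ fst h)
                 (λ r → inl (num (next n ⨾ ifz-S̲ (↑≃ z) ⨾ eq r)))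
                 (λ r → inr (num (ext-app (pred-cong (next n ⨾ ifz-S̲ (↑≃ z))) ⨾ eq r)))
             & inl (S̲⇒≢O̲ (ext-app (next n ⨾ ifz-S̲ z) ⨾ z)))
      where
        l : Tm (𝟎 ∷ (𝟎 ⇒ 𝟎 ⇒ 𝟎) ∷ 𝟏 ∷ 𝟏 ∷ []) 𝟎
        l = rec (var v0) O (var v1)

        next : ∀ n → H ⊩ least ⟪ ∅ ▸ g ▸ S̲ n ⟫ ≃
                         ifzᵗ (g · least ⟪ ∅ ▸ g ▸ n ⟫) (S̲ n) (least ⟪ ∅ ▸ g ▸ n ⟫)
        next n = rec-lam leastᵇ {∅ ▸ g ▸ n}

-- The standard part g of the characteristic function of { k : i ≤ k } agrees with
-- it at the standard numbers, so that i is the least m ≤ n with g m ≠ 0.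
st-≼ : H ⊩ st n → H ⊩ i ≼ n → H ⊩ st i
st-≼ {n = n} {i = i} sn i≼n = exE (standardPart above-binary) λ g h →
  let sg   = fst h
      same = λ {k} (sk : _ ⊩ st k) → eq (snd (snd h) $∀ k $ sk)
      l    = least ⟪ ∅ ▸ g ▸ n ⟫
      sl   = st-⟪⟫ (∅ ▸ sg ▸ ↑ sn) least
      nonzero : _ ⊩ g · l ≐ O̲ ⊃ ⊥′
      nonzero = cases (snd (least-spec {g = g} n)) id λ p → S̲⇒≢O̲
        (ext-app (eq p) ⨾ ↑≃ ≃sym (same (↑ sn)) ⨾ ↑≃ above-≽ (↑ i≼n))
      i≼l : _ ⊩ i ≼ l
      i≼l = cases (≼-or-≻ i l) id λ p → absurd (↑ nonzero $ num (↑≃ ≃sym (same sl) ⨾ above-≺ p))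
  in split l
    (λ p → st-≃ (≃sym (≼-antisym (≼-≃ ≃refl p (↑ i≼l)) O̲≼)) st-con)
    (λ p → cases (↑ fst (least-spec {g = g} n))
      (λ q → O̲≢S̲ (eq q) (↑≃ p))
      -- `pred l` is standard too, so `i ≤ pred l` would make `g` nonzero there. Hence
      -- `pred l < i ≤ l`, and `i` equals the standard number `l`.
      (λ q → cases (≼-or-≻ i (pred l))
        (λ r → S̲≢O̲ (≃sym (above-≽ r) ⨾ ↑≃ ↑≃ ↑≃ same (st-· st-predecessor sl) ⨾ ↑≃ eq q))
        (λ r → st-≃ (≼-antisym (≼-≃ (↑≃ ↑≃ ≃sym p) ≃refl r) (↑³ i≼l)) (↑³ sl))))

QF-ren : {r : Γ ⊆ Θ} (φ : Fm Γ) → QF φ → QF (ren r φ)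
QF-ren (s ≐ t) q       = q
QF-ren ⊥′ q            = q
QF-ren (φ ∧ ψ) (p , q) = QF-ren φ p , QF-ren ψ q
QF-ren (φ ∨ ψ) (p , q) = QF-ren φ p , QF-ren ψ q
QF-ren (φ ⊃ ψ) (p , q) = QF-ren φ p , QF-ren ψ q

module _ (φ : Fm (𝟎 ∷ Θ)) (e : Env Θ) {q : QF φ} where

  -- Ordinary induction on `k ≤ n ⊃ φ(k)`: the guard by the standard `n` makes every `k` that occurs
  -- standard, so a step for standard `k` suffices. The parameters in `e` may be nonstandard.
  st-ind : H ⊩ φ ⟨ e ▸ O̲ ⟩ →
           (∀ k → st k ∷ φ ⟨ e ▸ k ⟩ ∷ H ⊩ st k → st k ∷ φ ⟨ e ▸ k ⟩ ∷ H ⊩ φ ⟨ e ▸ k ⟩ →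
                  st k ∷ φ ⟨ e ▸ k ⟩ ∷ H ⊩ φ ⟨ e ▸ S̲ k ⟩) →
           H ⊩ st n → H ⊩ φ ⟨ e ▸ n ⟩
  st-ind {n = n} start next sn = conv (φ′~φ n) (ind
    (var v1 · var v0 · var v2 ≐ O ⊃ φ′) (e ▸ n ▸ monus) {tt , QF-ren φ q}
    (lam⊃ λ _ → conv (~sym (φ′~φ O̲)) (↑ start))
    (λ k h → lam⊃ λ p → conv (~sym (φ′~φ (S̲ k)))
      (↑² (lam⊃ λ h′ → lam⊃ λ sk → next k sk (↑ h′))
       $ conv (φ′~φ k) (↑ h $ ≺⇒≼ p) $ st-≼ (↑² sn) (≺⇒≼ p)))
    n $ ≼-refl)
    where
      φ′ : Fm (𝟎 ∷ (𝟎 ⇒ 𝟎 ⇒ 𝟎) ∷ 𝟎 ∷ Θ)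
      φ′ = ren (∷⁺ʳ 𝟎 (λ x → there (there x))) φ

      φ′~φ : ∀ k → φ′ ⟨ e ▸ n ▸ monus ▸ k ⟩ ~ φ ⟨ e ▸ k ⟩
      φ′~φ k = ren-⟨⟩ (λ { v0 → refl ; (there y) → refl }) φ

-- Arithmetical formulas as terms

Arithmetical : Fm Γ → Set
Arithmetical (s ≐ t)         = ⊤
Arithmetical (st t)          = ⊥
Arithmetical ⊥′              = ⊤
Arithmetical (φ ∧ ψ)         = Arithmetical φ × Arithmetical ψ
Arithmetical (φ ∨ ψ)         = Arithmetical φ × Arithmetical ψ
Arithmetical (φ ⊃ ψ)         = Arithmetical φ × Arithmetical ψ
Arithmetical (∀[ 𝟎 ] φ)      = Arithmetical φ
Arithmetical (∀[ _ ⇒ _ ] φ)  = ⊥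
Arithmetical (∀[ _ * ] φ)    = ⊥
Arithmetical (∃[ 𝟎 ] φ)      = Arithmetical φ
Arithmetical (∃[ _ ⇒ _ ] φ)  = ⊥
Arithmetical (∃[ _ * ] φ)    = ⊥
Arithmetical (∀<[ t ] φ)     = Arithmetical φ
Arithmetical (∃<[ t ] φ)     = Arithmetical φ

-- The variables reserved in every context for the operations: v0 is the search functional, v1 is
-- `monus`, v2 is `times` and v3 is `plus`.
Ops : Ctx
Ops = (𝟏 ⇒ 𝟎) ∷ (𝟎 ⇒ 𝟎 ⇒ 𝟎) ∷ (𝟎 ⇒ 𝟎 ⇒ 𝟎) ∷ (𝟎 ⇒ 𝟎 ⇒ 𝟎) ∷ []

ops : Term (𝟏 ⇒ 𝟎) → Env Ops
ops μ = ∅ ▸ plus ▸ times ▸ monus ▸ μ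

record _⊩μ_ (H : List Form) (μ : Term (𝟏 ⇒ 𝟎)) : Set where
  constructor mk
  field
    standard : H ⊩ st μ
    searches : H ⊩ Search ⟨ ∅ ▸ μ ⟩

open _⊩μ_

infix 1 _⊩μ_
infix 20 ↑ᵐ_

↑ᵐ_ : ∀ {μ} → H ⊩μ μ → A ∷ H ⊩μ μ
↑ᵐ mk p q = mk (↑ p) (↑ q)

st-ops : ∀ {μ} → H ⊩μ μ → H ⊩st ops μ
st-ops M = ∅ ▸ st-plus ▸ st-times ▸ st-monus ▸ standard M

-- Equivalences and truth values

infix 1 _⊩_↔_

_⊩_↔_ : List Form → Form → Form → Set
H ⊩ A ↔ B = H ⊩ (A ⊃ B) ∧ (B ⊃ A)

↔refl : H ⊩ A ↔ A
↔refl = lam⊃ id & lam⊃ id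

↔sym : H ⊩ A ↔ B → H ⊩ B ↔ A
↔sym p = snd p & fst p

infixr 4 _⨾↔_

_⨾↔_ : H ⊩ A ↔ B → H ⊩ B ↔ C → H ⊩ A ↔ C
p ⨾↔ q = lam⊃ (λ a → ↑ fst q $ (↑ fst p $ a)) & lam⊃ (λ c → ↑ snd p $ (↑ snd q $ c))

≃⇒↔ : H ⊩ s ≃ t → H ⊩ s ≐ O̲ ↔ t ≐ O̲
≃⇒↔ p = lam⊃ (λ a → num (↑≃ ≃sym p ⨾ eq a)) & lam⊃ (λ a → num (↑≃ p ⨾ eq a))

1̲ : Term 𝟎
1̲ = S̲ O̲

↔-nonzero : H ⊩ a ≐ O̲ ↔ A → H ⊩ a ≃ S̲ n → H ⊩ A → H ⊩ B
↔-nonzero p q h = O̲≢S̲ (eq (snd p $ h)) q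

ifz-∧ : H ⊩ a ≐ O̲ ↔ A → H ⊩ b ≐ O̲ ↔ B → H ⊩ ifzᵗ a b 1̲ ≐ O̲ ↔ A ∧ B
ifz-∧ {a = a} p q = split a
  (λ z → (lam⊃ λ h → ↑² fst p $ ↑ num z & ↑² fst q $ num (≃sym (ifz-O̲ (↑≃ z)) ⨾ eq h)) &
         (lam⊃ λ h → num (ifz-O̲ (↑≃ z) ⨾ eq (↑² snd q $ snd h))))
  (λ z → (lam⊃ λ h → S̲≢O̲ (≃sym (ifz-S̲ (↑≃ z)) ⨾ eq h)) &
         (lam⊃ λ h → ↔-nonzero (↑² p) (↑≃ z) (fst h)))

ifz-∨ : H ⊩ a ≐ O̲ ↔ A → H ⊩ b ≐ O̲ ↔ B → H ⊩ ifzᵗ a O̲ b ≐ O̲ ↔ A ∨ B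
ifz-∨ {a = a} p q = split a
  (λ z → (lam⊃ λ _ → inl (↑² fst p $ ↑ num z)) & (lam⊃ λ _ → num (ifz-O̲ (↑≃ z))))
  (λ z → (lam⊃ λ h → inr (↑² fst q $ num (≃sym (ifz-S̲ (↑≃ z)) ⨾ eq h))) &
         (lam⊃ λ h → cases h
           (λ r → ↔-nonzero (↑³ p) (↑≃ ↑≃ z) r)
           (λ r → num (ifz-S̲ (↑≃ ↑≃ z) ⨾ eq (↑³ snd q $ r)))))

ifz-⊃ : H ⊩ a ≐ O̲ ↔ A → H ⊩ b ≐ O̲ ↔ B → H ⊩ ifzᵗ a b O̲ ≐ O̲ ↔ A ⊃ B
ifz-⊃ {a = a} p q = split a
  (λ z → (lam⊃ λ h → lam⊃ λ _ → ↑³ fst q $ num (≃sym (ifz-O̲ (↑≃ ↑≃ z)) ⨾ ↑≃ eq h)) &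
         (lam⊃ λ h → num (ifz-O̲ (↑≃ z) ⨾ eq (↑² snd q $ (h $ (↑² fst p $ ↑ num z))))))
  (λ z → (lam⊃ λ h → lam⊃ λ r → ↔-nonzero (↑³ p) (↑≃ ↑≃ z) r) &
         (lam⊃ λ _ → num (ifz-S̲ (↑≃ z))))

ifz-¬ : H ⊩ a ≐ O̲ ↔ A → H ⊩ ifzᵗ a 1̲ O̲ ≐ O̲ ↔ A ⊃ ⊥′
ifz-¬ p = ifz-⊃ p (lam⊃ (λ h → S̲≢O̲ (eq h)) & lam⊃ absurd)

-- From left to right `μ · f` itself is the standard zero; the converse is the search property.
∃-↔ : {μ m : Term (𝟏 ⇒ 𝟎)} {f : Term 𝟏} → m ≡ μ → H ⊩μ μ → H ⊩ st f →
      H ⊩ f · (m · f) ≐ O̲ ↔ Zero f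
∃-↔ {μ = μ} {f = f} refl M sf =
  (lam⊃ λ h → exI (μ · f) (↑ st-· (standard M) sf & h)) &
  (lam⊃ λ h → exE h λ n g → ↑² searches M $∀ f $ ↑² sf $∀ n $ snd g)

module _ {φ : Fm (𝟎 ∷ Θ)} {e : Env Θ} {f : Term 𝟏} where

  Zero-∃ : (∀ n → st n ∷ H ⊩ st n → st n ∷ H ⊩ f · n ≐ O̲ ↔ φ ⟨ e ▸ n ⟩) →
           H ⊩ Zero f ↔ (∃ˢᵗ[ 𝟎 ] φ) ⟨ e ⟩
  Zero-∃ p =
    (lam⊃ λ h → exE h λ n g → exI n (fst g & (↑² (lam⊃ λ sn → fst (p n sn)) $ fst g $ snd g))) &
    (lam⊃ λ h → exE h λ n g → exI n (fst g & (↑² (lam⊃ λ sn → snd (p n sn)) $ fst g $ snd g)))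

  Zero-∀ : (∀ n → st n ∷ H ⊩ st n → st n ∷ H ⊩ f · n ≐ O̲ ↔ φ ⟨ e ▸ n ⟩ ⊃ ⊥′) →
           H ⊩ Zero f ⊃ ⊥′ ↔ (∀ˢᵗ[ 𝟎 ] φ) ⟨ e ⟩
  Zero-∀ p =
    (lam⊃ λ h → allI λ n → lam⊃ λ sn → contra λ k →
      ↑² h $ exI n (↑ sn & (↑³ (lam⊃ λ sn → snd (p n sn)) $ ↑ sn $ k))) &
    (lam⊃ λ h → lam⊃ λ z → exE z λ n g →
      (↑³ (lam⊃ λ sn → fst (p n sn)) $ fst g $ snd g) $ (↑² h $∀ n $ fst g))

  -- Bounded quantifiers are not relativised, so their witness comes without `st`. It is standard
  -- because it lies below the standard number `t`.
  Zero-∃< : H ⊩ st t → (∀ n → st n ∷ H ⊩ st n → st n ∷ H ⊩ f · n ≐ O̲ ↔ n ≺ t ∧ φ ⟨ e ▸ n ⟩) →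
            H ⊩ Zero f ↔ ex< t φ e
  Zero-∃< st-t p =
    (lam⊃ λ h → exE h λ n g →
      (lam⊃ λ k → ex<I n (fst k) (snd k)) $ (↑² (lam⊃ λ sn → fst (p n sn)) $ fst g $ snd g)) &
    (lam⊃ λ h → ex<E h λ n l g →
      (lam⊃ λ sn → exI n (sn & (↑⁴ (lam⊃ λ sn → snd (p n sn)) $ sn $ ↑ (l & g))))
      $ st-≼ (↑³ st-t) (≺⇒≼ l))

  Zero-∀< : H ⊩ st t → (∀ n → st n ∷ H ⊩ st n → st n ∷ H ⊩ f · n ≐ O̲ ↔ n ≺ t ∧ (φ ⟨ e ▸ n ⟩ ⊃ ⊥′)) →
            H ⊩ Zero f ⊃ ⊥′ ↔ all< t φ e
  Zero-∀< st-t p =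
    (lam⊃ λ h → all<I λ n l → contra λ k →
      (lam⊃ λ sn → ↑³ h $ exI n (sn & (↑⁴ (lam⊃ λ sn → snd (p n sn)) $ sn $ ↑ (↑ l & k))))
      $ st-≼ (↑³ st-t) (≺⇒≼ (↑ l))) &
    (lam⊃ λ h → lam⊃ λ z → exE z λ n g →
      (lam⊃ λ k → snd k $ all<E (↑³ h) n (fst k)) $ (↑³ (lam⊃ λ sn → fst (p n sn)) $ fst g $ snd g))

-- Zero stands for truth, because the search functional looks for zeros. A universal quantifier is
-- evaluated as a failed search for a counterexample. For standard parameters the value decides the
-- relativised formula.
T : Ops ⊆ Γ → (φ : Fm Γ) → Arithmetical φ → Tm Γ 𝟎
T o (s ≐ t) p         = ifz (var (o v1) · s · t) (var (o v1) · t · s) (suc′ O)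
T o ⊥′ p              = suc′ O
T o (φ ∧ ψ) (p , q)   = ifz (T o φ p) (T o ψ q) (suc′ O)
T o (φ ∨ ψ) (p , q)   = ifz (T o φ p) O (T o ψ q)
T o (φ ⊃ ψ) (p , q)   = ifz (T o φ p) (T o ψ q) O
T o (∀[ 𝟎 ] φ) p      = ifz (f · (var (o v0) · f)) (suc′ O) O
  where f = lam (ifz (T (λ x → there (o x)) φ p) (suc′ O) O)
T o (∃[ 𝟎 ] φ) p      = f · (var (o v0) · f)
  where f = lam (T (λ x → there (o x)) φ p)
T o (∀<[ t ] φ) p     = ifz (f · (var (o v0) · f)) (suc′ O) O
  where f = lam (ifz (var (there (o v1)) · suc′ (var v0) · wk t)
                     (ifz (T (λ x → there (o x)) φ p) (suc′ O) O) (suc′ O))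
T o (∃<[ t ] φ) p     = f · (var (o v0) · f)
  where f = lam (ifz (var (there (o v1)) · suc′ (var v0) · wk t)
                     (T (λ x → there (o x)) φ p) (suc′ O))

⟪⟫-wk : {e : Env Θ} {u : Term τ} (t : Tm Θ σ) → wk t ⟪ e ▸ u ⟫ ≡ t ⟪ e ⟫
⟪⟫-wk (var x) = refl
⟪⟫-wk (con c) = refl
⟪⟫-wk (f · t) = cong₂ _·_ (⟪⟫-wk f) (⟪⟫-wk t)

less : ∀ {m t′} → m ≡ monus → t′ ≡ t → H ⊩ m · S̲ n · t′ ≐ O̲ ↔ n ≺ t
less refl refl = ↔refl

module _ {μ : Term (𝟏 ⇒ 𝟎)} where

  Interprets : Env Γ → Ops ⊆ Γ → Set
  Interprets e o = ∀ {σ} (x : σ ∈ Ops) → lookup e (o x) ≡ lookup (ops μ) x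

  T-spec : {e : Env Γ} (o : Ops ⊆ Γ) → Interprets e o → (φ : Fm Γ) (p : Arithmetical φ) →
           H ⊩μ μ → H ⊩st e → H ⊩ T o φ p ⟪ e ⟫ ≐ O̲ ↔ (φ ^st) ⟨ e ⟩
  T-spec {e = e} o i (s ≐ t) p M E = ifz-∧ (≡⇒↔ (i v1)) (≡⇒↔ (i v1)) ⨾↔
    (lam⊃ (λ h → num (≼-antisym (fst h) (snd h))) &
     lam⊃ (λ h → ≼-reflexive (eq h) & ≼-reflexive (≃sym (eq h))))
    where
      ≡⇒↔ : ∀ {m s t} → m ≡ monus → H ⊩ m · s · t ≐ O̲ ↔ s ≼ t
      ≡⇒↔ refl = ↔refl
  T-spec o i ⊥′ p M E            = lam⊃ (λ h → S̲≢O̲ (eq h)) & lam⊃ absurd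
  T-spec o i (φ ∧ ψ) (p , q) M E = ifz-∧ (T-spec o i φ p M E) (T-spec o i ψ q M E)
  T-spec o i (φ ∨ ψ) (p , q) M E = ifz-∨ (T-spec o i φ p M E) (T-spec o i ψ q M E)
  T-spec o i (φ ⊃ ψ) (p , q) M E = ifz-⊃ (T-spec o i φ p M E) (T-spec o i ψ q M E)
  T-spec o i (∀[ 𝟎 ] φ) p M E    =
    ifz-¬ (∃-↔ (i v0) M (st-⟪⟫ E (lam body))) ⨾↔ Zero-∀ λ n sn →
      ≃⇒↔ (β body) ⨾↔ ifz-¬ (T-spec (λ x → there (o x)) i φ p (↑ᵐ M) (↑ˢ E ▸ sn))
    where body = ifz (T (λ x → there (o x)) φ p) (suc′ O) O
  T-spec o i (∃[ 𝟎 ] φ) p M E    =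
    ∃-↔ (i v0) M (st-⟪⟫ E (lam body)) ⨾↔ Zero-∃ λ n sn →
      ≃⇒↔ (β body) ⨾↔ T-spec (λ x → there (o x)) i φ p (↑ᵐ M) (↑ˢ E ▸ sn)
    where body = T (λ x → there (o x)) φ p
  T-spec o i (∀<[ s ] φ) p M E   =
    ifz-¬ (∃-↔ (i v0) M (st-⟪⟫ E (lam body))) ⨾↔ Zero-∀< (st-⟪⟫ E s) λ n sn →
      ≃⇒↔ (β body) ⨾↔ ifz-∧ (less (i v1) (⟪⟫-wk s))
        (ifz-¬ (T-spec (λ x → there (o x)) i φ p (↑ᵐ M) (↑ˢ E ▸ sn)))
    where
      body = ifz (var (there (o v1)) · suc′ (var v0) · wk s)
                 (ifz (T (λ x → there (o x)) φ p) (suc′ O) O) (suc′ O)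
  T-spec o i (∃<[ s ] φ) p M E   =
    ∃-↔ (i v0) M (st-⟪⟫ E (lam body)) ⨾↔ Zero-∃< (st-⟪⟫ E s) λ n sn →
      ≃⇒↔ (β body) ⨾↔ ifz-∧ (less (i v1) (⟪⟫-wk s))
        (T-spec (λ x → there (o x)) i φ p (↑ᵐ M) (↑ˢ E ▸ sn))
    where
      body = ifz (var (there (o v1)) · suc′ (var v0) · wk s)
                 (T (λ x → there (o x)) φ p) (suc′ O)

-- Second-order arithmetic over the variables for the operations

⟦_⟧ᶜ : L₂.Ctx → Ctx
⟦ [] ⟧ᶜ    = Ops
⟦ s ∷ Ξ ⟧ᶜ = ⟦ s ⟧ ∷ ⟦ Ξ ⟧ᶜ

op : ∀ Ξ → Ops ⊆ ⟦ Ξ ⟧ᶜ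
op [] x      = x
op (s ∷ Ξ) x = there (op Ξ x)

private variable
  Ξ Ξ′ : L₂.Ctx
  ς : L₂.Sort

⟦_⟧ᵛ : ς ∈ Ξ → ⟦ ς ⟧ ∈ ⟦ Ξ ⟧ᶜ
⟦ v0 ⟧ᵛ      = v0
⟦ there x ⟧ᵛ = there ⟦ x ⟧ᵛ

trTm : L₂.Tm Ξ → Tm ⟦ Ξ ⟧ᶜ 𝟎
trTm (L₂.var x)       = var ⟦ x ⟧ᵛ
trTm L₂.𝟘             = O
trTm L₂.𝟙             = suc′ O
trTm {Ξ} (s L₂.+ t)   = var (op Ξ v3) · trTm s · trTm t
trTm {Ξ} (s L₂.* t)   = var (op Ξ v2) · trTm s · trTm t

binaryᵒ : ∀ Ξ → Fm (𝟏 ∷ ⟦ Ξ ⟧ᶜ)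
binaryᵒ Ξ = ∀[ 𝟎 ] var (there (there (op Ξ v1))) · (var v1 · var v0) · suc′ O ≐ O

-- The translation `⌜_⌝` with variables in place of the closed terms for +, * and ∸, so that those
-- terms are never unfolded in derivations. On closed formulas `tr-closed` identifies the
-- relativisations of the two.
tr : L₂.Fm Ξ → Fm ⟦ Ξ ⟧ᶜ
tr (s L₂.≐ t)          = trTm s ≐ trTm t
tr {Ξ} (s L₂.< t)      = var (op Ξ v1) · suc′ (trTm s) · trTm t ≐ O
tr (t L₂.ε X)          = var ⟦ X ⟧ᵛ · trTm t ≐ suc′ O
tr L₂.⊥′               = ⊥′
tr (φ L₂.∧ ψ)          = tr φ ∧ tr ψ
tr (φ L₂.∨ ψ)          = tr φ ∨ tr ψ
tr (φ L₂.⊃ ψ)          = tr φ ⊃ tr ψ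
tr (L₂.∀ⁿ φ)           = ∀[ 𝟎 ] tr φ
tr (L₂.∃ⁿ φ)           = ∃[ 𝟎 ] tr φ
tr (L₂.∀<[ t ] φ)      = ∀<[ trTm t ] tr φ
tr (L₂.∃<[ t ] φ)      = ∃<[ trTm t ] tr φ
tr {Ξ} (L₂.∀ˢ φ)       = ∀[ 𝟏 ] binaryᵒ Ξ ⊃ tr φ
tr {Ξ} (L₂.∃ˢ φ)       = ∃[ 𝟏 ] binaryᵒ Ξ ∧ tr φ

opaque
  unfolding plus

  opPlus opTimes opMonus : Tm Γ (𝟎 ⇒ 𝟎 ⇒ 𝟎)
  opPlus  = plusᶜ
  opTimes = timesᶜ
  opMonus = monusᶜ

  sub-plusᶜ : (s : Sub Γ Θ) → subTm s plusᶜ ≡ opPlus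
  sub-plusᶜ s = refl

  sub-timesᶜ : (s : Sub Γ Θ) → subTm s timesᶜ ≡ opTimes
  sub-timesᶜ s = refl

  sub-monusᶜ : (s : Sub Γ Θ) → subTm s monusᶜ ≡ opMonus
  sub-monusᶜ s = refl

  wk-opPlus : wk {Γ} {τ = τ} opPlus ≡ opPlus
  wk-opPlus = refl

  wk-opTimes : wk {Γ} {τ = τ} opTimes ≡ opTimes
  wk-opTimes = refl

  wk-opMonus : wk {Γ} {τ = τ} opMonus ≡ opMonus
  wk-opMonus = refl

  real-plus : (η : Names Γ) → realᵗ η plus ≡ opPlus
  real-plus η = refl

  real-times : (η : Names Γ) → realᵗ η times ≡ opTimes
  real-times η = refl

  real-monus : (η : Names Γ) → realᵗ η monus ≡ opMonus
  real-monus η = refl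

record Matches (Ξ : L₂.Ctx) (s : Sub (map ⟦_⟧ Ξ) Θ) (s′ : Sub ⟦ Ξ ⟧ᶜ Θ) : Set where
  constructor mk
  field
    on-var   : ∀ {ς} (x : ς ∈ Ξ) → s (∈-map⁺ ⟦_⟧ x) ≡ s′ ⟦ x ⟧ᵛ
    on-plus  : s′ (op Ξ v3) ≡ opPlus
    on-times : s′ (op Ξ v2) ≡ opTimes
    on-monus : s′ (op Ξ v1) ≡ opMonus

open Matches

lift-Matches : {s : Sub (map ⟦_⟧ Ξ) Θ} {s′ : Sub ⟦ Ξ ⟧ᶜ Θ} → Matches Ξ s s′ → Matches (ς ∷ Ξ) (lift s) (lift s′)
lift-Matches m = mk
  (λ { v0 → refl ; (there x) → cong wk (on-var m x) })
  (trans (cong wk (on-plus m)) wk-opPlus)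
  (trans (cong wk (on-times m)) wk-opTimes)
  (trans (cong wk (on-monus m)) wk-opMonus)

sub-op : ∀ (σ : Sub Γ Θ) (c : Tm Γ (𝟎 ⇒ 𝟎 ⇒ 𝟎)) s t {c′ f a b} →
         subTm σ c ≡ c′ → f ≡ c′ → subTm σ s ≡ a → subTm σ t ≡ b →
         subTm σ (c · s · t) ≡ f · a · b
sub-op σ c s t refl refl refl refl = refl

sub-op-≐ : ∀ (σ : Sub Γ Θ) (c : Tm Γ (𝟎 ⇒ 𝟎 ⇒ 𝟎)) s t {c′ f a b} →
         subTm σ c ≡ c′ → f ≡ c′ → subTm σ s ≡ a → subTm σ t ≡ b →
           sub σ (c · s · t ≐ O) ≡ (f · a · b ≐ O)
sub-op-≐ σ c s t refl refl refl refl = refl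

sub-trTm : {s : Sub (map ⟦_⟧ Ξ) Θ} {s′ : Sub ⟦ Ξ ⟧ᶜ Θ} → Matches Ξ s s′ →
           (t : L₂.Tm Ξ) → subTm s ⌜ t ⌝ᵗ ≡ subTm s′ (trTm t)
sub-trTm m (L₂.var x)       = on-var m x
sub-trTm m L₂.𝟘             = refl
sub-trTm m L₂.𝟙             = refl
sub-trTm {s = σ} m (s L₂.+ t) =
  sub-op σ plusᶜ ⌜ s ⌝ᵗ ⌜ t ⌝ᵗ (sub-plusᶜ σ) (on-plus m) (sub-trTm m s) (sub-trTm m t)
sub-trTm {s = σ} m (s L₂.* t) =
  sub-op σ timesᶜ ⌜ s ⌝ᵗ ⌜ t ⌝ᵗ (sub-timesᶜ σ) (on-times m) (sub-trTm m s) (sub-trTm m t)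

sub-binary : {s : Sub (map ⟦_⟧ Ξ) Θ} {s′ : Sub ⟦ Ξ ⟧ᶜ Θ} → Matches Ξ s s′ →
             sub (lift s) ((var v0 ≤₁1) ^st) ≡ sub (lift s′) (binaryᵒ Ξ ^st)
sub-binary {Ξ} {s = s} m = cong (λ f → ∀ˢᵗ[ 𝟎 ] f · (var v1 · var v0) · suc′ O ≐ O)
  (trans (sub-monusᶜ (lift (lift s))) (sym (on-monus (lift-Matches {ς = L₂.num} (lift-Matches {ς = L₂.set} m)))))

sub-tr : {s : Sub (map ⟦_⟧ Ξ) Θ} {s′ : Sub ⟦ Ξ ⟧ᶜ Θ} → Matches Ξ s s′ →
         (φ : L₂.Fm Ξ) → sub s (⌜ φ ⌝ ^st) ≡ sub s′ (tr φ ^st)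
sub-tr m (s L₂.≐ t)          = cong₂ _≐_ (sub-trTm m s) (sub-trTm m t)
sub-tr {s = σ} m (s L₂.< t)  =
  sub-op-≐ σ monusᶜ (suc′ ⌜ s ⌝ᵗ) ⌜ t ⌝ᵗ (sub-monusᶜ σ) (on-monus m) (cong suc′ (sub-trTm m s)) (sub-trTm m t)
sub-tr m (t L₂.ε X)          = cong (_≐ suc′ O) (cong₂ _·_ (on-var m X) (sub-trTm m t))
sub-tr m L₂.⊥′               = refl
sub-tr m (φ L₂.∧ ψ)          = cong₂ _∧_ (sub-tr m φ) (sub-tr m ψ)
sub-tr m (φ L₂.∨ ψ)          = cong₂ _∨_ (sub-tr m φ) (sub-tr m ψ)
sub-tr m (φ L₂.⊃ ψ)          = cong₂ _⊃_ (sub-tr m φ) (sub-tr m ψ)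
sub-tr m (L₂.∀ⁿ φ)           = cong (∀ˢᵗ[ 𝟎 ]_) (sub-tr (lift-Matches m) φ)
sub-tr m (L₂.∃ⁿ φ)           = cong (∃ˢᵗ[ 𝟎 ]_) (sub-tr (lift-Matches m) φ)
sub-tr m (L₂.∀<[ t ] φ)      = cong₂ ∀<[_]_ (sub-trTm m t) (sub-tr (lift-Matches m) φ)
sub-tr m (L₂.∃<[ t ] φ)      = cong₂ ∃<[_]_ (sub-trTm m t) (sub-tr (lift-Matches m) φ)
sub-tr m (L₂.∀ˢ φ)           =
  cong₂ (λ A B → ∀ˢᵗ[ 𝟏 ] A ⊃ B) (sub-binary m) (sub-tr (lift-Matches m) φ)
sub-tr m (L₂.∃ˢ φ)           =
  cong₂ (λ A B → ∃ˢᵗ[ 𝟏 ] A ∧ B) (sub-binary m) (sub-tr (lift-Matches m) φ)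

record Renames {Ξ Ξ′} (ρ : Ξ ⊆ Ξ′) (s : Sub ⟦ Ξ ⟧ᶜ Θ) (s′ : Sub ⟦ Ξ′ ⟧ᶜ Θ) : Set where
  constructor mk
  field
    on-var : ∀ {ς} (x : ς ∈ Ξ) → s′ ⟦ ρ x ⟧ᵛ ≡ s ⟦ x ⟧ᵛ
    on-op  : ∀ {σ} (x : σ ∈ Ops) → s′ (op Ξ′ x) ≡ s (op Ξ x)

open Renames

module _ {Ξ Ξ′ : L₂.Ctx} {ρ : Ξ ⊆ Ξ′} {s : Sub ⟦ Ξ ⟧ᶜ Θ} {s′ : Sub ⟦ Ξ′ ⟧ᶜ Θ} where

  lift-Renames : Renames ρ s s′ → Renames (∷⁺ʳ ς ρ) (lift s) (lift s′)
  lift-Renames m = mk (λ { v0 → refl ; (there x) → cong wk (on-var m x) }) (λ x → cong wk (on-op m x))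

  trTm-ren : Renames ρ s s′ → (t : L₂.Tm Ξ) → subTm s′ (trTm (L₂.renTm ρ t)) ≡ subTm s (trTm t)
  trTm-ren m (L₂.var x)   = on-var m x
  trTm-ren m L₂.𝟘         = refl
  trTm-ren m L₂.𝟙         = refl
  trTm-ren m (t L₂.+ u)   = cong₂ _·_ (cong₂ _·_ (on-op m v3) (trTm-ren m t)) (trTm-ren m u)
  trTm-ren m (t L₂.* u)   = cong₂ _·_ (cong₂ _·_ (on-op m v2) (trTm-ren m t)) (trTm-ren m u)

tr-ren : {ρ : Ξ ⊆ Ξ′} {s : Sub ⟦ Ξ ⟧ᶜ Θ} {s′ : Sub ⟦ Ξ′ ⟧ᶜ Θ} → Renames ρ s s′ →
         (φ : L₂.Fm Ξ) → sub s′ (tr (L₂.ren ρ φ) ^st) ≡ sub s (tr φ ^st)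
tr-ren m (t L₂.≐ u)          = cong₂ _≐_ (trTm-ren m t) (trTm-ren m u)
tr-ren m (t L₂.< u)          = cong (_≐ O)
  (cong₂ _·_ (cong₂ _·_ (on-op m v1) (cong suc′ (trTm-ren m t))) (trTm-ren m u))
tr-ren m (t L₂.ε X)          = cong (_≐ suc′ O) (cong₂ _·_ (on-var m X) (trTm-ren m t))
tr-ren m L₂.⊥′               = refl
tr-ren m (φ L₂.∧ ψ)          = cong₂ _∧_ (tr-ren m φ) (tr-ren m ψ)
tr-ren m (φ L₂.∨ ψ)          = cong₂ _∨_ (tr-ren m φ) (tr-ren m ψ)
tr-ren m (φ L₂.⊃ ψ)          = cong₂ _⊃_ (tr-ren m φ) (tr-ren m ψ)
tr-ren m (L₂.∀ⁿ φ)           = cong (∀ˢᵗ[ 𝟎 ]_) (tr-ren (lift-Renames m) φ)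
tr-ren m (L₂.∃ⁿ φ)           = cong (∃ˢᵗ[ 𝟎 ]_) (tr-ren (lift-Renames m) φ)
tr-ren m (L₂.∀<[ t ] φ)      = cong₂ ∀<[_]_ (trTm-ren m t) (tr-ren (lift-Renames m) φ)
tr-ren m (L₂.∃<[ t ] φ)      = cong₂ ∃<[_]_ (trTm-ren m t) (tr-ren (lift-Renames m) φ)
tr-ren m (L₂.∀ˢ φ)           = cong₂ (λ f B → ∀ˢᵗ[ 𝟏 ] (∀ˢᵗ[ 𝟎 ] wk (wk f) · (var v1 · var v0) · suc′ O ≐ O) ⊃ B)
  (on-op m v1) (tr-ren (lift-Renames m) φ)
tr-ren m (L₂.∃ˢ φ)           = cong₂ (λ f B → ∃ˢᵗ[ 𝟏 ] (∀ˢᵗ[ 𝟎 ] wk (wk f) · (var v1 · var v0) · suc′ O ≐ O) ∧ B)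
  (on-op m v1) (tr-ren (lift-Renames m) φ)

sub-var : (φ : Fm Γ) {s : Sub Γ Γ} → (∀ {σ} (x : σ ∈ Γ) → s x ≡ var x) → sub s φ ≡ φ
sub-var (s ≐ t) e     = cong₂ _≐_ (trans (subTm-cong e s) (subTm-var s)) (trans (subTm-cong e t) (subTm-var t))
sub-var (st t) e      = cong st (trans (subTm-cong e t) (subTm-var t))
sub-var ⊥′ e          = refl
sub-var (φ ∧ ψ) e     = cong₂ _∧_ (sub-var φ e) (sub-var ψ e)
sub-var (φ ∨ ψ) e     = cong₂ _∨_ (sub-var φ e) (sub-var ψ e)
sub-var (φ ⊃ ψ) e     = cong₂ _⊃_ (sub-var φ e) (sub-var ψ e)
sub-var (∀[ σ ] φ) e  = cong (∀[ σ ]_) (sub-var φ λ { v0 → refl ; (there x) → cong wk (e x) })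
sub-var (∃[ σ ] φ) e  = cong (∃[ σ ]_) (sub-var φ λ { v0 → refl ; (there x) → cong wk (e x) })
sub-var (∀<[ t ] φ) e = cong₂ ∀<[_]_ (trans (subTm-cong e t) (subTm-var t))
  (sub-var φ λ { v0 → refl ; (there x) → cong wk (e x) })
sub-var (∃<[ t ] φ) e = cong₂ ∃<[_]_ (trans (subTm-cong e t) (subTm-var t))
  (sub-var φ λ { v0 → refl ; (there x) → cong wk (e x) })

tr-closed : ∀ {μ} (φ : L₂.Fm []) → (tr φ ^st) ⟨ ops μ ⟩ ~ ((⌜ φ ⌝ ^st) ⟨ ∅ ⟩)
tr-closed {μ} φ = mk λ η → trans (real-⟨⟩ η (ops μ) (tr φ ^st)) (trans
  (sym (sub-tr (mk (λ ()) (real-plus η) (real-times η) (real-monus η)) φ))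
  (sym (real-⟨⟩ η ∅ (⌜ φ ⌝ ^st))))

extract : (φ : L₂.Fm []) → [] ⊩ (⌜ φ ⌝ ^st) ⟨ ∅ ⟩ → Th ∣ [] ⊢ ⌜ φ ⌝ ^st
extract φ d = subst (Th ∣ [] ⊢_) (trans (real-⟨⟩ η ∅ (⌜ φ ⌝ ^st)) (sub-var (⌜ φ ⌝ ^st) (λ ())))
  (instantiate d η)
  where
    η : Names []
    -- A closed formula over the empty environment contains no names, so any closed terms will do as
    -- their values.
    η σ n = zeroAt σ

-- Characteristic functions and extensionality

private variable
  e : Env Γ
  μ : Term (𝟏 ⇒ 𝟎)
  X Y Y′ Z : Term 𝟏

-- `T` has 0 for truth whereas membership is the value 1, so the truth value is reversed.
setOf : Ops ⊆ Γ → (φ : Fm (𝟎 ∷ Γ)) → Arithmetical φ → Tm Γ 𝟏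
setOf o φ p = lam (ifz (T (λ x → there (o x)) φ p) (suc′ O) O)

ifz-1̲ : H ⊩ ifzᵗ a 1̲ O̲ ≐ 1̲ ↔ a ≐ O̲
ifz-1̲ {a = a} = split a
  (λ z → (lam⊃ λ _ → ↑ num z) & (lam⊃ λ _ → num (ifz-O̲ (↑≃ z))))
  (λ z → (lam⊃ λ h → S̲≢O̲ (≃sym (eq h) ⨾ ifz-S̲ (↑≃ z))) & (lam⊃ λ h → O̲≢S̲ (eq h) (↑≃ z)))

≐-↔ : H ⊩ s ≃ t → H ⊩ s ≐ u ↔ t ≐ u
≐-↔ p = lam⊃ (λ a → num (↑≃ ≃sym p ⨾ eq a)) & lam⊃ (λ a → num (↑≃ p ⨾ eq a))

set-∈ : (o : Ops ⊆ Γ) → Interprets {μ = μ} e o → (φ : Fm (𝟎 ∷ Γ)) (p : Arithmetical φ) →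
        H ⊩μ μ → H ⊩st e → H ⊩ st n → H ⊩ setOf o φ p ⟪ e ⟫ · n ≐ 1̲ ↔ (φ ^st) ⟨ e ▸ n ⟩
set-∈ {e = e} o i φ p M E sn =
  ≐-↔ (β (ifz (T (λ x → there (o x)) φ p) (suc′ O) O) {e}) ⨾↔ ifz-1̲ ⨾↔
  T-spec (λ x → there (o x)) i φ p M (E ▸ sn)

set-≼1 : (o : Ops ⊆ Γ) (φ : Fm (𝟎 ∷ Γ)) (p : Arithmetical φ) → ∀ n → H ⊩ setOf o φ p ⟪ e ⟫ · n ≼ 1̲
set-≼1 {e = e} o φ p n = ≼-≃ (≃sym (β (ifz φ? (suc′ O) O) {e})) ≃refl
  (split (φ? ⟪ e ▸ n ⟫)
    (λ z → ≼-reflexive (ifz-O̲ z))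
    (λ z → ≼-≃ (≃sym (ifz-S̲ z)) ≃refl O̲≼))
  where φ? = T (λ x → there (o x)) φ p

0-or-1 : H ⊩ a ≼ 1̲ → H ⊩ (a ≐ O̲) ∨ (a ≐ 1̲)
0-or-1 p = cases (≼-split p) (λ h → inl (num (≼-antisym (S̲≼S̲⁻¹ h) O̲≼))) inr

≃-bit : H ⊩ a ≼ 1̲ → H ⊩ b ≼ 1̲ → H ⊩ a ≐ 1̲ ↔ b ≐ 1̲ → H ⊩ a ≃ b
≃-bit p q h = eq (cases (0-or-1 p)
  (λ x → cases (0-or-1 (↑ q))
    (λ y → num (↑≃ eq x ⨾ ≃sym (eq y)))
    (λ y → O̲≢S̲ (↑≃ eq x) (eq (↑² snd h $ y))))
  (λ x → num (eq x ⨾ ≃sym (eq (↑ fst h $ x)))))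

-- An argument where `X` and `Y` differ is a zero of a standard function, so by transfer they would
-- differ at a standard argument. Definitions that fix only the values at standard arguments thus
-- yield extensional equality, which all functionals respect.
st-funext : H ⊩ st X → H ⊩ st Y → (∀ n → st n ∷ H ⊩ st n → st n ∷ H ⊩ X · n ≃ Y · n) → H ⊩ X ≃ Y
st-funext {X = X} {Y} sX sY p = funext λ n → eq (contra λ h →
  exE (transfer (st-⟪⟫ (∅ ▸ st-monus ▸ ↑ sX ▸ ↑ sY) (lam differ))
        (num (β differ {∅ ▸ monus ▸ X ▸ Y} ⨾ eq (snd (same n) $ h)))) λ m g →
    fst (same m) $ num (≃sym (β differ {∅ ▸ monus ▸ X ▸ Y}) ⨾ eq (snd g)) $
      (↑² (lam⊃ λ s → num (p m s)) $ fst g))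
  where
    differ : Tm (𝟎 ∷ 𝟏 ∷ 𝟏 ∷ (𝟎 ⇒ 𝟎 ⇒ 𝟎) ∷ []) 𝟎
    differ = ifz (ifz (var v3 · (var v2 · var v0) · (var v1 · var v0))
                      (var v3 · (var v1 · var v0) · (var v2 · var v0)) (suc′ O)) (suc′ O) O

    same : ∀ {H} n → H ⊩ differ ⟪ ∅ ▸ monus ▸ X ▸ Y ▸ n ⟫ ≐ O̲ ↔ X · n ≐ Y · n ⊃ ⊥′
    same n = ifz-¬ (ifz-∧ ↔refl ↔refl ⨾↔
      (lam⊃ (λ h → num (≼-antisym (fst h) (snd h))) &
       lam⊃ (λ h → ≼-reflexive (eq h) & ≼-reflexive (≃sym (eq h)))))

-- Comprehension, induction and the axioms of arithmetic

data Good (H : List Form) (μ : Term (𝟏 ⇒ 𝟎)) : ∀ Ξ → Env ⟦ Ξ ⟧ᶜ → Set where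
  start  : H ⊩μ μ → Good H μ [] (ops μ)
  _▸_    : {t : Term ⟦ ς ⟧} → Good H μ Ξ e → H ⊩ st t → Good H μ (ς ∷ Ξ) (e ▸ t)

good-μ : Good H μ Ξ e → H ⊩μ μ
good-μ (start M) = M
good-μ (g ▸ p)   = good-μ g

good-st : Good H μ Ξ e → H ⊩st e
good-st (start M) = st-ops M
good-st (g ▸ p)   = good-st g ▸ p

good-Interprets : Good H μ Ξ e → Interprets {μ = μ} e (op Ξ)
good-Interprets (start M) x = refl
good-Interprets (g ▸ p) x   = good-Interprets g x

↑ᵍ_ : Good H μ Ξ e → Good (A ∷ H) μ Ξ e
↑ᵍ start M = start (↑ᵐ M)
↑ᵍ (g ▸ p) = (↑ᵍ g) ▸ ↑ p

infix 20 ↑ᵍ_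

-- `closure` binds the innermost variable first. The premise is uniform in `H` and `e`, since each
-- quantifier adds both hypotheses and a value.
close : (φ : L₂.Fm Ξ) → (∀ {H e} → Good H μ Ξ e → H ⊩ (tr φ ^st) ⟨ e ⟩) →
        H ⊩μ μ → H ⊩ (tr (L₂.closure Ξ φ) ^st) ⟨ ops μ ⟩
close {[]} φ f M = f (start M)
close {L₂.num ∷ Ξ} φ f M = close (L₂.∀ⁿ φ) (λ g → allI λ n → lam⊃ λ sn → f (↑ᵍ g ▸ sn)) M
close {L₂.set ∷ Ξ} φ f M =
  close (L₂.∀ˢ φ) (λ g → allI λ X → lam⊃ λ sX → lam⊃ λ _ → f (↑ᵍ (↑ᵍ g ▸ sX))) M

tr-Arithmetical : (φ : L₂.Fm Ξ) → L₂.Arithmetical φ → Arithmetical (tr φ)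
tr-Arithmetical (s L₂.≐ t) p         = p
tr-Arithmetical (s L₂.< t) p         = p
tr-Arithmetical (t L₂.ε X) p         = p
tr-Arithmetical L₂.⊥′ p              = p
tr-Arithmetical (φ L₂.∧ ψ) (p , q)   = tr-Arithmetical φ p , tr-Arithmetical ψ q
tr-Arithmetical (φ L₂.∨ ψ) (p , q)   = tr-Arithmetical φ p , tr-Arithmetical ψ q
tr-Arithmetical (φ L₂.⊃ ψ) (p , q)   = tr-Arithmetical φ p , tr-Arithmetical ψ q
tr-Arithmetical (L₂.∀ⁿ φ) p          = tr-Arithmetical φ p
tr-Arithmetical (L₂.∃ⁿ φ) p          = tr-Arithmetical φ p
tr-Arithmetical (L₂.∀<[ t ] φ) p     = tr-Arithmetical φ p
tr-Arithmetical (L₂.∃<[ t ] φ) p     = tr-Arithmetical φ p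

tr-ren-⟨⟩ : {ρ : Ξ ⊆ Ξ′} {e : Env ⟦ Ξ ⟧ᶜ} {e′ : Env ⟦ Ξ′ ⟧ᶜ} →
            (∀ {ς} (x : ς ∈ Ξ) → lookup e′ ⟦ ρ x ⟧ᵛ ≡ lookup e ⟦ x ⟧ᵛ) →
            (∀ {σ} (x : σ ∈ Ops) → lookup e′ (op Ξ′ x) ≡ lookup e (op Ξ x)) →
            (φ : L₂.Fm Ξ) → ((tr (L₂.ren ρ φ) ^st) ⟨ e′ ⟩) ~ ((tr φ ^st) ⟨ e ⟩)
tr-ren-⟨⟩ {ρ = ρ} {e} {e′} p q φ = mk λ η → trans (real-⟨⟩ η e′ (tr (L₂.ren ρ φ) ^st)) (trans
  (tr-ren (mk (λ x → cong (realᵗ η) (p x)) (λ x → cong (realᵗ η) (q x))) φ)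
  (sym (real-⟨⟩ η e (tr φ ^st))))

binaryᵒ-intro : Good H μ Ξ e → (∀ n → H ⊩ X · n ≼ 1̲) → H ⊩ (binaryᵒ Ξ ^st) ⟨ e ▸ X ⟩
binaryᵒ-intro {H = H} {X = X} g p = allI λ n → lam⊃ λ _ →
  subst (λ m → st n ∷ H ⊩ m · (X · n) · 1̲ ≐ O̲) (sym (good-Interprets g v1)) (↑ p n)

binaryᵒ-elim : Good H μ Ξ e → H ⊩ (binaryᵒ Ξ ^st) ⟨ e ▸ X ⟩ → H ⊩ st n → H ⊩ X · n ≼ 1̲
binaryᵒ-elim {X = X} {n = n} g p sn =
  subst (λ m → _ ⊩ m · (X · n) · 1̲ ≐ O̲) (good-Interprets g v1) (p $∀ n $ sn)

comprehension : (φ : L₂.Fm (L₂.num ∷ Ξ)) → L₂.Arithmetical φ → Good H μ Ξ e →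
  H ⊩ (tr (L₂.∃ˢ L₂.∀ⁿ (L₂.var v0 L₂.ε v1 L₂.⇔ L₂.ren (∷⁺ʳ L₂.num there) φ)) ^st) ⟨ e ⟩
comprehension {Ξ = Ξ} {e = e} φ p g = exI (setOf (op Ξ) (tr φ) q ⟪ e ⟫)
  (st-⟪⟫ (good-st g) (setOf (op Ξ) (tr φ) q) & binaryᵒ-intro g (set-≼1 (op Ξ) (tr φ) q) &
   (allI λ n → lam⊃ λ sn →
     let m = set-∈ (op Ξ) (good-Interprets g) (tr φ) q (↑ᵐ good-μ g) (↑ˢ good-st g) sn
         r = tr-ren-⟨⟩ (λ { v0 → refl ; (there x) → refl }) (λ x → refl) φ
     in lam⊃ (λ h → conv (~sym r) (↑ fst m $ h)) & lam⊃ (λ h → ↑ snd m $ conv r h)))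
  where q = tr-Arithmetical φ p

⊞-1̲ : H ⊩ n ⊞ 1̲ ≃ S̲ n
⊞-1̲ = ⊞-S̲ ⨾ S̲-cong ⊞-O̲

∀st : {φ : Fm (𝟎 ∷ Γ)} → (∀ n → st n ∷ H ⊩ st n → st n ∷ H ⊩ φ ⟨ e ▸ n ⟩) → H ⊩ (∀ˢᵗ[ 𝟎 ] φ) ⟨ e ⟩
∀st f = allI λ n → lam⊃ (f n)

Valid : L₂.Fm [] → Set
Valid φ = ∀ {H μ} → H ⊩μ μ → H ⊩ (tr φ ^st) ⟨ ops μ ⟩

valid-induction : Valid (L₂.∀ˢ L₂.𝟘 L₂.ε v0 L₂.∧ (L₂.∀ⁿ L₂.var v0 L₂.ε v1 L₂.⊃ L₂.var v0 L₂.+ L₂.𝟙 L₂.ε v1)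
                                L₂.⊃ (L₂.∀ⁿ L₂.var v0 L₂.ε v1))
valid-induction M = allI λ X → lam⊃ λ _ → lam⊃ λ _ → lam⊃ λ h → ∀st λ n sn →
  st-ind (var v1 · var v0 ≐ suc′ O) (∅ ▸ X) (↑ fst h)
    (λ k sk g → num (≃sym (ext-app ⊞-1̲) ⨾ eq (↑³ snd h $∀ k $ sk $ g))) sn

valid-<-suc : Valid (L₂.∀ⁿ L₂.∀ⁿ (L₂.var v1 L₂.< L₂.var v0 L₂.+ L₂.𝟙 L₂.⇔
                                   L₂.var v1 L₂.< L₂.var v0 L₂.∨ L₂.var v1 L₂.≐ L₂.var v0))
valid-<-suc M = ∀st λ m _ → ∀st λ n _ →
  (lam⊃ λ h → ≼-split (S̲≼S̲⁻¹ (≼-≃ ≃refl ⊞-1̲ h))) &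
  (lam⊃ λ h → ≼-≃ ≃refl (≃sym ⊞-1̲) (S̲≼S̲ (cases h ≺⇒≼ (λ p → ≼-reflexive (eq p)))))

valid-+1-nonzero : Valid (L₂.∀ⁿ L₂.¬ (L₂.var v0 L₂.+ L₂.𝟙 L₂.≐ L₂.𝟘))
valid-+1-nonzero M = ∀st λ n _ → lam⊃ λ h → S̲≢O̲ (≃sym ⊞-1̲ ⨾ eq h)

valid-+1-inj : Valid (L₂.∀ⁿ L₂.∀ⁿ L₂.var v1 L₂.+ L₂.𝟙 L₂.≐ L₂.var v0 L₂.+ L₂.𝟙 L₂.⊃ L₂.var v1 L₂.≐ L₂.var v0)
valid-+1-inj M = ∀st λ m _ → ∀st λ n _ → lam⊃ λ h → num (S̲-inj (≃sym ⊞-1̲ ⨾ eq h ⨾ ⊞-1̲))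

valid-+-suc : Valid (L₂.∀ⁿ L₂.∀ⁿ
  L₂.var v1 L₂.+ (L₂.var v0 L₂.+ L₂.𝟙) L₂.≐ (L₂.var v1 L₂.+ L₂.var v0) L₂.+ L₂.𝟙)
valid-+-suc M = ∀st λ m _ → ∀st λ n _ → num (⊞-cong ≃refl ⊞-1̲ ⨾ ⊞-S̲ ⨾ ≃sym ⊞-1̲)

valid-*-suc : Valid (L₂.∀ⁿ L₂.∀ⁿ
  L₂.var v1 L₂.* (L₂.var v0 L₂.+ L₂.𝟙) L₂.≐ L₂.var v1 L₂.* L₂.var v0 L₂.+ L₂.var v1)
valid-*-suc M = ∀st λ m _ → ∀st λ n _ → num (⊠-cong ≃refl ⊞-1̲ ⨾ ⊠-S̲)

-- A standard finite sequence of consistent demands on the values of a function is met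
-- by one function.  Hence some function meets all standard demands, and so does its
-- standard part.

private
  Tasks : Ctx
  Tasks = (𝟏 ⇒ 𝟎) ∷ (𝟏 ⇒ 𝟎) ∷ []

  -- A demand is a function v with `C · v = 0`; it asks for the value `V · v` at the argument
  -- `v · O`. The formula is internal, as idealisation requires.
  solves : Fm (𝟏 ∷ 𝟏 ∷ (𝟏 ⇒ 𝟎) ∷ (𝟏 ⇒ 𝟎) ∷ Γ)
  solves = var v3 · var v0 ≐ O ⊃ var v1 · (var v0 · O) ≐ var v2 · var v0

  idealise : H ⊩ (∀[ 𝟏 ⇒ 𝟎 ] ∀[ 𝟏 ⇒ 𝟎 ]
    (∀ˢᵗ[ 𝟏 * ] ∃[ 𝟏 ] ∀[ 𝟏 ] var v0 ε var v2 ⊃ ren (∷⁺ʳ 𝟏 (∷⁺ʳ 𝟏 there)) solves) ⊃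
    (∃[ 𝟏 ] ∀ˢᵗ[ 𝟏 ] solves)) ⟨ ∅ ⟩
  idealise = mk λ η → ∀I (∀I (ax (inj₁ (inj₁ (idealisation solves _)))))

  hitᵇ : Tm (𝟎 ∷ 𝟎 ∷ 𝟎 ∷ 𝟏 * ∷ (𝟏 ⇒ 𝟎) ∷ (𝟏 ⇒ 𝟎) ∷ (𝟎 ⇒ 𝟎 ⇒ 𝟎) ∷ []) 𝟎
  hitᵇ = ifz (var v5 · v)
             (ifz (var (there v5) · (v · O) · var v2) (var (there v5) · var v2 · (v · O)) (suc′ O)) (suc′ O)
    where
      v : Tm (𝟎 ∷ 𝟎 ∷ 𝟎 ∷ 𝟏 * ∷ (𝟏 ⇒ 𝟎) ∷ (𝟏 ⇒ 𝟎) ∷ (𝟎 ⇒ 𝟎 ⇒ 𝟎) ∷ []) 𝟏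
      v = var v3 ! var v0

  pickᵇ : Tm (𝟎 ∷ 𝟎 ∷ 𝟎 ∷ 𝟏 * ∷ (𝟏 ⇒ 𝟎) ∷ (𝟏 ⇒ 𝟎) ∷ (𝟎 ⇒ 𝟎 ⇒ 𝟎) ∷ []) 𝟎
  pickᵇ = ifz hitᵇ (var v4 · (var v3 ! var v0)) (var v1)

  -- The value demanded at k by the last item of the finite sequence that demands one.
  valueᵇ : Tm (𝟎 ∷ 𝟏 * ∷ (𝟏 ⇒ 𝟎) ∷ (𝟏 ⇒ 𝟎) ∷ (𝟎 ⇒ 𝟎 ⇒ 𝟎) ∷ []) 𝟎
  valueᵇ = rec (length (var v1)) O (lam (lam pickᵇ))

  clipᵇ : Tm (𝟎 ∷ 𝟏 ∷ []) 𝟎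
  clipᵇ = ifz (var v1 · var v0) O (suc′ O)

Consistent : Fm Tasks
Consistent = ∀ˢᵗ[ 𝟏 ] ∀ˢᵗ[ 𝟏 ]
  var v3 · var v1 ≐ O ⊃ var v3 · var v0 ≐ O ⊃ var v1 · O ≐ var v0 · O ⊃ var v2 · var v1 ≐ var v2 · var v0

module _ {C V : Term (𝟏 ⇒ 𝟎)} where

  private
    module _ {s : Term (𝟏 *)} {v : Term 𝟏} where

      item : Term 𝟎 → Term 𝟏
      item i = con at · s · i

      at-key : Env (𝟎 ∷ 𝟏 * ∷ (𝟏 ⇒ 𝟎) ∷ (𝟏 ⇒ 𝟎) ∷ (𝟎 ⇒ 𝟎 ⇒ 𝟎) ∷ [])
      at-key = ∅ ▸ monus ▸ C ▸ V ▸ s ▸ v · O̲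

      pick = lam (lam pickᵇ) ⟪ at-key ⟫

      hit : ∀ n → H ⊩ hitᵇ ⟪ at-key ▸ recᵗ n O̲ pick ▸ n ⟫ ≐ O̲ ↔ C · item n ≐ O̲ ∧ item n · O̲ ≐ v · O̲
      hit n = ifz-∧ ↔refl (ifz-∧ ↔refl ↔refl ⨾↔
        (lam⊃ (λ h → num (≼-antisym (fst h) (snd h))) &
         lam⊃ (λ h → ≼-reflexive (eq h) & ≼-reflexive (≃sym (eq h)))))

      pick-step : ∀ n → H ⊩ recᵗ (S̲ n) O̲ pick ≃
                        ifzᵗ (hitᵇ ⟪ at-key ▸ recᵗ n O̲ pick ▸ n ⟫) (V · item n) (recᵗ n O̲ pick)
      pick-step n = rec-lam pickᵇ {at-key}

      -- Once item `i`, which is `v`, has been passed, the value can only be replaced by that of a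
      -- later item with the same key. Such an item is standard, its index being below the standard
      -- length, so by consistency it demands the same value as `v`. The guard `n ≤ len s` serves to
      -- keep the indices standard.
      picks : H ⊩ st s → H ⊩ Consistent ⟨ ∅ ▸ C ▸ V ⟩ → H ⊩ i ≺ con len · s → H ⊩ v ≃ item i →
              H ⊩ C · v ≐ O̲ → ∀ n → H ⊩ n ≼ con len · s ⊃ i ≺ n ⊃ recᵗ n O̲ pick ≐ V · v
      picks {i = i} ss cons i≺ v≃ Cv = ind
        (var v5 · var v0 · var v4 ≐ O ⊃ var v5 · suc′ (var v3) · var v0 ≐ O ⊃
         rec (var v0) O (var v2) ≐ var v1)
        (∅ ▸ monus ▸ con len · s ▸ i ▸ pick ▸ V · v)
        (lam⊃ λ _ → lam⊃ ⊀O̲)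
        λ n h → lam⊃ λ n≺ → lam⊃ λ i≼n → split (hitᵇ ⟪ at-key ▸ recᵗ n O̲ pick ▸ n ⟫)
          (λ z → num (pick-step n ⨾ ifz-O̲ z ⨾ eq
            (↑⁴ cons $∀ item n $ st-· (st-· st-con (↑⁴ ss)) (st-≼ (↑⁴ len-st) (≺⇒≼ (↑² n≺)))
                    $∀ v $ ↑⁴ sv $ fst (fst (hit n) $ num z) $ ↑⁴ Cv $ snd (fst (hit n) $ num z))))
          (λ z → num (pick-step n ⨾ ifz-S̲ z ⨾ eq (cases (≼-split (S̲≼S̲⁻¹ (↑ i≼n)))
            (λ i≺n → ↑⁴ h $ ≺⇒≼ (↑³ n≺) $ i≺n)
            (λ i≐n → let v≃n = ↑≃ ↑≃ ↑≃ ↑≃ ↑≃ v≃ ⨾ ext-app (eq i≐n) in ↔-nonzero (hit n) (↑≃ z)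
              (num (ext-app (≃sym v≃n) ⨾ eq (↑⁵ Cv)) & num (app-cong (≃sym v≃n)))))))
        where
          len-st : _ ⊩ st (con len · s)
          len-st = st-· st-con ss

          sv : _ ⊩ st v
          sv = st-≃ (≃sym v≃) (st-· (st-· st-con ss) (st-≼ len-st (≺⇒≼ i≺)))

  standardSolution : H ⊩ Consistent ⟨ ∅ ▸ C ▸ V ⟩ → (∀ {H} v → H ⊩ V · v ≼ 1̲) →
                     H ⊩ (∃ˢᵗ[ 𝟏 ] ∀ˢᵗ[ 𝟏 ] solves) ⟨ ∅ ▸ C ▸ V ⟩
  standardSolution {H} cons V≼1 = exE (idealise $∀ C $∀ V $ premise) λ Z h →
    -- `STP` applies to binary functions only. All demanded values are at most 1, so clipping `Z`
    -- changes none of them, and `v · O` is standard when `v` is, so neither does passing to the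
    -- standard part.
    exE (standardPart (clip-binary Z)) λ Z° g → exI Z° (fst g & allI λ v → lam⊃ λ sv → lam⊃ λ Cv →
      num (≃sym (eq (↑² snd (snd g) $∀ v · O̲ $ st-· (↑ sv) st-con)) ⨾ β clipᵇ {∅ ▸ Z} ⨾
           clip (V≼1 v) (eq (↑³ h $∀ v $ ↑ sv $ Cv))))
    where
      premise : H ⊩ (∀ˢᵗ[ 𝟏 * ] ∃[ 𝟏 ] ∀[ 𝟏 ]
        var v0 ε var v2 ⊃ ren (∷⁺ʳ 𝟏 (∷⁺ʳ 𝟏 there)) solves) ⟨ ∅ ▸ C ▸ V ⟩
      premise = allI λ s → lam⊃ λ ss → exI (lam valueᵇ ⟪ ∅ ▸ monus ▸ C ▸ V ▸ s ⟫) (allI λ v → lam⊃ λ v∈s →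
        lam⊃ λ Cv → ex<E (↑ v∈s) λ i i≺ v≐ → num (β valueᵇ {∅ ▸ monus ▸ C ▸ V ▸ s} ⨾ eq
          (picks (↑⁴ ss) (↑⁵ cons) i≺ (funext λ x → eq (v≐ $∀ x)) (↑² Cv) (con len · s) $ ≼-refl $ i≺)))

      clip : ∀ {H a b} → H ⊩ b ≼ 1̲ → H ⊩ a ≃ b → H ⊩ ifzᵗ a O̲ 1̲ ≃ b
      clip p q = eq (cases (0-or-1 p)
        (λ z → num (ifz-O̲ (↑≃ q ⨾ eq z) ⨾ ≃sym (eq z)))
        (λ z → num (ifz-S̲ (↑≃ q ⨾ eq z) ⨾ ≃sym (eq z))))

      clip-binary : ∀ {H} Z → H ⊩ binary ⟨ ∅ ▸ monus ▸ lam clipᵇ ⟪ ∅ ▸ Z ⟫ ⟩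
      clip-binary Z = allI λ k → ≼-≃ (≃sym (β clipᵇ {∅ ▸ Z})) ≃refl (split (Z · k)
        (λ z → ≼-≃ (≃sym (ifz-O̲ z)) ≃refl O̲≼)
        (λ z → ≼-reflexive (ifz-S̲ z)))

-- Transfinite induction

module _ {Γ : Ctx} (o : Ops ⊆ Γ) where

  pairᵒ : Tm Γ 𝟎 → Tm Γ 𝟎 → Tm Γ 𝟎
  pairᵒ i j = var (o v3) · (var (o v2) · (var (o v3) · i · j) · (var (o v3) · i · j)) · i

  leᵒ ltᵒ : Tm Γ 𝟏 → Tm Γ 𝟎 → Tm Γ 𝟎 → Fm Γ
  leᵒ X i j = X · pairᵒ i j ≐ suc′ O
  ltᵒ X i j = leᵒ X i j ∧ (¬ leᵒ X j i)

th² : ∀ {a b} → Γ ⊆ a ∷ b ∷ Γ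
th² x = there (there x)

th³ : ∀ {a b c} → Γ ⊆ a ∷ b ∷ c ∷ Γ
th³ x = there (there (there x))

th⁴ : ∀ {a b c d} → Γ ⊆ a ∷ b ∷ c ∷ d ∷ Γ
th⁴ x = there (there (there (there x)))

Le Lt : Term 𝟏 → Term 𝟎 → Term 𝟎 → Form
Le X i j = X · pairᵗ i j ≐ 1̲
Lt X i j = Le X i j ∧ (Le X j i ⊃ ⊥′)

private variable
  f p : Term 𝟏

Le-≃ : H ⊩ a ≃ b → H ⊩ i ≃ j → H ⊩ Le X a i → H ⊩ Le X b j
Le-≃ p q h = num (ext-app (pairᵗ-cong (≃sym p) (≃sym q)) ⨾ eq h)

Lt-≃ : H ⊩ a ≃ b → H ⊩ i ≃ j → H ⊩ Lt X a i → H ⊩ Lt X b j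
Lt-≃ p q h = Le-≃ p q (fst h) & (lam⊃ λ k → ↑ snd h $ Le-≃ (↑≃ ≃sym q) (↑≃ ≃sym p) k)

st-pairᵗ : H ⊩ st i → H ⊩ st j → H ⊩ st (pairᵗ i j)
st-pairᵗ si sj = st-⟪⟫ (∅ ▸ st-plus ▸ st-times ▸ si ▸ sj)
  (var v3 · (var v2 · (var v3 · var v1 · var v0) · (var v3 · var v1 · var v0)) · var v1)

-- Descending sequences and their graphs

private
  graphᶠ : Fm (𝟎 ∷ 𝟏 ∷ Ops)
  graphᶠ = ∃[ 𝟎 ] var v1 ≐ pairᵒ th³ (var v0) (var v2 · var v0)

-- `L₂.WF` speaks of sets of pairs, so a descending function must be recoded as its graph before it
-- can refute well-foundedness.
graph : Term (𝟏 ⇒ 𝟎) → Term 𝟏 → Term 𝟏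
graph μ f = setOf there graphᶠ tt ⟪ ops μ ▸ f ⟫

graph-≼1 : ∀ n → H ⊩ graph μ f · n ≼ 1̲
graph-≼1 {μ = μ} {f} = set-≼1 {e = ops μ ▸ f} there graphᶠ tt

st-graph : H ⊩μ μ → H ⊩ st f → H ⊩ st (graph μ f)
st-graph M sf = st-⟪⟫ (st-ops M ▸ sf) (setOf there graphᶠ tt)

graph-∈ : H ⊩μ μ → H ⊩ st f → H ⊩ st n →
          H ⊩ graph μ f · n ≐ 1̲ ↔ (graphᶠ ^st) ⟨ ops μ ▸ f ▸ n ⟩
graph-∈ M sf sn = set-∈ there (λ x → refl) graphᶠ tt M (st-ops M ▸ sf) sn

graph-value : H ⊩μ μ → H ⊩ st f → H ⊩ st n → H ⊩ graph μ f · pairᵗ n (f · n) ≐ 1̲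
graph-value M sf sn = snd (graph-∈ M sf (st-pairᵗ sn (st-· sf sn))) $ exI _ (sn & num ≃refl)

graph-unique : H ⊩μ μ → H ⊩ st f → H ⊩ st n → H ⊩ st a → H ⊩ graph μ f · pairᵗ n a ≐ 1̲ → H ⊩ a ≃ f · n
graph-unique M sf sn sa h = eq (exE (fst (graph-∈ M sf (st-pairᵗ sn sa)) $ h) λ m g →
  num (pairᵗ-injʳ (eq (snd g)) ⨾ ext-app (≃sym (pairᵗ-injˡ (eq (snd g))))))

private
  iterateᵇ : Tm (𝟎 ∷ 𝟎 ∷ 𝟏 ∷ []) 𝟎
  iterateᵇ = rec (var v0) (var v1) (lam (lam (var v4 · var v1)))

iterate : Term 𝟏 → Term 𝟎 → Term 𝟏
iterate f a = lam iterateᵇ ⟪ ∅ ▸ f ▸ a ⟫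

st-iterate : H ⊩ st f → H ⊩ st a → H ⊩ st (iterate f a)
st-iterate sf sa = st-⟪⟫ (∅ ▸ sf ▸ sa) (lam iterateᵇ)

iterate-O̲ : H ⊩ iterate f a · O̲ ≃ a
iterate-O̲ {f = f} {a} = β iterateᵇ {∅ ▸ f ▸ a} ⨾ rec-O̲

iterate-S̲ : H ⊩ iterate f a · S̲ n ≃ f · (iterate f a · n)
iterate-S̲ {f = f} {a} {n} = β iterateᵇ {∅ ▸ f ▸ a} ⨾ rec-lam (var v4 · var v1) {∅ ▸ f ▸ a ▸ n} ⨾
  ext-app (≃sym (β iterateᵇ {∅ ▸ f ▸ a}))

Progressive : Fm (𝟏 ∷ 𝟏 ∷ Ops)
Progressive = ∀ˢᵗ[ 𝟎 ] leᵒ th³ (var v2) (var v0) (var v0) ⊃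
  (∀ˢᵗ[ 𝟎 ] ltᵒ th⁴ (var v3) (var v0) (var v1) ⊃ var v2 · var v0 ≐ O) ⊃ var v1 · var v0 ≐ O

record _⊩WO[_]_ (H : List Form) (μ : Term (𝟏 ⇒ 𝟎)) (X : Term 𝟏) : Set where
  constructor mk
  field
    search-μ : H ⊩μ μ
    st-order : H ⊩ st X
    isWO     : H ⊩ (tr {L₂.set ∷ []} (L₂.WO v0) ^st) ⟨ ops μ ▸ X ⟩

open _⊩WO[_]_

infix 1 _⊩WO[_]_
infix 20 ↑ʷ_

↑ʷ_ : H ⊩WO[ μ ] X → A ∷ H ⊩WO[ μ ] X
↑ʷ mk M s w = mk (↑ᵐ M) (↑ s) (↑ w)

module _ (W : H ⊩WO[ μ ] X) where

  Le-field : H ⊩ st i → H ⊩ st j → H ⊩ Le X i j → H ⊩ Le X i i ∧ Le X j j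
  Le-field si sj h = fst (fst (isWO W)) $∀ _ $ si $∀ _ $ sj $ h

  Le-trans : H ⊩ st i → H ⊩ st j → H ⊩ st k → H ⊩ Le X i j → H ⊩ Le X j k → H ⊩ Le X i k
  Le-trans si sj sk h g = fst (snd (fst (isWO W))) $∀ _ $ si $∀ _ $ sj $∀ _ $ sk $ (h & g)

Lt-trans : H ⊩WO[ μ ] X → H ⊩ st i → H ⊩ st j → H ⊩ st k → H ⊩ Lt X i j → H ⊩ Lt X j k → H ⊩ Lt X i k
Lt-trans W si sj sk h g = Le-trans W si sj sk (fst h) (fst g) &
  (lam⊃ λ q → ↑ snd g $ Le-trans (↑ʷ W) (↑ sk) (↑ si) (↑ sj) q (↑ fst h))

private
  descentᶠ : Fm (𝟎 ∷ 𝟎 ∷ 𝟏 ∷ 𝟏 ∷ Ops)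
  descentᶠ = ltᵒ th⁴ (var v3) (var v0) (var v1) ∧ (¬ (var v2 · var v0 ≐ O))

  -- The search functional selects a smaller counterexample as a function of `j`, so the descending
  -- sequence arises by primitive recursion, without an appeal to dependent choice.
  descendᵇ : Tm (𝟎 ∷ 𝟏 ∷ 𝟏 ∷ Ops) 𝟎
  descendᵇ = var v3 · lam (T th⁴ descentᶠ _)

module _ {μ : Term (𝟏 ⇒ 𝟎)} {X p : Term 𝟏} where

  private
    E : Env (𝟏 ∷ 𝟏 ∷ Ops)
    E = ops μ ▸ X ▸ p

    descend : Term 𝟏
    descend = lam descendᵇ ⟪ E ⟫

    search-at : Term 𝟎 → Term 𝟏
    search-at j = lam (T th⁴ descentᶠ _) ⟪ E ▸ j ⟫

    st-search-at : H ⊩WO[ μ ] X → H ⊩ st p → H ⊩ st j → H ⊩ st (search-at j)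
    st-search-at W sp sj =
      st-⟪⟫ (st-ops (search-μ W) ▸ st-order W ▸ sp ▸ sj) (lam (T th⁴ descentᶠ _))

    search-at-spec : H ⊩WO[ μ ] X → H ⊩ st p → H ⊩ st j → H ⊩ st i →
                     H ⊩ search-at j · i ≐ O̲ ↔ Lt X i j ∧ (p · i ≐ O̲ ⊃ ⊥′)
    search-at-spec {j = j} W sp sj si = ≃⇒↔ (β (T th⁴ descentᶠ _) {E ▸ j}) ⨾↔
      T-spec th⁴ (λ x → refl) descentᶠ _ (search-μ W) (st-ops (search-μ W) ▸ st-order W ▸ sp ▸ sj ▸ si)

    descend-step : H ⊩WO[ μ ] X → H ⊩ st p → H ⊩ Progressive ⟨ E ⟩ → H ⊩ st j →
                   H ⊩ Le X j j → H ⊩ p · j ≐ O̲ ⊃ ⊥′ →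
                   H ⊩ Lt X (descend · j) j ∧ (p · (descend · j) ≐ O̲ ⊃ ⊥′)
    descend-step {H} {j} W sp prog sj fj pj =
      leibniz (descentᶠ ^st) (≈refl {e = E ▸ j} ▸ ≃sym (β descendᵇ {E}))
        (fst (search-at-spec W sp sj (st-· (standard (search-μ W)) sg)) $ found)
      where
        sg : H ⊩ st (search-at j)
        sg = st-search-at W sp sj

        found : H ⊩ search-at j · (μ · search-at j) ≐ O̲
        found = snd (∃-↔ refl (search-μ W) sg) $ (contra λ none →
          -- If no smaller counterexample existed, `p` would vanish at every standard i below `j`,
          -- and progressiveness would make it vanish at `j`.
          ↑ pj $ (↑ prog $∀ j $ ↑ sj $ ↑ fj $ (allI λ i → lam⊃ λ si → lam⊃ λ lt → contra λ pi →
            ↑³ none $ exI i (↑² si &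
              (snd (search-at-spec (↑ʷ ↑ʷ ↑ʷ ↑ʷ W) (↑⁴ sp) (↑⁴ sj) (↑² si)) $ (↑ lt & pi))))))

    st-descend : H ⊩WO[ μ ] X → H ⊩ st p → H ⊩ st descend
    st-descend W sp = st-⟪⟫ (st-ops (search-μ W) ▸ st-order W ▸ sp) (lam descendᵇ)

    -- Iterating the search for a smaller counterexample gives a descending sequence.
    no-counterexample : H ⊩WO[ μ ] X → H ⊩ st p → H ⊩ Progressive ⟨ E ⟩ → H ⊩ st j → H ⊩ Le X j j →
                        H ⊩ p · j ≐ O̲ ⊃ ⊥′ → H ⊩ ⊥′
    no-counterexample {H} {j} W sp prog sj fj pj = snd (snd (isWO W)) $ exI (graph μ path)
      (st-graph M sf &
       binaryᵒ-intro (start M ▸ st-order W) graph-≼1 &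
       ((∀st λ k sk → lam⊃ λ h → exE (fst (graph-∈ (↑ᵐ ↑ᵐ M) (↑² sf) (↑ sk)) $ h) λ n g →
          exI n (fst g & exI (path · n) (st-· (↑³ sf) (fst g) & snd g & fst (↑³ counterexample n $ fst g)))) &
        (∀st λ n sn → exI (path · n) (st-· (↑ sf) sn & graph-value (↑ᵐ M) (↑ sf) sn)) &
        (∀st λ n sn → ∀st λ a sa → ∀st λ b sb → lam⊃ λ h →
          num (graph-unique (↑ᵐ ↑ᵐ ↑ᵐ ↑ᵐ M) (↑⁴ sf) (↑³ sn) (↑² sa) (fst h) ⨾
               ≃sym (graph-unique (↑ᵐ ↑ᵐ ↑ᵐ ↑ᵐ M) (↑⁴ sf) (↑³ sn) (↑ sb) (snd h))))) &
       (∀st λ n sn → ∀st λ a sa → ∀st λ b sb → lam⊃ λ h → Lt-≃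
          (≃sym (graph-unique (↑ᵐ ↑ᵐ ↑ᵐ ↑ᵐ M) (↑⁴ sf) (st-S̲ (↑³ sn)) (↑ sb)
            (Le-≃ ⊞-1̲ ≃refl (snd h))))
          (≃sym (graph-unique (↑ᵐ ↑ᵐ ↑ᵐ ↑ᵐ M) (↑⁴ sf) (↑³ sn) (↑² sa) (fst h)))
          (↑⁴ decreasing n $ ↑³ sn)))
      where
        M = search-μ W

        path : Term 𝟏
        path = iterate descend j

        sf : H ⊩ st path
        sf = st-iterate (st-descend W sp) sj

        counterexample : ∀ n → H ⊩ st n ⊃ Le X (path · n) (path · n) ∧ (p · (path · n) ≐ O̲ ⊃ ⊥′)
        counterexample n = lam⊃ λ sn → st-ind
          (leᵒ th⁴ (var v3) (var v1 · var v0) (var v1 · var v0) ∧ (var v2 · (var v1 · var v0) ≐ O ⊃ ⊥′))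
          (E ▸ path)
          (Le-≃ (≃sym iterate-O̲) (≃sym iterate-O̲) (↑ fj) &
           (lam⊃ λ h → ↑² pj $ num (ext-app (≃sym iterate-O̲) ⨾ eq h)))
          (λ k sk h →
            let W₂  = ↑ʷ ↑ʷ ↑ʷ W
                sfk = st-· (↑³ sf) sk
                d   = descend-step W₂ (↑³ sp) (↑³ prog) sfk (fst h) (snd h)
                sd  = st-· (st-descend W₂ (↑³ sp)) sfk
            in Le-≃ (≃sym iterate-S̲) (≃sym iterate-S̲) (fst (Le-field W₂ sd sfk (fst (fst d)))) &
               (lam⊃ λ z → ↑ snd d $ num (ext-app (≃sym iterate-S̲) ⨾ eq z)))
          sn

        decreasing : ∀ n → H ⊩ st n ⊃ Lt X (path · S̲ n) (path · n)
        decreasing n = lam⊃ λ sn → Lt-≃ (≃sym iterate-S̲) ≃refl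
          (fst (descend-step (↑ʷ W) (↑ sp) (↑ prog) (st-· (↑ sf) sn)
            (fst (↑ counterexample n $ sn)) (snd (↑ counterexample n $ sn))))

  transfiniteInduction : H ⊩WO[ μ ] X → H ⊩ st p → H ⊩ Progressive ⟨ E ⟩ → H ⊩ st j → H ⊩ Le X j j →
                         H ⊩ p · j ≐ O̲
  transfiniteInduction W sp prog sj fj =
    contra (no-counterexample (↑ʷ W) (↑ sp) (↑ prog) (↑ sj) (↑ fj))

module _ {μ : Term (𝟏 ⇒ 𝟎)} {X : Term 𝟏} {o : Ops ⊆ Γ} {e : Env Γ} (i : Interprets {μ = μ} e o)
         (φ : Fm (𝟎 ∷ Γ)) (q : Arithmetical φ) where

  -- Transfinite induction applied to the truth value of `φ`. The formula in the hypothesis list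
  -- that carries the induction hypothesis is left arbitrary, as `IH`: the step receives its
  -- instances as derivations.
  inductionAlong : H ⊩WO[ μ ] X → H ⊩st e →
    (∀ {IH} j → IH ∷ Le X j j ∷ st j ∷ H ⊩ st j → IH ∷ Le X j j ∷ st j ∷ H ⊩ Le X j j →
      (∀ i → IH ∷ Le X j j ∷ st j ∷ H ⊩ st i ⊃ Lt X i j ⊃ (φ ^st) ⟨ e ▸ i ⟩) →
      IH ∷ Le X j j ∷ st j ∷ H ⊩ (φ ^st) ⟨ e ▸ j ⟩) →
    H ⊩ st j → H ⊩ Le X j j → H ⊩ (φ ^st) ⟨ e ▸ j ⟩
  inductionAlong W E step sj fj = fst (spec W E sj) $ transfiniteInduction W (st-⟪⟫ E (lam body))
    (∀st λ k sk → lam⊃ λ fk → lam⊃ λ ih → snd (spec (↑ʷ ↑ʷ ↑ʷ W) (↑ˢ ↑ˢ ↑ˢ E) (↑² sk)) $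
      step k (↑² sk) (↑ fk) (λ m → lam⊃ λ sm → lam⊃ λ lt →
        fst (spec (↑ʷ ↑ʷ ↑ʷ ↑ʷ ↑ʷ W) (↑ˢ ↑ˢ ↑ˢ ↑ˢ ↑ˢ E) (↑ sm)) $ (↑² ih $∀ m $ ↑ sm $ lt)))
    sj fj
    where
      body = T (λ x → there (o x)) φ q
      spec : ∀ {H n} → H ⊩WO[ μ ] X → H ⊩st e → H ⊩ st n → H ⊩ lam body ⟪ e ⟫ · n ≐ O̲ ↔ (φ ^st) ⟨ e ▸ n ⟩
      spec W E sn = ≃⇒↔ (β body) ⨾↔ T-spec (λ x → there (o x)) i φ q (search-μ W) (E ▸ sn)

-- Transfinite recursion

sectionᶠ : Fm (𝟎 ∷ 𝟎 ∷ 𝟏 ∷ 𝟏 ∷ Ops)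
sectionᶠ = ∃[ 𝟎 ] ∃[ 𝟎 ] var v2 ≐ pairᵒ o (var v1) (var v0) ∧
  (var v4 · var v2 ≐ suc′ O ∧ ltᵒ o (var v5) (var v0) (var v3))
  where
    o : Ops ⊆ 𝟎 ∷ 𝟎 ∷ 𝟎 ∷ 𝟎 ∷ 𝟏 ∷ 𝟏 ∷ Ops
    o x = th³ (th³ x)

opaque

  -- The functional taking Y and j to Y^j.
  sections : Term (𝟏 ⇒ 𝟎) → Term 𝟏 → Term (𝟏 ⇒ 𝟎 ⇒ 𝟏)
  sections μ X = lam (lam (setOf th³ sectionᶠ _)) ⟪ ops μ ▸ X ⟫

-- The operator to be iterated is a standard functional, with `θ · Z · n = 0` standing for θ(n , Z).
-- Extensionality then gives equal results on extensionally equal sections.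
record _⊩⟨_,_,_⟩ (H : List Form) (μ : Term (𝟏 ⇒ 𝟎)) (X : Term 𝟏) (θ : Term (𝟏 ⇒ 𝟎 ⇒ 𝟎)) : Set where
  constructor mk
  field
    order : H ⊩WO[ μ ] X
    st-θ  : H ⊩ st θ

open _⊩⟨_,_,_⟩

infix 1 _⊩⟨_,_,_⟩
infix 20 ↑ᶜ_

↑ᶜ_ : ∀ {μ X θ} → H ⊩⟨ μ , X , θ ⟩ → A ∷ H ⊩⟨ μ , X , θ ⟩
↑ᶜ mk W s = mk (↑ʷ W) (↑ s)

module _ {μ : Term (𝟏 ⇒ 𝟎)} {X : Term 𝟏} {θ : Term (𝟏 ⇒ 𝟎 ⇒ 𝟎)} where

  sec : Term (𝟏 ⇒ 𝟎 ⇒ 𝟏)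
  sec = sections μ X

  Base : Ctx
  Base = (𝟏 ⇒ 𝟎 ⇒ 𝟏) ∷ (𝟏 ⇒ 𝟎 ⇒ 𝟎) ∷ 𝟏 ∷ Ops

  base′ : Env Base
  base′ = ops μ ▸ X ▸ θ ▸ sec

  Ctxt : List Form → Set
  Ctxt H = H ⊩⟨ μ , X , θ ⟩

  M : Ctxt H → H ⊩μ μ
  M c = search-μ (order c)

  opaque
    unfolding sections

    st-sec : Ctxt H → H ⊩ st sec
    st-sec c = st-⟪⟫ (st-ops (M c) ▸ st-order (order c)) (lam (lam (setOf th³ sectionᶠ _)))

    section-∈ : Ctxt H → H ⊩ st Y → H ⊩ st j → H ⊩ st k →
                H ⊩ sec · Y · j · k ≐ 1̲ ↔ (sectionᶠ ^st) ⟨ ops μ ▸ X ▸ Y ▸ j ▸ k ⟩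
    section-∈ {Y = Y} {j} c sY sj sk = ≐-↔ (app-cong (β₂ (setOf th³ sectionᶠ _) {ops μ ▸ X})) ⨾↔
      set-∈ th³ (λ x → refl) sectionᶠ _ (M c) (st-ops (M c) ▸ st-order (order c) ▸ sY ▸ sj) sk

    section-≼1 : ∀ k → H ⊩ sec · Y · j · k ≼ 1̲
    section-≼1 {Y = Y} {j} k = ≼-≃ (≃sym (app-cong (β₂ (setOf th³ sectionᶠ _) {ops μ ▸ X}))) ≃refl
      (set-≼1 {e = ops μ ▸ X ▸ Y ▸ j} th³ sectionᶠ _ k)

  st-base : Ctxt H → H ⊩st base′
  st-base c = st-ops (M c) ▸ st-order (order c) ▸ st-θ c ▸ st-sec c

  st-section : Ctxt H → H ⊩ st Y → H ⊩ st j → H ⊩ st (sec · Y · j)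
  st-section c sY sj = st-· (st-· (st-sec c) sY) sj

  inclusionᶠ : Fm (𝟎 ∷ 𝟏 ∷ 𝟏 ∷ 𝟏 ∷ Ops)
  inclusionᶠ = ∀ˢᵗ[ 𝟎 ] ltᵒ o (var v4) (var v0) (var v1) ⊃
    (∀ˢᵗ[ 𝟎 ] var v4 · pairᵒ (λ x → there (o x)) (var v0) (var v1) ≐ suc′ O ⊃
             var v3 · pairᵒ (λ x → there (o x)) (var v0) (var v1) ≐ suc′ O)
    where
      o : Ops ⊆ 𝟎 ∷ 𝟎 ∷ 𝟏 ∷ 𝟏 ∷ 𝟏 ∷ Ops
      o x = th³ (th² x)

  -- Y^j ⊆ Y′^j
  _⊑[_]_ : Term 𝟏 → Term 𝟎 → Term 𝟏 → Form
  Y ⊑[ j ] Y′ = inclusionᶠ ⟨ ops μ ▸ X ▸ Y ▸ Y′ ▸ j ⟩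

  section-mono : Ctxt H → H ⊩ st Y → H ⊩ st Y′ → H ⊩ st j → H ⊩ st k → H ⊩ Y ⊑[ j ] Y′ →
                 H ⊩ sec · Y · j · k ≐ 1̲ ⊃ sec · Y′ · j · k ≐ 1̲
  section-mono c sY sY′ sj sk s = lam⊃ λ h → exE (fst (section-∈ (↑ᶜ c) (↑ sY) (↑ sj) (↑ sk)) $ h) λ m g →
    exE (snd g) λ i g′ → let k≃ = eq (fst (snd g′)) in
      snd (section-∈ (↑ᶜ ↑ᶜ ↑ᶜ c) (↑³ sY′) (↑³ sj) (↑³ sk)) $ exI m (↑ fst g & exI i (fst g′ & num k≃ &
        num (ext-app k≃ ⨾ eq (↑³ s $∀ i $ fst g′ $ snd (snd (snd g′)) $∀ m $ ↑ fst g $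
          num (ext-app (≃sym k≃) ⨾ eq (fst (snd (snd g′)))))) &
        snd (snd (snd g′))))

  section-≃ : Ctxt H → H ⊩ st Y → H ⊩ st Y′ → H ⊩ st j → H ⊩ Y ⊑[ j ] Y′ → H ⊩ Y′ ⊑[ j ] Y →
              H ⊩ sec · Y · j ≃ sec · Y′ · j
  section-≃ c sY sY′ sj p q = st-funext (st-section c sY sj) (st-section c sY′ sj) λ k sk →
    ≃-bit (section-≼1 k) (section-≼1 k)
      (section-mono (↑ᶜ c) (↑ sY) (↑ sY′) (↑ sj) sk (↑ p) & section-mono (↑ᶜ c) (↑ sY′) (↑ sY) (↑ sj) sk (↑ q))

  θ-≃ : H ⊩ sec · Y · j ≃ sec · Y′ · j → H ⊩ θ · (sec · Y · j) · n ≃ θ · (sec · Y′ · j) · n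
  θ-≃ p = app-cong (ext-app p)

  -- Y is the result of the recursion below j.
  hierarchyᶠ : Fm (𝟎 ∷ 𝟏 ∷ Base)
  hierarchyᶠ = ∀[ 𝟎 ] ltᵒ o (var v5) (var v0) (var v1) ⊃
    (∀[ 𝟎 ] (var v3 · pairᵒ (λ x → there (o x)) (var v0) (var v1) ≐ suc′ O ⇔
             var v5 · (var v4 · var v3 · var v1) · var v0 ≐ O))
    where
      o : Ops ⊆ 𝟎 ∷ 𝟎 ∷ 𝟏 ∷ Base
      o x = th³ (th³ x)

  Hierarchy : Term 𝟏 → Term 𝟎 → Form
  Hierarchy Y j = (hierarchyᶠ ^st) ⟨ base′ ▸ Y ▸ j ⟩

  -- The premise that i lies below j belongs to the formula, so that the induction can run along all
  -- of `X` instead of an initial segment.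
  agreementᶠ : Fm (𝟎 ∷ 𝟎 ∷ 𝟏 ∷ 𝟏 ∷ 𝟏 ∷ Ops)
  agreementᶠ = ltᵒ o (var v4) (var v0) (var v1) ⊃
    (∀[ 𝟎 ] (var v4 · pairᵒ (λ x → there (o x)) (var v0) (var v1) ≐ suc′ O ⇔
             var v3 · pairᵒ (λ x → there (o x)) (var v0) (var v1) ≐ suc′ O))
    where
      o : Ops ⊆ 𝟎 ∷ 𝟎 ∷ 𝟏 ∷ 𝟏 ∷ 𝟏 ∷ Ops
      o x = th³ (th² x)

  Agreement : Term 𝟏 → Term 𝟏 → Term 𝟎 → Term 𝟎 → Form
  Agreement Y Y′ j i = (agreementᶠ ^st) ⟨ ops μ ▸ X ▸ Y ▸ Y′ ▸ j ▸ i ⟩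

  module _ (c : Ctxt H) (sY : H ⊩ st Y) (sY′ : H ⊩ st Y′) (si : H ⊩ st i)
           (below : ∀ i′ → H ⊩ st i′ ⊃ Lt X i′ i ⊃ Lt X i′ j)
           (agree : ∀ i′ → H ⊩ st i′ ⊃ Lt X i′ i ⊃ Agreement Y Y′ j i′) where

    agreement-section : H ⊩ sec · Y · i ≃ sec · Y′ · i
    agreement-section = section-≃ c sY sY′ si
      (∀st λ i′ si′ → lam⊃ λ l → ∀st λ m sm → lam⊃ λ y →
        fst (↑⁴ agree i′ $ ↑³ si′ $ ↑² l $ (↑⁴ below i′ $ ↑³ si′ $ ↑² l) $∀ m $ ↑ sm) $ y)
      (∀st λ i′ si′ → lam⊃ λ l → ∀st λ m sm → lam⊃ λ y →
        snd (↑⁴ agree i′ $ ↑³ si′ $ ↑² l $ (↑⁴ below i′ $ ↑³ si′ $ ↑² l) $∀ m $ ↑ sm) $ y)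

  -- Below j, both sets obtain column i by applying `θ` to their sections at i. By the induction
  -- hypothesis and transitivity of the order, these sections are equal.
  agreement : Ctxt H → H ⊩ st Y → H ⊩ st Y′ → H ⊩ st j → H ⊩ Hierarchy Y j → H ⊩ Hierarchy Y′ j →
              H ⊩ st i → H ⊩ Le X i i → H ⊩ Agreement Y Y′ j i
  agreement {Y = Y} {Y′} {j} c sY sY′ sj hY hY′ =
    inductionAlong {o = λ x → th⁴ x} {e = ops μ ▸ X ▸ Y ▸ Y′ ▸ j} (λ x → refl) agreementᶠ _
      (order c) (st-ops (M c) ▸ st-order (order c) ▸ sY ▸ sY′ ▸ sj)
      λ i si fi ih → lam⊃ λ lt → ∀st λ m sm →
        let s = agreement-section (↑ᶜ ↑ᶜ ↑ᶜ ↑ᶜ c) (↑⁴ sY) (↑⁴ sY′) (↑ si)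
                  (λ i′ → lam⊃ λ si′ → lam⊃ λ l →
                    Lt-trans (order (↑ᶜ ↑ᶜ ↑ᶜ ↑ᶜ ↑ᶜ ↑ᶜ c)) (↑ si′) (↑³ si) (↑⁶ sj) l (↑² lt))
                  (λ i′ → ↑ ih i′)
        in (↑⁵ hY $∀ i $ ↑² si $ ↑ lt $∀ m $ sm) ⨾↔ ≃⇒↔ (θ-≃ (↑≃ s)) ⨾↔
           ↔sym (↑⁵ hY′ $∀ i $ ↑² si $ ↑ lt $∀ m $ sm)

  hierarchies-section : Ctxt H → H ⊩ st Y → H ⊩ st Y′ → H ⊩ st j → H ⊩ Hierarchy Y j → H ⊩ Hierarchy Y′ j →
                        H ⊩ sec · Y · j ≃ sec · Y′ · j
  hierarchies-section c sY sY′ sj hY hY′ = agreement-section c sY sY′ sj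
    (λ i → lam⊃ λ _ → lam⊃ id)
    (λ i → lam⊃ λ si → lam⊃ λ lt →
      agreement (↑ᶜ ↑ᶜ c) (↑² sY) (↑² sY′) (↑² sj) (↑² hY) (↑² hY′) (↑ si)
        (fst (Le-field (order (↑ᶜ ↑ᶜ c)) (↑ si) (↑² sj) (fst lt))))

  -- Demands made by partial hierarchies

  skip : 𝟎 ∷ 𝟏 ∷ Base ⊆ 𝟎 ∷ 𝟎 ∷ 𝟎 ∷ 𝟏 ∷ Base
  skip v0        = v0
  skip (there x) = there (there (there x))

  -- With k = (n , j), `taskᶠ` is the condition under which Y makes a demand at k, and `valueᶠ` says
  -- whether the demand is membership. Both are arithmetical, so they can be evaluated by terms.
  taskᶠ valueᶠ : Fm (𝟎 ∷ 𝟏 ∷ Base)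
  taskᶠ  = ∃[ 𝟎 ] ∃[ 𝟎 ] var v2 ≐ pairᵒ (λ x → th⁴ (th³ x)) (var v1) (var v0) ∧ ren skip hierarchyᶠ
  valueᶠ = ∃[ 𝟎 ] ∃[ 𝟎 ] var v2 ≐ pairᵒ (λ x → th⁴ (th³ x)) (var v1) (var v0) ∧
                         var v5 · (var v4 · var v3 · var v0) · var v1 ≐ O

  Task Value : Term 𝟏 → Term 𝟎 → Form
  Task Y k  = (taskᶠ ^st) ⟨ base′ ▸ Y ▸ k ⟩
  Value Y k = (valueᶠ ^st) ⟨ base′ ▸ Y ▸ k ⟩

  task-hierarchy : ∀ {k n} → ((ren skip hierarchyᶠ ^st) ⟨ base′ ▸ Y ▸ k ▸ n ▸ j ⟩) ~ Hierarchy Y j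
  task-hierarchy = ren-⟨⟩ {r = skip} (λ { v0 → refl ; (there x) → refl }) (hierarchyᶠ ^st)

  task-intro : H ⊩ st n → H ⊩ st j → H ⊩ Hierarchy Y j → H ⊩ Task Y (pairᵗ n j)
  task-intro sn sj h = exI _ (sn & exI _ (sj & num ≃refl & conv (~sym task-hierarchy) h))

  value-pair : H ⊩ st n → H ⊩ st j → H ⊩ Value Y (pairᵗ n j) ↔ θ · (sec · Y · j) · n ≐ O̲
  value-pair {n = n} {j = j} sn sj =
    (lam⊃ λ h → exE h λ n′ g → exE (snd g) λ j′ g′ → let p = eq (fst (snd g′)) in
      num (ext-app (ext-app (pairᵗ-injʳ p) ) ·≃ pairᵗ-injˡ p ⨾ eq (snd (snd g′)))) &
    (lam⊃ λ h → exI n (↑ sn & exI j (↑ sj & num ≃refl & h)))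

  value-transport : Ctxt H → H ⊩ st Y → H ⊩ st Y′ → H ⊩ Task Y k → H ⊩ Task Y′ k →
                    H ⊩ Value Y k → H ⊩ Value Y′ k
  value-transport {k = k} c sY sY′ t t′ v = exE t λ n₀ g₀ → exE (snd g₀) λ j₀ g →
    exE (↑² t′) λ n₁ g₁ → exE (snd g₁) λ j₁ g′ → exE (↑⁴ v) λ n g₂ → exE (snd g₂) λ j g″ →
      let p = ↑≃ ↑≃ ↑≃ ↑≃ eq (fst (snd g))
          p′ = ↑≃ ↑≃ eq (fst (snd g′))
          p″ = eq (fst (snd g″))
          sj = fst g″
          -- The two tasks and the value decode `k` separately; injectivity of pairing moves both
          -- hierarchy statements to the `j` of the value.
          h = leibniz (hierarchyᶠ ^st) (≈refl ▸ pairᵗ-injʳ (≃sym p ⨾ p″))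
                (↑⁴ conv task-hierarchy (snd (snd g)))
          h′ = leibniz (hierarchyᶠ ^st) (≈refl ▸ pairᵗ-injʳ (≃sym p′ ⨾ p″))
                 (↑² conv task-hierarchy (snd (snd g′)))
      in exI n (↑ fst g₂ & exI j (sj & num p″ & num (θ-≃ (hierarchies-section
           (↑ᶜ ↑ᶜ ↑ᶜ ↑ᶜ ↑ᶜ ↑ᶜ c) (↑⁶ sY′) (↑⁶ sY) sj h′ h) ⨾ eq (snd (snd g″)))))

  -- A function v codes the number v 0 together with the function x ↦ v (x + 1).
  tailOf : Term 𝟏 → Term 𝟏
  tailOf v = con S · (con K · v) · con suc

  onCodeᵇ : Tm (𝟏 ∷ (𝟏 ⇒ 𝟎 ⇒ 𝟎) ∷ []) 𝟎
  onCodeᵇ = var v1 · (con S · (con K · var v0) · con suc) · (var v0 · O)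

  onCode : Term (𝟏 ⇒ 𝟎 ⇒ 𝟎) → Term (𝟏 ⇒ 𝟎)
  onCode F = lam onCodeᵇ ⟪ ∅ ▸ F ⟫

  onCode-β : ∀ {F v} → H ⊩ onCode F · v ≃ F · tailOf v · (v · O̲)
  onCode-β {F = F} = β onCodeᵇ {∅ ▸ F}

  joinᵇ : Tm (𝟎 ∷ 𝟏 ∷ 𝟎 ∷ []) 𝟎
  joinᵇ = rec (var v0) (var v2) (lam (lam (var v3 · var v0)))

  join : Term 𝟎 → Term 𝟏 → Term 𝟏
  join k Y = lam joinᵇ ⟪ ∅ ▸ k ▸ Y ⟫

  join-head : H ⊩ join k Y · O̲ ≃ k
  join-head {k = k} {Y} = β joinᵇ {∅ ▸ k ▸ Y} ⨾ rec-O̲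

  join-tail : H ⊩ tailOf (join k Y) ≃ Y
  join-tail {k = k} {Y} = funext λ x → S-eq ⨾ app-cong K-eq ⨾ β joinᵇ {∅ ▸ k ▸ Y} ⨾
    rec-lam (var v3 · var v0) {∅ ▸ k ▸ Y ▸ x}

  ops₅ : Ops ⊆ 𝟎 ∷ 𝟏 ∷ Base
  ops₅ x = th³ (th² x)

  opaque

    isTask value : Term (𝟏 ⇒ 𝟎 ⇒ 𝟎)
    isTask = lam (lam (T ops₅ taskᶠ _)) ⟪ base′ ⟫
    value  = lam (lam (ifz (T ops₅ valueᶠ _) (suc′ O) O)) ⟪ base′ ⟫

    isTask-spec : Ctxt H → H ⊩ st Y → H ⊩ st k → H ⊩ isTask · Y · k ≐ O̲ ↔ Task Y k
    isTask-spec c sY sk = ≃⇒↔ (β₂ (T ops₅ taskᶠ _) {base′}) ⨾↔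
      T-spec ops₅ (λ x → refl) taskᶠ _ (M c) (st-base c ▸ sY ▸ sk)

    value-spec : Ctxt H → H ⊩ st Y → H ⊩ st k → H ⊩ value · Y · k ≐ 1̲ ↔ Value Y k
    value-spec c sY sk = ≐-↔ (β₂ (ifz (T ops₅ valueᶠ _) (suc′ O) O) {base′}) ⨾↔ ifz-1̲ ⨾↔
      T-spec ops₅ (λ x → refl) valueᶠ _ (M c) (st-base c ▸ sY ▸ sk)

    value-≼1 : ∀ Y k → H ⊩ value · Y · k ≼ 1̲
    value-≼1 Y k = ≼-≃ (≃sym (β₂ (ifz (T ops₅ valueᶠ _) (suc′ O) O) {base′})) ≃refl
      (split (T ops₅ valueᶠ _ ⟪ base′ ▸ Y ▸ k ⟫)
        (λ z → ≼-reflexive (ifz-O̲ z))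
        (λ z → ≼-≃ (≃sym (ifz-S̲ z)) ≃refl O̲≼))

  st-tailOf : ∀ {v} → H ⊩ st v → H ⊩ st (tailOf v)
  st-tailOf sv = st-· (st-· st-con (st-· st-con sv)) st-con

  values-agree : Ctxt H → H ⊩ st Y → H ⊩ st Y′ → H ⊩ st k → H ⊩ isTask · Y · k ≐ O̲ → H ⊩ isTask · Y′ · k ≐ O̲ →
                 H ⊩ value · Y · k ≃ value · Y′ · k
  values-agree c sY sY′ sk t t′ = ≃-bit (value-≼1 _ _) (value-≼1 _ _)
    (value-spec c sY sk ⨾↔
     ((lam⊃ λ v → value-transport (↑ᶜ c) (↑ sY) (↑ sY′) (↑ q) (↑ q′) v) &
      (lam⊃ λ v → value-transport (↑ᶜ c) (↑ sY′) (↑ sY) (↑ q′) (↑ q) v)) ⨾↔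
     ↔sym (value-spec c sY′ sk))
    where
      q  = fst (isTask-spec c sY sk) $ t
      q′ = fst (isTask-spec c sY′ sk) $ t′

  consistent : Ctxt H → H ⊩ Consistent ⟨ ∅ ▸ onCode isTask ▸ onCode value ⟩
  consistent c = allI λ v → lam⊃ λ sv → allI λ v′ → lam⊃ λ sv′ → lam⊃ λ t → lam⊃ λ t′ → lam⊃ λ p →
    num (onCode-β ⨾ ext-app (eq p) ⨾ values-agree (↑ᶜ ↑ᶜ ↑ᶜ ↑ᶜ ↑ᶜ c)
      (st-tailOf (↑⁴ sv)) (st-tailOf (↑³ sv′)) (st-· (↑³ sv′) st-con)
      (num (ext-app (≃sym (eq p)) ⨾ ≃sym onCode-β ⨾ eq (↑² t)))
      (num (≃sym onCode-β ⨾ eq (↑ t′))) ⨾ ≃sym onCode-β)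

  -- Existence of the recursion

  solutionᶠ : Fm (𝟏 ∷ Base)
  solutionᶠ = ∀ˢᵗ[ 𝟎 ] leᵒ (λ x → there (th⁴ x)) (var v4) (var v0) (var v0) ⊃
    (∀ˢᵗ[ 𝟎 ] (var v2 · pairᵒ (λ x → th² (th⁴ x)) (var v0) (var v1) ≐ suc′ O ⇔
               var v4 · (var v3 · var v2 · var v1) · var v0 ≐ O))

  stepᶠ : Fm (𝟎 ∷ 𝟏 ∷ Base)
  stepᶠ = ∀[ 𝟎 ] (var v2 · pairᵒ (λ x → th² (th⁴ x)) (var v0) (var v1) ≐ suc′ O ⇔
                  var v4 · (var v3 · var v2 · var v1) · var v0 ≐ O)

  solution : Ctxt H → H ⊩ (∃ˢᵗ[ 𝟏 ] solutionᶠ) ⟨ base′ ⟩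
  solution c = exE (standardSolution (consistent c) (λ v → ≼-≃ (≃sym onCode-β) ≃refl (value-≼1 _ _))) λ Z h →
    let c₁ = ↑ᶜ c
        sZ = fst h
    in exI Z (sZ & ∀st λ j sj → lam⊃ λ fj →
      inductionAlong {o = λ x → th⁴ x} {e = base′ ▸ Z} (λ x → refl) stepᶠ _ (order (↑ᶜ ↑ᶜ c₁))
        (st-base (↑ᶜ ↑ᶜ c₁) ▸ ↑² sZ)
        (λ j sj fj ih → ∀st λ n sn →
          -- The induction hypothesis makes `Z` a hierarchy below `j`, hence the source of a demand
          -- at (n , j). `join (pairᵗ n j) Z` is the code of that demand, and `z` says that `Z`
          -- meets it.
          let t  = task-intro sn (↑ sj) (∀st λ i si → lam⊃ λ lt → ∀st λ m sm →
                     ↑⁴ ih i $ ↑² si $ ↑ lt $∀ m $ sm)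
              c₆ = ↑ᶜ ↑ᶜ ↑ᶜ ↑ᶜ ↑ᶜ ↑ᶜ c₁
              sk = st-pairᵗ sn (↑ sj)
              s  = st-⟪⟫ (∅ ▸ sk ▸ ↑⁶ sZ) (lam joinᵇ)
              z  = ↑⁶ snd h $∀ join (pairᵗ n j) Z $ s $
                     num (onCode-β ⨾ ext-app join-tail ·≃ join-head ⨾ eq (snd (isTask-spec c₆ (↑⁶ sZ) sk) $ t))
          in ≐-↔ (ext-app (≃sym join-head) ⨾ eq z ⨾ onCode-β ⨾ ext-app join-tail ·≃ join-head) ⨾↔
             value-spec c₆ (↑⁶ sZ) sk ⨾↔ value-pair sn (↑ sj))
        (↑ sj) fj)

  -- Restriction to the field of the order

  restrictionᶠ : Fm (𝟎 ∷ 𝟏 ∷ 𝟏 ∷ Ops)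
  restrictionᶠ = ∃[ 𝟎 ] ∃[ 𝟎 ] var v2 ≐ pairᵒ o (var v1) (var v0) ∧
    (leᵒ o (var v4) (var v0) (var v0) ∧ var v3 · var v2 ≐ suc′ O)
    where
      o : Ops ⊆ 𝟎 ∷ 𝟎 ∷ 𝟎 ∷ 𝟏 ∷ 𝟏 ∷ Ops
      o x = th³ (th² x)

  opaque

    -- `L₂.H` admits only pairs (n , j) with j in the field as elements, but the solution `Z` is
    -- unconstrained elsewhere; the excess is cut off.
    restriction : Term 𝟏 → Term 𝟏
    restriction Z = setOf th² restrictionᶠ _ ⟪ ops μ ▸ X ▸ Z ⟫

    st-restriction : Ctxt H → H ⊩ st Z → H ⊩ st (restriction Z)
    st-restriction c sZ = st-⟪⟫ (st-ops (M c) ▸ st-order (order c) ▸ sZ) (setOf th² restrictionᶠ _)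

    restriction-∈ : Ctxt H → H ⊩ st Z → H ⊩ st k →
                    H ⊩ restriction Z · k ≐ 1̲ ↔ (restrictionᶠ ^st) ⟨ ops μ ▸ X ▸ Z ▸ k ⟩
    restriction-∈ c sZ sk =
      set-∈ th² (λ x → refl) restrictionᶠ _ (M c) (st-ops (M c) ▸ st-order (order c) ▸ sZ) sk

    restriction-≼1 : ∀ k → H ⊩ restriction Z · k ≼ 1̲
    restriction-≼1 {Z = Z} k = set-≼1 {e = ops μ ▸ X ▸ Z} th² restrictionᶠ _ k

  restriction-pair : Ctxt H → H ⊩ st Z → H ⊩ st n → H ⊩ st j → H ⊩ Le X j j →
                     H ⊩ restriction Z · pairᵗ n j ≐ 1̲ ↔ Z · pairᵗ n j ≐ 1̲
  restriction-pair c sZ sn sj fj = restriction-∈ c sZ (st-pairᵗ sn sj) ⨾↔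
    ((lam⊃ λ h → exE h λ n′ g → exE (snd g) λ j′ g′ → snd (snd (snd g′))) &
     (lam⊃ λ h → exI _ (↑ sn & exI _ (↑ sj & num ≃refl & ↑ fj & h))))

  -- A section at `j` consists of columns strictly below `j`, and these belong to elements of the
  -- field, where nothing has been cut off.
  restriction-section : Ctxt H → H ⊩ st Z → H ⊩ st j → H ⊩ sec · Z · j ≃ sec · restriction Z · j
  restriction-section {Z = Z} {j} c sZ sj = section-≃ c sZ (st-restriction c sZ) sj
      (∀st λ i si → lam⊃ λ lt → ∀st λ m sm → snd (same i m (↑² si) (↑ lt) sm))
      (∀st λ i si → lam⊃ λ lt → ∀st λ m sm → fst (same i m (↑² si) (↑ lt) sm))
    where
      same : ∀ {A B C} i m → A ∷ B ∷ C ∷ _ ⊩ st i → A ∷ B ∷ C ∷ _ ⊩ Lt X i j → A ∷ B ∷ C ∷ _ ⊩ st m →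
             A ∷ B ∷ C ∷ _ ⊩ restriction Z · pairᵗ m i ≐ 1̲ ↔ Z · pairᵗ m i ≐ 1̲
      same i m si lt sm = let c₃ = ↑ᶜ ↑ᶜ ↑ᶜ c in
        restriction-pair c₃ (↑³ sZ) sm si (fst (Le-field (order c₃) si (↑³ sj) (fst lt)))

  fieldᶠ : Fm (𝟏 ∷ Base)
  fieldᶠ = ∀ˢᵗ[ 𝟎 ] var v1 · var v0 ≐ suc′ O ⊃
    (∃ˢᵗ[ 𝟎 ] ∃ˢᵗ[ 𝟎 ] var v2 ≐ pairᵒ (λ x → th³ (th⁴ x)) (var v1) (var v0) ∧
                     leᵒ (λ x → th³ (th⁴ x)) (var (there v5)) (var v0) (var v0))

  recursion : H ⊩⟨ μ , X , θ ⟩ →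
    H ⊩ (∃ˢᵗ[ 𝟏 ] (∀[ 𝟎 ] var (there v5) · (var v1 · var v0) · suc′ O ≐ O) ∧ fieldᶠ ∧ solutionᶠ) ⟨ base′ ⟩
  recursion c = exE (solution c) λ Z h → let c₁ = ↑ᶜ c; sZ = fst h in exI (restriction Z)
    (st-restriction c₁ sZ &
     allI (λ n → restriction-≼1 n) &
     (∀st λ k sk → lam⊃ λ y → exE (fst (restriction-∈ (↑ᶜ ↑ᶜ c₁) (↑² sZ) (↑ sk)) $ y) λ n g →
       exE (snd g) λ j g′ → exI n (↑ fst g & exI j (fst g′ & fst (snd g′) & fst (snd (snd g′))))) &
     (∀st λ j sj → lam⊃ λ fj → ∀st λ n sn →
       restriction-pair (↑ᶜ ↑ᶜ ↑ᶜ c₁) (↑³ sZ) sn (↑² sj) (↑ fj) ⨾↔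
       (↑³ snd h $∀ j $ ↑² sj $ ↑ fj $∀ n $ sn) ⨾↔
       ≃⇒↔ (θ-≃′ (restriction-section (↑ᶜ ↑ᶜ ↑ᶜ c₁) (↑³ sZ) (↑² sj)))))
    where
      θ-≃′ : ∀ {H n} {Y Y′ : Term 𝟏} → H ⊩ Y ≃ Y′ → H ⊩ θ · Y · n ≃ θ · Y′ · n
      θ-≃′ p = app-cong (ext-app p)

-- The axioms of ATR₀

module _ {Ξ : L₂.Ctx} {μ : Term (𝟏 ⇒ 𝟎)} {e : Env ⟦ Ξ ⟧ᶜ}
         (θ : L₂.Fm (L₂.num ∷ L₂.set ∷ Ξ)) (p : L₂.Arithmetical θ) where

  private
    Outer : L₂.Ctx → L₂.Ctx
    Outer Ξ = L₂.num ∷ L₂.num ∷ L₂.num ∷ L₂.set ∷ L₂.set ∷ Ξ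

    -- The parts of `L₂.H` that do not involve the formula θ are stated over contexts without
    -- parameters, where the sections and the recursion live, and are carried by renaming to the
    -- context with `Ξ`.
    inField : L₂.Fm (Outer Ξ′)
    inField = L₂.var v2 L₂.≐ L₂.pair (L₂.var v1) (L₂.var v0) L₂.∧ L₂.Field v4 (L₂.var v0)

    Inner : L₂.Ctx
    Inner = L₂.set ∷ L₂.num ∷ L₂.set ∷ L₂.set ∷ []

    isSection : L₂.Fm Inner
    isSection = L₂.IsSection v0 v2 v3 v1

    outer : Outer [] ⊆ Outer Ξ
    outer v0 = v0
    outer v1 = v1
    outer v2 = v2
    outer v3 = v3
    outer v4 = v4

    order-only : L₂.set ∷ [] ⊆ L₂.set ∷ Ξ
    order-only v0 = v0

    inner : Inner ⊆ L₂.set ∷ Outer Ξ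
    inner v0 = v0
    inner v1 = v1
    inner v2 = v4
    inner v3 = v5

    opaque

      θᵗ : Term (𝟏 ⇒ 𝟎 ⇒ 𝟎)
      θᵗ = lam (lam (T (λ x → th² (op Ξ x)) (tr θ) (tr-Arithmetical θ p))) ⟪ e ⟫

      st-θᵗ : Good H μ Ξ e → H ⊩ st θᵗ
      st-θᵗ g = st-⟪⟫ (good-st g) (lam (lam (T (λ x → th² (op Ξ x)) (tr θ) (tr-Arithmetical θ p))))

      θᵗ-spec : ∀ {Z} → Good H μ Ξ e → H ⊩ st Z → H ⊩ st n →
                H ⊩ θᵗ · Z · n ≐ O̲ ↔ (tr θ ^st) ⟨ e ▸ Z ▸ n ⟩
      θᵗ-spec g sZ sn = ≃⇒↔ (β₂ (T (λ x → th² (op Ξ x)) (tr θ) (tr-Arithmetical θ p))) ⨾↔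
        T-spec (λ x → th² (op Ξ x)) (good-Interprets g) (tr θ) (tr-Arithmetical θ p) (good-μ g)
          (good-st g ▸ sZ ▸ sn)

    module _ {X Y : Term 𝟏} {k n j : Term 𝟎} where

      inField-~ : Good H μ Ξ e → ((tr inField ^st) ⟨ e ▸ X ▸ Y ▸ k ▸ n ▸ j ⟩) ~
                  ((tr (inField {[]}) ^st) ⟨ ops μ ▸ X ▸ Y ▸ k ▸ n ▸ j ⟩)
      inField-~ g = tr-ren-⟨⟩ {ρ = outer} {ops μ ▸ X ▸ Y ▸ k ▸ n ▸ j} {e ▸ X ▸ Y ▸ k ▸ n ▸ j}
        (λ { v0 → refl ; v1 → refl ; v2 → refl ; v3 → refl ; v4 → refl })
        (good-Interprets g) (inField {[]})

      isSection-~ : ∀ {Z} → Good H μ Ξ e →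
        ((tr (L₂.IsSection v0 v4 v5 v1) ^st) ⟨ e ▸ X ▸ Y ▸ k ▸ n ▸ j ▸ Z ⟩) ~
        ((tr isSection ^st) ⟨ ops μ ▸ X ▸ Y ▸ j ▸ Z ⟩)
      isSection-~ {Z = Z} g = tr-ren-⟨⟩ {ρ = inner} {ops μ ▸ X ▸ Y ▸ j ▸ Z} {e ▸ X ▸ Y ▸ k ▸ n ▸ j ▸ Z}
        (λ { v0 → refl ; v1 → refl ; v2 → refl ; v3 → refl })
        (good-Interprets g) isSection

      place-~ : ∀ {Z} → ((tr (L₂.ren (L₂.place θ) θ) ^st) ⟨ e ▸ X ▸ Y ▸ k ▸ n ▸ j ▸ Z ⟩) ~
                ((tr θ ^st) ⟨ e ▸ Z ▸ n ⟩)
      place-~ {Z = Z} = tr-ren-⟨⟩ {e = e ▸ Z ▸ n} {e ▸ X ▸ Y ▸ k ▸ n ▸ j ▸ Z}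
        (λ { v0 → refl ; v1 → refl ; (there (there x)) → refl }) (λ x → refl) θ

    under : 𝟎 ∷ 𝟎 ∷ 𝟏 ∷ 𝟏 ∷ Ops ⊆ 𝟎 ∷ 𝟏 ∷ 𝟎 ∷ 𝟏 ∷ 𝟏 ∷ Ops
    under v0        = v0
    under (there x) = there (there x)

    section-~ : ∀ {X Y Z j k} → ((ren under (sectionᶠ ^st)) ⟨ ops μ ▸ X ▸ Y ▸ j ▸ Z ▸ k ⟩) ~
                                ((sectionᶠ ^st) ⟨ ops μ ▸ X ▸ Y ▸ j ▸ k ⟩)
    section-~ = ren-⟨⟩ {r = under} (λ { v0 → refl ; (there x) → refl }) (sectionᶠ ^st)

    module _ {X Y : Term 𝟏} {ϑ : Term (𝟏 ⇒ 𝟎 ⇒ 𝟎)} (c : H ⊩⟨ μ , X , ϑ ⟩) (sY : H ⊩ st Y) (sj : H ⊩ st j) where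

      sections-isSection : H ⊩ (tr isSection ^st) ⟨ ops μ ▸ X ▸ Y ▸ j ▸ sections μ X · Y · j ⟩
      sections-isSection = ∀st λ k sk → section-∈ (↑ᶜ c) (↑ sY) (↑ sj) sk ⨾↔
        ((lam⊃ λ h → conv (~sym section-~) h) & (lam⊃ λ h → conv section-~ h))

      -- `L₂.H` quantifies existentially over a set equal to the section. Uniqueness up to
      -- extensional equality turns this back into applying the functional `θᵗ` to the section
      -- itself.
      isSection-unique : ∀ {Z} → H ⊩ st Z → (∀ {n} → st n ∷ H ⊩ st n → st n ∷ H ⊩ Z · n ≼ 1̲) →
                         H ⊩ (tr isSection ^st) ⟨ ops μ ▸ X ▸ Y ▸ j ▸ Z ⟩ → H ⊩ Z ≃ sections μ X · Y · j
      isSection-unique sZ bZ s = st-funext sZ (st-section c sY sj) λ k sk → ≃-bit (bZ sk) (section-≼1 {θ = ϑ} k)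
        ((↑ s $∀ k $ sk) ⨾↔ ((lam⊃ λ h → conv section-~ h) & (lam⊃ λ h → conv (~sym section-~) h)) ⨾↔
         ↔sym (section-∈ (↑ᶜ c) (↑ sY) (↑ sj) sk))

    wo-~ : ∀ {X} → Good H μ Ξ e →
           ((tr (L₂.WO v0) ^st) ⟨ e ▸ X ⟩) ~ ((tr {L₂.set ∷ []} (L₂.WO v0) ^st) ⟨ ops μ ▸ X ⟩)
    wo-~ {X = X} g = tr-ren-⟨⟩ {ρ = order-only} {ops μ ▸ X} {e ▸ X} (λ { v0 → refl })
      (good-Interprets g) (L₂.WO v0)

    module _ {X Y : Term 𝟏} (g : Good H μ Ξ e) (c : H ⊩⟨ μ , X , θᵗ ⟩) (sY : H ⊩ st Y)
             (sk : H ⊩ st k) (sn : H ⊩ st n) (sj : H ⊩ st j) where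

      stage-intro : H ⊩ θᵗ · (sections μ X · Y · j) · n ≐ O̲ →
        H ⊩ (tr (L₂.∃ˢ L₂.IsSection v0 v4 v5 v1 L₂.∧ L₂.ren (L₂.place θ) θ) ^st) ⟨ e ▸ X ▸ Y ▸ k ▸ n ▸ j ⟩
      stage-intro t = exI (sections μ X · Y · j) (st-section c sY sj &
        binaryᵒ-intro (g ▸ st-order (order c) ▸ sY ▸ sk ▸ sn ▸ sj) (section-≼1 {θ = θᵗ}) &
        conv (~sym (isSection-~ g)) (sections-isSection c sY sj) &
        conv (~sym place-~) (fst (θᵗ-spec g (st-section c sY sj) sn) $ t))

      stage-elim :
        H ⊩ (tr (L₂.∃ˢ L₂.IsSection v0 v4 v5 v1 L₂.∧ L₂.ren (L₂.place θ) θ) ^st) ⟨ e ▸ X ▸ Y ▸ k ▸ n ▸ j ⟩ →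
        H ⊩ θᵗ · (sections μ X · Y · j) · n ≐ O̲
      stage-elim h = exE h λ Z s →
        let sZ = fst s
            g₁ = ↑ᵍ g
            Z≃ = isSection-unique (↑ᶜ c) (↑ sY) (↑ sj) sZ
                   (λ sm → binaryᵒ-elim (↑ᵍ ↑ᵍ (g ▸ st-order (order c) ▸ sY ▸ sk ▸ sn ▸ sj))
                             (↑ fst (snd s)) sm)
                   (conv (isSection-~ g₁) (fst (snd (snd s))))
        in num (app-cong (ext-app (≃sym Z≃)) ⨾
                eq (snd (θᵗ-spec g₁ sZ (↑ sn)) $ conv place-~ (snd (snd (snd s)))))

  transfinite-recursion : Good H μ Ξ e → H ⊩ (tr (L₂.∀ˢ L₂.WO v0 L₂.⊃ (L₂.∃ˢ L₂.H θ)) ^st) ⟨ e ⟩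
  transfinite-recursion g = allI λ X → lam⊃ λ sX → lam⊃ λ _ → lam⊃ λ wo →
    let g₃ = ↑ᵍ ↑ᵍ ↑ᵍ g
        c₃ = mk (mk (good-μ g₃) (↑² sX) (conv (wo-~ g₃) wo)) (st-θᵗ g₃)
    in exE (recursion c₃) λ Y h →
      let g₄ = ↑ᵍ g₃
          c₄ = ↑ᶜ c₃
          sY = fst h
          elements = fst (snd (snd h))
          recursive = snd (snd (snd h))
      in exI Y (sY & binaryᵒ-intro (g₄ ▸ ↑³ sX) (λ n → fst (snd h) $∀ n) & ∀st λ k sk →
        (lam⊃ λ y → exE (↑² elements $∀ k $ ↑ sk $ y) λ n a → exE (snd a) λ j b →
          let g₈ = ↑ᵍ ↑ᵍ ↑ᵍ ↑ᵍ g₄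
              c₈ = ↑ᶜ ↑ᶜ ↑ᶜ ↑ᶜ c₄
              sn = ↑ fst a
              sj = fst b
              k≐ = fst (snd b)
              fj = snd (snd b)
              f  = conv (~sym (inField-~ {X = X} {Y} {k} {n} {j} g₈)) (k≐ & fj)
          in exI n (sn & exI j (sj & fst f & snd f & stage-intro g₈ c₈ (↑⁴ sY) (↑³ sk) sn sj
               (fst (↑⁴ recursive $∀ j $ sj $ fj $∀ n $ sn) $ num (ext-app (≃sym (eq k≐)) ⨾ eq (↑² y)))))) &
        (lam⊃ λ y → exE y λ n a → exE (snd a) λ j b →
          let g₈ = ↑ᵍ ↑ᵍ ↑ᵍ ↑ᵍ g₄
              c₈ = ↑ᶜ ↑ᶜ ↑ᶜ ↑ᶜ c₄
              sn = ↑ fst a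
              sj = fst b
              f  = conv (inField-~ {X = X} {Y} {k} {n} {j} g₈) (fst (snd b) & fst (snd (snd b)))
          in num (ext-app (eq (fst f)) ⨾ eq (snd (↑⁴ recursive $∀ j $ sj $ snd f $∀ n $ sn) $
               stage-elim g₈ c₈ (↑⁴ sY) (↑³ sk) sn sj (snd (snd (snd b)))))))

valid : ∀ {A} → L₂.ATR₀ A → Valid A
valid L₂.+1-nonzero                   = valid-+1-nonzero
valid L₂.+1-inj                       = valid-+1-inj
valid L₂.+-zero M                     = ∀st λ n _ → num ⊞-O̲
valid L₂.+-suc                        = valid-+-suc
valid L₂.*-zero M                     = ∀st λ n _ → num ⊠-O̲
valid L₂.*-suc                        = valid-*-suc
valid L₂.<-zero M                     = ∀st λ n _ → lam⊃ ⊀O̲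
valid L₂.<-suc                        = valid-<-suc
valid L₂.induction                    = valid-induction
valid (L₂.comprehension Ξ φ p)        = close _ (comprehension φ p)
valid (L₂.transfinite-recursion Ξ θ p) = close _ (transfinite-recursion θ p)

theorem6p4 : (P₀ ⊕ Π⁰₁-TRANS ⊕ STP) Proves ATR₀^st
theorem6p4 (relativised {A} a) = extract A (exE search λ μ h →
  conv (tr-closed A) (valid a (mk (fst h) (snd h))))
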